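{- Let $t\ge 2$ and $\ell\ge (19.1t)^9$ be integers, and let $n$ be a positive integer such that $(t-1)(2\ell-1)\le n-1 < t(2\ell-1)$. Then $$R(C_{2\ell},K_{1,n}) = f_t(\ell,n)+1,\qquad\text{where } f_t(\ell,n)=\max\Big\{t(2\ell-1),\ n+\Big\lfloor \frac{n-1}{t}\Big\rfloor\Big\}.$$
   Context: $C_{2\ell}$ denotes the cycle of length $2\ell$ and $K_{1,n}$ the star with $n$ edges. The Ramsey number $R(C_{2\ell},K_{1,n})$ is the minimum $N$ such that every graph $G$ on $N$ vertices either contains $C_{2\ell}$ as a subgraph or its complement $\overline{G}$ contains $K_{1,n}$; equivalently, the minimum $N$ such that every graph on $N$ vertices with minimum degree at least $N-n$ contains a copy of $C_{2\ell}$. -}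

module Defs where

open import Data.Nat using (ℕ; zero; suc; _+_; _*_; _∸_; _≤_; _<_; _⊔_; NonZero)
open import Data.Nat.DivMod using (_/_)
open import Data.Fin using (Fin; toℕ; zero; suc)
open import Data.Bool using (Bool; true; false)
open import Data.Product using (Σ; ∃; _×_; _,_)
open import Function.Definitions using (Injective)
open import Relation.Binary.PropositionalEquality using (_≡_; _≢_)
open import Relation.Nullary using (¬_)

record Graph (N : ℕ) : Set where
  field
    adj   : Fin N → Fin N → Bool
    sym   : ∀ u v → adj u v ≡ adj v u
    irrefl : ∀ v → adj v v ≡ false

open Graph public

Adj : ∀ {N} → Graph N → Fin N → Fin N → Set
Adj G u v = adj G u v ≡ true

-- cyclic successor on Fin k : i ↦ i+1 for i < k-1, and k-1 ↦ 0
next : ∀ {k} → Fin k → Fin k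
next {suc zero} zero = zero
next {suc (suc k)} zero = suc zero
next {suc (suc k)} (suc i) with next {suc k} i
... | zero = zero
... | suc j = suc (suc j)

-- G contains a cycle of length k (k ≥ 3 intended) as a subgraph:
-- an injective map of Fin k into the vertices with cyclically consecutive images adjacent.
ContainsCycle : ∀ {N} → ℕ → Graph N → Set
ContainsCycle {N} k G =
  Σ (Fin k → Fin N) λ φ → Injective _≡_ _≡_ φ × (∀ i → Adj G (φ i) (φ (next i)))

ComplContainsStar : ∀ {N} → ℕ → Graph N → Set
ComplContainsStar {N} n G =
  Σ (Fin N) λ v → Σ (Fin n → Fin N) λ ψ →
    Injective _≡_ _≡_ ψ × (∀ i → ψ i ≢ v) × (∀ i → adj G v (ψ i) ≡ false)

Arrows : ℕ → ℕ → ℕ → Set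
Arrows ℓ n N = (G : Graph N) → (ContainsCycle (2 * ℓ) G) Data.Sum.⊎ (ComplContainsStar n G)
  where import Data.Sum

IsRamseyCycleStar : ℕ → ℕ → ℕ → Set
IsRamseyCycleStar ℓ n R = Arrows ℓ n R × (∀ N → Arrows ℓ n N → R ≤ N)

f : (t ℓ n : ℕ) → .{{NonZero t}} → ℕ
f t ℓ n = (t * (2 * ℓ ∸ 1)) ⊔ (n + (n ∸ 1) / t)

{-# OPTIONS --safe #-}
-- Upper bound. Let G have N = f + 1 vertices and no star K_{1,n} in its complement, and put d = N - n.
-- All degrees are at least d ≥ N / (t + 1). Splitting G repeatedly at single vertices gives pieces in which
-- the vertices not used for splitting keep their degrees; as a piece has more than d vertices, there are at most t
-- pieces, and in one of them at least 2ℓ vertices have degree linear in ℓ. If there are not many more than 2ℓ of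
-- these, the Bondy–Chvátal closure shows that 2ℓ of them span a Hamiltonian cycle. Otherwise separators of size
-- κ = O(ℓ / t) are removed until a cluster is left, a highly connected subgraph of minimum degree above ℓ.
-- Inside a cluster there are paths of every prescribed moderate length between two given vertices x and y: reserve
-- three small connected dominating sets, build a short connection of flexible length from 4-cycles (each passed
-- along one or three edges) and from two paths whose lengths differ by one, take a long path in the rest by Dirac's
-- crossing argument, and link the parts through the reserved sets. The two paths come from an edge within a level
-- of a breadth-first search; if there is none, the cluster is bipartite and parity takes care of itself.
-- If no separator had to be removed, one cluster suffices. Otherwise there are two clusters, which are joined by
-- two short disjoint paths since the piece cannot be split by a single vertex, and the cycle runs through both.
--
-- Lower bound. Take t disjoint cliques on 2ℓ - 1 vertices or, with n - 1 = q t + r, r disjoint cliques on q + 1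
-- vertices together with t + 1 - r cliques on q + 1 vertices that share one vertex.

module Submission where

open import Defs hiding (sym)
open import Data.Nat using (ℕ; suc; _+_; _*_; _∸_; _^_; _≤_; _<_; NonZero)
open import Data.Nat using (zero; _⊔_; _≤?_; _<?_; _≤ᵇ_; z≤n; s≤s; s≤s⁻¹; >-nonZero)
open import Data.Nat.DivMod using (_/_; _%_; m≡m%n+[m/n]*n; m%n<n; m<n*o⇒m/o<n)
open import Data.Nat.Properties hiding (_≟_)
open import Data.Nat.Properties using () renaming (_≟_ to _≟ⁿ_)
open import Data.Nat.Tactic.RingSolver using (solve-∀)
open import Algebra.Properties.CommutativeMonoid.Sum +-0-commutativeMonoid using (sum; sum-cong-≗; ∑-distrib-+; ∑-comm)
open import Data.Bool using (Bool; true; false; T; _∧_; _∨_; not; if_then_else_)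
open import Data.Bool.Properties using (∨-comm; not-involutive)
open import Data.Empty using (⊥; ⊥-elim)
open import Data.Fin using (Fin; zero; suc; toℕ; fromℕ; fromℕ<; inject₁; inject≤; combine; remQuot; splitAt; _↑ˡ_; _↑ʳ_)
open import Data.Fin.Properties using (_≟_; any?; all?; toℕ-injective; toℕ<n; toℕ-fromℕ; toℕ-fromℕ<; injective⇒≤; inject≤-injective; toℕ-inject≤; remQuot-combine; combine-remQuot; splitAt-↑ˡ; splitAt-↑ʳ; join-splitAt)
open import Data.List using (List; []; _∷_; [_]; length; _++_; reverse; lookup; tabulate)
import Data.List.Membership.DecPropositional as DecMembership
open import Data.List.Membership.Propositional using (_∈_; _∉_)
open import Data.List.Membership.Propositional.Properties using (∈-++⁺ˡ; ∈-++⁺ʳ; ∈-++⁻; ∈-lookup; ∈-tabulate⁺)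
open import Data.List.Properties using (unfold-reverse; ++-assoc; ++-identityʳ; length-++; length-reverse; length-++-≤ˡ; length-++-≤ʳ; length-tabulate)
open import Data.List.Relation.Binary.Permutation.Propositional using (_↭_; refl; prep; swap; trans; ↭-sym; ↭-reflexive)
open import Data.List.Relation.Binary.Permutation.Propositional.Properties using (∈-resp-↭; ↭-length; ↭-reverse; ++-comm; ++⁺ˡ; All-resp-↭)
open import Data.List.Relation.Binary.Subset.Propositional using (_⊆_)
open import Data.List.Relation.Unary.All using (All; []; _∷_)
import Data.List.Relation.Unary.All as All
import Data.List.Relation.Unary.All.Properties as AllP
open import Data.List.Relation.Unary.AllPairs using ([]; _∷_)
open import Data.List.Relation.Unary.Any using (Any; here; there)
import Data.List.Relation.Unary.Any as Any
import Data.List.Relation.Unary.Any.Properties as AnyP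
open import Data.List.Relation.Unary.Unique.Propositional using (Unique)
import Data.List.Relation.Unary.Unique.Propositional.Properties as UniqueP
open import Data.Product using (∃; ∃₂; Σ; _×_; _,_; proj₁; proj₂)
open import Data.Sum using (_⊎_; inj₁; inj₂)
open import Data.Unit using (⊤; tt)
open import Data.Vec using (Vec; []; _∷_; zipWith; replicate; allFin) renaming (map to mapᵥ; lookup to lookupᵥ; tabulate to tabulateᵥ)
open import Data.Vec.N-ary using (N-ary; _$ⁿ_)
open import Data.Vec.Properties using (lookup∘tabulate)
open import Function using (_∘_; case_of_)
open import Function.Definitions using (Injective)
open import Relation.Binary.Definitions using (tri<; tri≈; tri>)
open import Relation.Binary.PropositionalEquality as ≡ using (_≡_; _≢_; refl; cong; sym; subst)
open import Relation.Nullary using (¬_; Dec; yes; no; does; contradiction)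
open import Relation.Nullary.Decidable using (map′; _×-dec_; _→-dec_; dec-true; dec-false)

-- The proof lives on a gap between `d` and ℓ. From t (2ℓ - 1) < N ≤ (t + 1) d and t ≥ 2 follows 3 d
-- ≥ 4ℓ - 2, so the degrees exceed ℓ by about ℓ / 3. This surplus pays for every deletion. A
-- separator of size κ lowers the degrees by at most κ; each discarded side has at least ℓ vertices,
-- and N < (2t + 2) ℓ, so at most 2t + 2 separators are removed on the way to a cluster. The price
-- is of order t κ, and everything reserved inside a cluster must have size of order ℓ / t as well.
-- A dominating set has e + i c vertices, where N < e c and i is of order t, and paths with O(t)
-- vertices make it connected. With e of order ℓ / t² and c of order t³ this fits as soon as ℓ is a
-- large multiple of t^6, which is how the lower bound on ℓ enters. Whether a graph contains a cycle
-- of length 2ℓ is decided by exhaustive search. It is therefore enough to refute its absence, and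
-- the splittings and separators need to exist only under double negation.

-- Linear inequalities

infixl 6 _:+_
infixr 7 _:*_
infixl 8 _*:_
infix 4 _:≤_
infix 3 _⊠_
infix 2 _⊢_

data Lin (n : ℕ) : Set where
  con  : ℕ → Lin n
  var  : Fin n → Lin n
  _:+_ : Lin n → Lin n → Lin n
  _:*_ : ℕ → Lin n → Lin n
  -- For large coefficients: the type checker unfolds c * x, but not x * c.
  _*:_ : Lin n → ℕ → Lin n

record Ineq (n : ℕ) : Set where
  constructor _:≤_
  field lhs rhs : Lin n

record Weighted (n : ℕ) : Set where
  constructor _⊠_
  field
    weight : ℕ
    ineq   : Ineq n

record Problem (n : ℕ) : Set where
  constructor _⊢_
  field
    hyps : List (Weighted n)
    goal : Weighted n

⟦_⟧ₑ : ∀ {n} → Lin n → Vec ℕ n → ℕ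
⟦ con c ⟧ₑ ρ = c
⟦ var i ⟧ₑ ρ = lookupᵥ ρ i
⟦ a :+ b ⟧ₑ ρ = ⟦ a ⟧ₑ ρ + ⟦ b ⟧ₑ ρ
⟦ c :* a ⟧ₑ ρ = c * ⟦ a ⟧ₑ ρ
⟦ a *: c ⟧ₑ ρ = ⟦ a ⟧ₑ ρ * c

⟦_⟧ᵢ : ∀ {n} → Ineq n → Vec ℕ n → Set
⟦ a :≤ b ⟧ᵢ ρ = ⟦ a ⟧ₑ ρ ≤ ⟦ b ⟧ₑ ρ

⟦_⟧ₕ : ∀ {n} → List (Weighted n) → Ineq n → Vec ℕ n → Set
⟦ [] ⟧ₕ g ρ = ⟦ g ⟧ᵢ ρ
⟦ (_ ⊠ h) ∷ hs ⟧ₕ g ρ = ⟦ h ⟧ᵢ ρ → ⟦ hs ⟧ₕ g ρ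

unit : ∀ {n} → Fin n → Vec ℕ n
unit zero    = 1 ∷ replicate _ 0
unit (suc i) = 0 ∷ unit i

coeffs : ∀ {n} → Lin n → Vec ℕ (suc n)
coeffs (con c)  = c ∷ replicate _ 0
coeffs (var i)  = 0 ∷ unit i
coeffs (a :+ b) = zipWith _+_ (coeffs a) (coeffs b)
coeffs (c :* a) = mapᵥ (c *_) (coeffs a)
coeffs (a *: c) = mapᵥ (c *_) (coeffs a)

dot : ∀ {n} → Vec ℕ n → Vec ℕ n → ℕ
dot [] [] = 0
dot (a ∷ as) (x ∷ xs) = a * x + dot as xs

_≤ᵛ_ : ∀ {n} → Vec ℕ n → Vec ℕ n → Bool
[] ≤ᵛ [] = true
(a ∷ as) ≤ᵛ (b ∷ bs) = (a ≤ᵇ b) ∧ (as ≤ᵛ bs)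

sumL sumR : ∀ {n} → List (Weighted n) → Lin n → Lin n
sumL [] z = z
sumL ((w ⊠ (a :≤ b)) ∷ hs) z = w :* a :+ sumL hs z
sumR [] z = z
sumR ((w ⊠ (a :≤ b)) ∷ hs) z = w :* b :+ sumR hs z

-- Farkas certificate: w·lhs + Σ wᵢ·rhsᵢ ≤ w·rhs + Σ wᵢ·lhsᵢ coefficientwise.
check : ∀ {n} → Problem n → Bool
check (hs ⊢ (w ⊠ (a :≤ b))) = (1 ≤ᵇ w) ∧ (coeffs (sumR hs (w :* a)) ≤ᵛ coeffs (sumL hs (w :* b)))

dot-0 : ∀ {n} (ρ : Vec ℕ n) → dot (replicate n 0) ρ ≡ 0
dot-0 [] = refl
dot-0 (x ∷ ρ) = dot-0 ρ

dot-unit : ∀ {n} (i : Fin n) (ρ : Vec ℕ n) → dot (unit i) ρ ≡ lookupᵥ ρ i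
dot-unit zero (x ∷ ρ) rewrite dot-0 ρ | +-identityʳ (x + 0) = +-identityʳ x
dot-unit (suc i) (x ∷ ρ) = dot-unit i ρ

dot-+ : ∀ {n} (as bs ρ : Vec ℕ n) → dot (zipWith _+_ as bs) ρ ≡ dot as ρ + dot bs ρ
dot-+ [] [] [] = refl
dot-+ (a ∷ as) (b ∷ bs) (x ∷ ρ) rewrite dot-+ as bs ρ = lemma a b x (dot as ρ) (dot bs ρ)
  where
  lemma : ∀ a b x u v → (a + b) * x + (u + v) ≡ a * x + u + (b * x + v)
  lemma = solve-∀

dot-* : ∀ {n} c (as ρ : Vec ℕ n) → dot (mapᵥ (c *_) as) ρ ≡ c * dot as ρ
dot-* c [] [] = sym (*-zeroʳ c)
dot-* c (a ∷ as) (x ∷ ρ) rewrite dot-* c as ρ = lemma c a x (dot as ρ)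
  where
  lemma : ∀ c a x u → c * a * x + c * u ≡ c * (a * x + u)
  lemma = solve-∀

coeffs-correct : ∀ {n} (e : Lin n) (ρ : Vec ℕ n) → dot (coeffs e) (1 ∷ ρ) ≡ ⟦ e ⟧ₑ ρ
coeffs-correct (con c) ρ rewrite dot-0 ρ | +-identityʳ (c * 1) = *-identityʳ c
coeffs-correct (var i) ρ = dot-unit i ρ
coeffs-correct (a :+ b) ρ =
  ≡.trans (dot-+ (coeffs a) (coeffs b) (1 ∷ ρ)) (≡.cong₂ _+_ (coeffs-correct a ρ) (coeffs-correct b ρ))
coeffs-correct (c :* a) ρ = ≡.trans (dot-* c (coeffs a) (1 ∷ ρ)) (cong (c *_) (coeffs-correct a ρ))
coeffs-correct (a *: c) ρ = ≡.trans (dot-* c (coeffs a) (1 ∷ ρ))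
  (≡.trans (cong (c *_) (coeffs-correct a ρ)) (*-comm c (⟦ a ⟧ₑ ρ)))

T-∧ : ∀ {a b} → T (a ∧ b) → T a × T b
T-∧ {true} {true} _ = _ , _

dot-mono : ∀ {n} (as bs ρ : Vec ℕ n) → T (as ≤ᵛ bs) → dot as ρ ≤ dot bs ρ
dot-mono [] [] [] _ = z≤n
dot-mono (a ∷ as) (b ∷ bs) (x ∷ ρ) p with T-∧ {a ≤ᵇ b} p
... | q , r = +-mono-≤ (*-monoˡ-≤ x (≤ᵇ⇒≤ a b q)) (dot-mono as bs ρ r)

-- Replacing `v * c` by the larger `v * d` makes the hypothesis cancel from both sides of the
-- certificate.
certified : ∀ {n} (hs : List (Weighted n)) w a b (ρ : Vec ℕ n) → 1 ≤ w →
  ⟦ sumR hs (w :* a) ⟧ₑ ρ ≤ ⟦ sumL hs (w :* b) ⟧ₑ ρ → ⟦ hs ⟧ₕ (a :≤ b) ρ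
certified [] (suc w) a b ρ _ p = *-cancelˡ-≤ (suc w) p
certified ((v ⊠ (c :≤ d)) ∷ hs) w a b ρ w>0 p h = certified hs w a b ρ w>0
  (+-cancelˡ-≤ (v * ⟦ d ⟧ₑ ρ) _ _ (≤-trans p (+-monoˡ-≤ _ (*-monoʳ-≤ v h))))

instantiate : ∀ {n} → N-ary n (Lin n) (Problem n) → Problem n
instantiate {n} f = f $ⁿ mapᵥ var (allFin n)

-- For a valid certificate `T (check …)` evaluates to the unit type, so that this argument is never
-- written. Variables range over ℕ, hence comparing coefficients suffices. A product such as `t * k`
-- is passed as a variable of its own; strict inequalities carry a `con 1`.
lin : ∀ {n} (ρ : Vec ℕ n) (f : N-ary n (Lin n) (Problem n)) → {T (check (instantiate f))} →
      ⟦ Problem.hyps (instantiate f) ⟧ₕ (Weighted.ineq (Problem.goal (instantiate f))) ρ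
lin {n} ρ f {ok} with instantiate f
... | hs ⊢ (w ⊠ (a :≤ b)) with T-∧ {1 ≤ᵇ w} ok
... | p , q = certified hs w a b ρ (≤ᵇ⇒≤ 1 w p)
  (≡.subst₂ _≤_ (coeffs-correct (sumR hs (w :* a)) ρ) (coeffs-correct (sumL hs (w :* b)) ρ)
    (dot-mono (coeffs (sumR hs (w :* a))) (coeffs (sumL hs (w :* b))) (1 ∷ ρ) q))

-- Counting in finite sets

private variable
  n : ℕ

Sub : ℕ → Set
Sub n = Fin n → Bool

_⊑_ : Sub n → Sub n → Set
p ⊑ q = ∀ v → p v ≡ true → q v ≡ true

∧-elim : ∀ {a b} → a ∧ b ≡ true → a ≡ true × b ≡ true
∧-elim {true} {true} _ = refl , refl

∧-intro : ∀ {a b} → a ≡ true → b ≡ true → a ∧ b ≡ true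
∧-intro refl refl = refl

∨-elim : ∀ {a b} → a ∨ b ≡ true → a ≡ true ⊎ b ≡ true
∨-elim {true} _ = inj₁ refl
∨-elim {false} p = inj₂ p

∨-introˡ : ∀ {a b} → a ≡ true → a ∨ b ≡ true
∨-introˡ refl = refl

∨-introʳ : ∀ {a b} → b ≡ true → a ∨ b ≡ true
∨-introʳ {true} _ = refl
∨-introʳ {false} p = p

not-elim : ∀ {a} → not a ≡ true → a ≡ false
not-elim {false} _ = refl

true≢false : ∀ {a} → a ≡ true → a ≡ false → ⊥
true≢false refl ()

true? : ∀ a → a ≡ true ⊎ a ≡ false
true? true = inj₁ refl
true? false = inj₂ refl

dec? : ∀ b → Dec (b ≡ true)
dec? true = yes refl
dec? false = no λ ()

¬true⇒false : ∀ {a} → ¬ a ≡ true → a ≡ false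
¬true⇒false {true} h = ⊥-elim (h refl)
¬true⇒false {false} _ = refl

does-true : ∀ {A : Set} {d : Dec A} → does d ≡ true → A
does-true {d = yes a} _ = a

does-false : ∀ {A : Set} {d : Dec A} → does d ≡ false → ¬ A
does-false {d = no ¬a} _ = ¬a

_∈?_ : (v : Fin n) (xs : List (Fin n)) → Dec (v ∈ xs)
_∈?_ = DecMembership._∈?_ _≟_

mem : List (Fin n) → Sub n
mem xs v = does (v ∈? xs)

-- Being opaque, the set difference stays intact under unification, which can recover `p` and `xs`
-- from it; the two lemmas of the block are the only access.
opaque
  _∖_ : Sub n → List (Fin n) → Sub n
  (p ∖ xs) v = p v ∧ not (mem xs v)

  ∖-intro : ∀ {p : Sub n} {xs v} → p v ≡ true → v ∉ xs → (p ∖ xs) v ≡ true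
  ∖-intro {xs = xs} {v} pv v∉ rewrite pv | dec-false (v ∈? xs) v∉ = refl

  ∖-elim : ∀ {p : Sub n} {xs v} → (p ∖ xs) v ≡ true → p v ≡ true × v ∉ xs
  ∖-elim {xs = xs} {v} h with ∧-elim h
  ... | pv , h′ = pv , does-false {d = v ∈? xs} (not-elim h′)

does-sym : ∀ {n} (u v : Fin n) → does (u ≟ v) ≡ does (v ≟ u)
does-sym u v with u ≟ v | v ≟ u
... | yes _ | yes _ = refl
... | no _ | no _ = refl
... | yes u≡v | no v≢u = ⊥-elim (v≢u (sym u≡v))
... | no u≢v | yes v≡u = ⊥-elim (u≢v (sym v≡u))

sum-mono : {f g : Fin n → ℕ} → (∀ i → f i ≤ g i) → sum f ≤ sum g
sum-mono {zero} h = z≤n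
sum-mono {suc n} h = +-mono-≤ (h zero) (sum-mono (h ∘ suc))

sum≤n*c : {f : Fin n → ℕ} (c : ℕ) → (∀ i → f i ≤ c) → sum f ≤ n * c
sum≤n*c {zero} c h = z≤n
sum≤n*c {suc n} c h = +-mono-≤ (h zero) (sum≤n*c c (h ∘ suc))

sum-find : (f : Fin n → ℕ) (c : ℕ) → n * c < sum f → ∃ λ i → c < f i
sum-find f c h with any? (λ i → c <? f i)
... | yes r = r
... | no ¬r = contradiction (sum≤n*c c (λ i → ≮⇒≥ (λ q → ¬r (i , q)))) (<⇒≱ h)

wt : (Fin n → ℕ) → Sub n → ℕ
wt w p = sum (λ v → if p v then w v else 0)

infix 8 #_
#_ : Sub n → ℕ
# p = wt (λ _ → 1) p

wt-mono : ∀ (w : Fin n → ℕ) {p q} → p ⊑ q → wt w p ≤ wt w q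
wt-mono w {p} {q} h = sum-mono pointwise
  where
  pointwise : ∀ v → (if p v then w v else 0) ≤ (if q v then w v else 0)
  pointwise v with p v in pv
  ... | false = z≤n
  ... | true rewrite h v pv = ≤-refl

wt-mono-weight : ∀ {w w′ : Fin n → ℕ} (p : Sub n) → (∀ v → p v ≡ true → w v ≤ w′ v) → wt w p ≤ wt w′ p
wt-mono-weight {w = w} {w′} p h = sum-mono pointwise
  where
  pointwise : ∀ v → (if p v then w v else 0) ≤ (if p v then w′ v else 0)
  pointwise v with p v in pv
  ... | false = z≤n
  ... | true = h v pv

wt-disjoint : ∀ (w : Fin n → ℕ) {p q r} → p ⊑ r → q ⊑ r → (∀ v → p v ≡ true → q v ≡ true → ⊥) →
  wt w p + wt w q ≤ wt w r
wt-disjoint w {p} {q} {r} p⊑r q⊑r disj =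
  ≤-trans (≤-reflexive (sym (∑-distrib-+ (λ v → if p v then w v else 0) (λ v → if q v then w v else 0))))
      (sum-mono pointwise)
  where
  pointwise : ∀ v → (if p v then w v else 0) + (if q v then w v else 0) ≤ (if r v then w v else 0)
  pointwise v with p v in pv | q v in qv
  ... | true | true = ⊥-elim (disj v pv qv)
  ... | true | false rewrite p⊑r v pv = ≤-reflexive (+-identityʳ _)
  ... | false | true rewrite q⊑r v qv = ≤-refl
  ... | false | false = z≤n

#-cover : {p q r : Sub n} → (∀ v → p v ≡ true → q v ≡ true ⊎ r v ≡ true) → # p ≤ # q + # r
#-cover {p = p} {q} {r} h = ≤-trans (sum-mono pointwise)
  (≤-reflexive (∑-distrib-+ (λ v → if q v then 1 else 0) (λ v → if r v then 1 else 0)))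
  where
  pointwise : ∀ v → (if p v then 1 else 0) ≤ (if q v then 1 else 0) + (if r v then 1 else 0)
  pointwise v with p v in pv
  ... | false = z≤n
  ... | true with h v pv
  ... | inj₁ qv rewrite qv = s≤s z≤n
  ... | inj₂ rv rewrite rv = m≤n+m 1 _

#-find : (p : Sub n) → 0 < # p → ∃ λ v → p v ≡ true
#-find {n} p h with sum-find (λ v → if p v then 1 else 0) 0 (subst (_< # p) (sym (*-zeroʳ n)) h)
... | v , q with p v in pv
... | true = v , pv

#≤n : (p : Sub n) → # p ≤ n
#≤n {n} p = ≤-trans (sum≤n*c 1 pointwise) (≤-reflexive (*-identityʳ n))
  where
  pointwise : ∀ v → (if p v then 1 else 0) ≤ 1
  pointwise v with p v
  ... | true = ≤-refl
  ... | false = z≤n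

wt-empty : ∀ (w : Fin n → ℕ) {p : Sub n} → (∀ v → p v ≡ true → ⊥) → wt w p ≡ 0
wt-empty {zero} w h = refl
wt-empty {suc n} w {p} h with p zero in p0
... | true = ⊥-elim (h zero p0)
... | false = wt-empty (w ∘ suc) (h ∘ suc)

wt-single : ∀ (w : Fin n → ℕ) x → wt w (λ v → does (v ≟ x)) ≡ w x
wt-single {suc n} w zero = ≡.trans (cong (w zero +_) (wt-empty (w ∘ suc) (λ v ()))) (+-identityʳ _)
wt-single {suc n} w (suc x) = wt-single (w ∘ suc) x

wt-point : ∀ (w : Fin n → ℕ) {p x} → p x ≡ true → w x ≤ wt w p
wt-point w {p} {x} px = ≤-trans (≤-reflexive (sym (wt-single w x)))
  (wt-mono w {q = p} (λ v v≡x → ≡.trans (cong p (does-true {d = v ≟ x} v≡x)) px))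

⟨_⟩ : Bool → ℕ
⟨ b ⟩ = if b then 1 else 0

lc : Sub n → List (Fin n) → ℕ
lc p [] = 0
lc p (x ∷ xs) = ⟨ p x ⟩ + lc p xs

lc≤length : (p : Sub n) (xs : List (Fin n)) → lc p xs ≤ length xs
lc≤length p [] = z≤n
lc≤length p (x ∷ xs) with p x
... | true = s≤s (lc≤length p xs)
... | false = m≤n⇒m≤1+n (lc≤length p xs)

lc-mono : (p q : Sub n) {xs : List (Fin n)} → All (λ x → p x ≡ true → q x ≡ true) xs → lc p xs ≤ lc q xs
lc-mono p q [] = z≤n
lc-mono p q {x ∷ xs} (h ∷ hs) with p x in px
... | false = m≤n⇒m≤o+n _ (lc-mono p q hs)
... | true rewrite h refl = s≤s (lc-mono p q hs)

#≤lc+#∖ : (p : Sub n) (xs : List (Fin n)) → # p ≤ lc p xs + # (p ∖ xs)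
#≤lc+#∖ p [] = wt-mono (λ _ → 1) {q = p ∖ []} (λ v pv → ∖-intro pv λ ())
#≤lc+#∖ {n} p (x ∷ xs) = ≤-trans (#≤lc+#∖ p xs) (≤-trans (+-monoʳ-≤ (lc p xs) step) (≤-reflexive rearrange))
  where
  here-x : Sub n
  here-x v = p v ∧ does (v ≟ x)
  cover : ∀ v → (p ∖ xs) v ≡ true → here-x v ≡ true ⊎ (p ∖ (x ∷ xs)) v ≡ true
  cover v h with ∖-elim h | v ≟ x
  ... | pv , _ | yes refl = inj₁ (∧-intro pv refl)
  ... | pv , v∉ | no v≢x = inj₂ (∖-intro pv λ { (here e) → v≢x e ; (there q) → v∉ q })
  small : # here-x ≤ ⟨ p x ⟩
  small with p x in px
  ... | true = ≤-trans (wt-mono (λ _ → 1) {q = λ v → does (v ≟ x)} (λ v h → proj₂ (∧-elim h)))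
    (≤-reflexive (wt-single (λ _ → 1) x))
  ... | false = ≤-reflexive (wt-empty (λ _ → 1) {p = here-x} λ v h → case ∧-elim h of λ
    { (pv , e) → true≢false (≡.trans (cong p (sym (does-true {d = v ≟ x} e))) pv) px })
  step : # (p ∖ xs) ≤ ⟨ p x ⟩ + # (p ∖ (x ∷ xs))
  step = ≤-trans (#-cover {q = here-x} {p ∖ (x ∷ xs)} cover) (+-monoˡ-≤ _ small)
  rearrange : lc p xs + (⟨ p x ⟩ + # (p ∖ (x ∷ xs))) ≡ ⟨ p x ⟩ + lc p xs + # (p ∖ (x ∷ xs))
  rearrange = ≡.trans (sym (+-assoc (lc p xs) _ _)) (cong (_+ # (p ∖ (x ∷ xs))) (+-comm (lc p xs) _))

#≤length+#∖ : (p : Sub n) (xs : List (Fin n)) → # p ≤ length xs + # (p ∖ xs)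
#≤length+#∖ p xs = ≤-trans (#≤lc+#∖ p xs) (+-monoˡ-≤ _ (lc≤length p xs))

#mem≤length : (xs : List (Fin n)) → # (mem xs) ≤ length xs
#mem≤length xs = ≤-trans (#≤length+#∖ (mem xs) xs) (≤-reflexive
  (≡.trans (cong (λ k → length xs + k) (wt-empty (λ _ → 1) {p = mem xs ∖ xs} λ v h → case ∖-elim h of λ
    { (q , v∉) → v∉ (does-true {d = v ∈? xs} q) })) (+-identityʳ _)))

fresh : (p : Sub n) (xs : List (Fin n)) → length xs < # p → ∃ λ v → p v ≡ true × v ∉ xs
fresh p xs h with #-find (p ∖ xs) (+-cancelˡ-< (length xs) 0 (# (p ∖ xs))
  (≤-<-trans (≤-reflexive (+-identityʳ (length xs))) (<-≤-trans h (#≤length+#∖ p xs))))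
... | v , q = v , ∖-elim q

∉⇒All≢ : {x : Fin n} {xs : List (Fin n)} → x ∉ xs → All (x ≢_) xs
∉⇒All≢ = AllP.¬Any⇒All¬ _

All≢⇒∉ : {x : Fin n} {xs : List (Fin n)} → All (x ≢_) xs → x ∉ xs
All≢⇒∉ = AllP.All¬⇒¬Any

unique-length : (p : Sub n) {xs : List (Fin n)} → Unique xs → All (λ x → p x ≡ true) xs → length xs ≤ # p
unique-length p [] [] = z≤n
unique-length {n} p {x ∷ xs} (x≢ ∷ uq) (px ∷ pxs) = ≤-trans
  (+-mono-≤ (≤-reflexive (sym (wt-single (λ _ → 1) x)))
            (unique-length (p ∖ (x ∷ [])) uq (All.map (λ { (pv , x≢v) → ∖-intro pv λ { (here e) → x≢v (sym e) } })
              (All.zip (pxs , x≢)))))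
  (wt-disjoint (λ _ → 1) {p = λ v → does (v ≟ x)} {q = p ∖ (x ∷ [])} {r = p}
    (λ v e → ≡.trans (cong p (does-true {d = v ≟ x} e)) px) (λ v h → proj₁ (∖-elim h))
    (λ v e h → proj₂ (∖-elim h) (here (does-true {d = v ≟ x} e))))

take-fresh : (p : Sub n) (k : ℕ) → k ≤ # p → ∃ λ xs → Unique xs × All (λ x → p x ≡ true) xs × length xs ≡ k
take-fresh p zero h = [] , [] , [] , refl
take-fresh p (suc k) h with take-fresh p k (≤-trans (n≤1+n k) h)
... | xs , uq , all , refl with fresh p xs h
... | v , pv , v∉ = v ∷ xs , ∉⇒All≢ v∉ ∷ uq , pv ∷ all , refl

elements : (p : Sub n) → ∃ λ xs → Unique xs × All (λ x → p x ≡ true) xs × length xs ≡ # p ×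
    (∀ v → p v ≡ true → v ∈ xs)
elements p with take-fresh p (# p) ≤-refl
... | xs , uq , all , len = xs , uq , all , len , complete
  where
  complete : ∀ v → p v ≡ true → v ∈ xs
  complete v pv with v ∈? xs
  ... | yes v∈ = v∈
  ... | no v∉ = contradiction (unique-length p (∉⇒All≢ v∉ ∷ uq) (pv ∷ all)) (<⇒≱ (s≤s (≤-reflexive (sym len))))

#-scale : (U : Sub n) (w : Fin n → ℕ) (a : ℕ) → (∀ u → U u ≡ true → a ≤ w u) → # U * a ≤ wt w U
#-scale {zero} U w a h = z≤n
#-scale {suc n} U w a h with U zero in U0
... | true = +-mono-≤ (h zero U0) (#-scale (U ∘ suc) (w ∘ suc) a (h ∘ suc))
... | false = #-scale (U ∘ suc) (w ∘ suc) a (h ∘ suc)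

-- Counting the pairs by rows gives at least `# U * a`; if every column had at most `c`, there would
-- be at most `n * c`.
double-count : ∀ {m} (U : Sub m) (R : Fin m → Sub n) (a c : ℕ) → (∀ u → U u ≡ true → a ≤ # (R u)) →
  n * c < # U * a → ∃ λ q → c < # (λ u → U u ∧ R u q)
double-count {n} {m} U R a c h big = sum-find (λ q → # (λ u → U u ∧ R u q)) c (<-≤-trans big
  (≤-trans (#-scale U (λ u → # (R u)) a h) (≤-reflexive (≡.trans (sum-cong-≗ rowwise)
    (∑-comm (λ u q → if U u ∧ R u q then 1 else 0))))))
  where
  rowwise : ∀ u → (if U u then # (R u) else 0) ≡ sum (λ q → if U u ∧ R u q then 1 else 0)
  rowwise u with U u
  ... | true = refl
  ... | false = sym (wt-empty {n} (λ _ → 1) {p = λ _ → false} (λ v ()))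

#-cover-list : {A : Set} (s : A → Sub n) (p : Sub n) (M : ℕ) (as : List A) →
  (∀ v → p v ≡ true → Any (λ a → s a v ≡ true) as) → All (λ a → # (s a) ≤ M) as → # p ≤ length as * M
#-cover-list s p M [] cov [] = ≤-reflexive (wt-empty (λ _ → 1) {p = p} λ v pv → case cov v pv of λ ())
#-cover-list s p M (a ∷ as) cov (h ∷ hs) = ≤-trans (#-cover {q = s a} {r = λ v → p v ∧ not (s a v)} split)
  (+-mono-≤ h (#-cover-list s (λ v → p v ∧ not (s a v)) M as later hs))
  where
  split : ∀ v → p v ≡ true → s a v ≡ true ⊎ p v ∧ not (s a v) ≡ true
  split v pv with s a v
  ... | true = inj₁ refl
  ... | false = inj₂ (∧-intro pv refl)
  later : ∀ v → p v ∧ not (s a v) ≡ true → Any (λ a → s a v ≡ true) as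
  later v h with ∧-elim h
  ... | pv , ¬sv with cov v pv
  ... | here sv = ⊥-elim (true≢false sv (not-elim ¬sv))
  ... | there q = q

-- Walks, paths and cycles

module _ {A : Set} where

  Unique-resp-↭ : {xs ys : List A} → xs ↭ ys → Unique xs → Unique ys
  Unique-resp-↭ refl u = u
  Unique-resp-↭ (prep x p) (x≢ ∷ u) = All-resp-↭ p x≢ ∷ Unique-resp-↭ p u
  Unique-resp-↭ (swap x y p) ((x≢y ∷ x≢) ∷ y≢ ∷ u) =
    ((x≢y ∘ sym) ∷ All-resp-↭ p y≢) ∷ All-resp-↭ p x≢ ∷ Unique-resp-↭ p u
  Unique-resp-↭ (trans p q) u = Unique-resp-↭ q (Unique-resp-↭ p u)

  Unique-++⁻ˡ : (xs : List A) {ys : List A} → Unique (xs ++ ys) → Unique xs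
  Unique-++⁻ˡ [] _ = []
  Unique-++⁻ˡ (x ∷ xs) (x≢ ∷ u) = All.tabulate (λ i → All.lookup x≢ (∈-++⁺ˡ i)) ∷ Unique-++⁻ˡ xs u

  Unique-++⁻ʳ : (xs : List A) {ys : List A} → Unique (xs ++ ys) → Unique ys
  Unique-++⁻ʳ [] u = u
  Unique-++⁻ʳ (x ∷ xs) (_ ∷ u) = Unique-++⁻ʳ xs u

  Unique-disjoint : (xs : List A) {ys : List A} → Unique (xs ++ ys) → ∀ {x} → x ∈ xs → x ∈ ys → ⊥
  Unique-disjoint (x ∷ xs) (x≢ ∷ u) (here refl) j = All.lookup x≢ (∈-++⁺ʳ xs j) refl
  Unique-disjoint (x ∷ xs) (x≢ ∷ u) (there i) j = Unique-disjoint xs u i j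

  Unique-++⁺ : {xs ys : List A} → Unique xs → Unique ys → (∀ {x} → x ∈ xs → x ∈ ys → ⊥) → Unique (xs ++ ys)
  Unique-++⁺ u v d = UniqueP.++⁺ u v (λ (i , j) → d i j)

  Unique-∷ : {x : A} {xs : List A} → x ∉ xs → Unique xs → Unique (x ∷ xs)
  Unique-∷ x∉ u = All.tabulate (λ i e → x∉ (subst (_∈ _) (sym e) i)) ∷ u

  ∈-reverse⁻ : {x : A} (xs : List A) → x ∈ reverse xs → x ∈ xs
  ∈-reverse⁻ xs = ∈-resp-↭ (↭-reverse xs)

both? : (a b : Bool) → (a ≡ true × b ≡ true) ⊎ ⟨ a ⟩ + ⟨ b ⟩ ≤ 1
both? true true = inj₁ (refl , refl)
both? true false = inj₂ ≤-refl
both? false true = inj₂ ≤-refl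
both? false false = inj₂ z≤n

crossing-count : ∀ a b c d A B L → b + c ≤ 1 → A + B + 1 ≤ L + c + d → a + A + (b + B) + 1 ≤ suc L + a + d
crossing-count a b c d A B L = lin (a ∷ b ∷ c ∷ d ∷ A ∷ B ∷ L ∷ []) (λ a b c d A B L →
  (1 ⊠ b :+ c :≤ con 1) ∷ (1 ⊠ A :+ B :+ con 1 :≤ L :+ c :+ d) ∷ [] ⊢
  (1 ⊠ a :+ A :+ (b :+ B) :+ con 1 :≤ con 1 :+ L :+ a :+ d))

lookup-injective : ∀ {A : Set} {xs : List A} → Unique xs → Injective _≡_ _≡_ (lookup xs)
lookup-injective (x≢ ∷ u) {zero} {zero} _ = refl
lookup-injective (x≢ ∷ u) {zero} {suc j} h = ⊥-elim (All.lookup x≢ (∈-lookup j) h)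
lookup-injective (x≢ ∷ u) {suc i} {zero} h = ⊥-elim (All.lookup x≢ (∈-lookup i) (sym h))
lookup-injective (x≢ ∷ u) {suc i} {suc j} h = cong suc (lookup-injective u h)

lc-↭ : ∀ {n} (p : Sub n) {xs ys : List (Fin n)} → xs ↭ ys → lc p xs ≡ lc p ys
lc-↭ p refl = refl
lc-↭ p (prep x q) = cong (λ k → ⟨ p x ⟩ + k) (lc-↭ p q)
lc-↭ p (swap {xs} {ys} x y q) rewrite lc-↭ p q = lemma ⟨ p x ⟩ ⟨ p y ⟩ (lc p ys)
  where
  lemma : ∀ a b c → a + (b + c) ≡ b + (a + c)
  lemma = solve-∀
lc-↭ p (trans q r) = ≡.trans (lc-↭ p q) (lc-↭ p r)

Adj-sym : ∀ {N} {G : Graph N} {u v} → Adj G u v → Adj G v u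
Adj-sym {G = G} {u} {v} h = ≡.trans (Graph.sym G v u) h

Adj-irrefl : ∀ {N} (G : Graph N) {v} → Adj G v v → ⊥
Adj-irrefl G {v} h = true≢false h (irrefl G v)

-- Walk G B u v xs n: the vertices xs, from u to v, with consecutive ones adjacent
-- in G except for n steps, which are in the relation B.
data Walk {N} (G : Graph N) (B : Fin N → Fin N → Set) (u : Fin N) : Fin N → List (Fin N) → ℕ → Set where
  end  : Walk G B u u (u ∷ []) 0
  step : ∀ {w v xs n} → Adj G u w → Walk G B w v xs n → Walk G B u v (u ∷ xs) n
  skip : ∀ {w v xs n} → B u w → Walk G B w v xs n → Walk G B u v (u ∷ xs) (suc n)

Path : ∀ {N} (G : Graph N) (u v : Fin N) → List (Fin N) → Set
Path G u v xs = Walk G (λ _ _ → ⊥) u v xs 0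

Cyclic : ∀ {N} (G : Graph N) → List (Fin N) → Set
Cyclic G xs = ∃₂ λ u v → Path G u v xs × Adj G v u

module _ {N : ℕ} {G : Graph N} where

  private
    V = Fin N
    variable
      u v w x y z : V
      xs ys : List V
      m : ℕ

  module _ {B : V → V → Set} where

    join : Walk G B u v xs m → Adj G v w → Walk G B w z ys n → Walk G B u z (xs ++ ys) (m + n)
    join end e q = step e q
    join (step f p) e q = step f (join p e q)
    join (skip b p) e q = skip b (join p e q)

    joinSkip : Walk G B u v xs m → B v w → Walk G B w z ys n → Walk G B u z (xs ++ ys) (suc (m + n))
    joinSkip end b q = skip b q
    joinSkip (step f p) e q = step f (joinSkip p e q)
    joinSkip (skip b p) e q = skip b (joinSkip p e q)

    reverseWalk : (∀ {a b} → B a b → B b a) → Walk G B u v xs n → Walk G B v u (reverse xs) n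
    reverseWalk s end = end
    reverseWalk s (step {xs = xs} {n = n} e p) = ≡.subst₂ (Walk G B _ _) (sym (unfold-reverse _ xs)) (+-identityʳ n)
      (join (reverseWalk s p) (Adj-sym {G = G} e) end)
    reverseWalk s (skip {xs = xs} {n = n} b p) = ≡.subst₂ (Walk G B _ _) (sym (unfold-reverse _ xs))
        (cong suc (+-identityʳ n))
      (joinSkip (reverseWalk s p) (s b) end)

    asPath : Walk G B u v xs 0 → Path G u v xs
    asPath end = end
    asPath (step e p) = step e (asPath p)

    firstSkip : Walk G B u v xs (suc n) → ∃₂ λ x y → ∃₂ λ as bs →
      Walk G B u x as 0 × B x y × Walk G B y v bs n × xs ≡ as ++ bs
    firstSkip (step e p) with firstSkip p
    ... | x , y , as , bs , q , b , r , refl = x , y , _ ∷ as , bs , step e q , b , r , refl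
    firstSkip (skip b p) = _ , _ , _ , _ , end , b , p , refl

    -- Without a step from β to α, every step has its tail in β or its head in α, but not both.
    -- Summed over the `length xs - 1` steps this is the second alternative; heads miss `u` and
    -- tails miss `v`. The crossing step found may itself be one of the skips and is dropped, hence
    -- `n₁ + n₂ ≤ n` instead of an equation.
    crossing : (α β : Sub N) → Walk G B u v xs n →
      (∃₂ λ x y → ∃₂ λ as bs → ∃₂ λ n₁ n₂ → Walk G B u x as n₁ × Walk G B y v bs n₂ ×
         xs ≡ as ++ bs × β x ≡ true × α y ≡ true × n₁ + n₂ ≤ n)
      ⊎ lc α xs + lc β xs + 1 ≤ length xs + ⟨ α u ⟩ + ⟨ β v ⟩
    crossing {u = u} α β end = inj₂ (≤-reflexive (lemma ⟨ α u ⟩ ⟨ β u ⟩))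
      where
      lemma : ∀ a b → a + 0 + (b + 0) + 1 ≡ 1 + a + b
      lemma = solve-∀
    crossing {u = u} {v} α β (step {w} {xs = xs} {n = n} e q) with crossing α β q
    ... | inj₁ (x , y , as , bs , n₁ , n₂ , r , s , refl , βx , αy , le) =
      inj₁ (x , y , u ∷ as , bs , n₁ , n₂ , step e r , s , refl , βx , αy , le)
    ... | inj₂ le with both? (β u) (α w)
    ... | inj₁ (βu , αw) = inj₁ (u , w , [ u ] , xs , 0 , n , end , q , refl , βu , αw , ≤-refl)
    ... | inj₂ few = inj₂ (crossing-count ⟨ α u ⟩ ⟨ β u ⟩ ⟨ α w ⟩ ⟨ β v ⟩ (lc α xs) (lc β xs) (length xs) few le)
    crossing {u = u} {v} α β (skip {w} {xs = xs} {n = n} b q) with crossing α β q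
    ... | inj₁ (x , y , as , bs , n₁ , n₂ , r , s , refl , βx , αy , le) =
      inj₁ (x , y , u ∷ as , bs , suc n₁ , n₂ , skip b r , s , refl , βx , αy , s≤s le)
    ... | inj₂ le with both? (β u) (α w)
    ... | inj₁ (βu , αw) = inj₁ (u , w , [ u ] , xs , 0 , n , end , q , refl , βu , αw , n≤1+n n)
    ... | inj₂ few = inj₂ (crossing-count ⟨ α u ⟩ ⟨ β u ⟩ ⟨ α w ⟩ ⟨ β v ⟩ (lc α xs) (lc β xs) (length xs) few le)

    lastHit : (p : Sub N) → Walk G B u v xs 0 →
      All (λ x → p x ≡ false) xs ⊎
      (∃₂ λ z ys → ∃ λ as → Walk G B z v (z ∷ ys) 0 × p z ≡ true × All (λ x → p x ≡ false) ys × xs ≡ as ++ z ∷ ys)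
    lastHit {u = u} p end with true? (p u)
    ... | inj₁ pu = inj₂ (u , [] , [] , end , pu , [] , refl)
    ... | inj₂ ¬pu = inj₁ (¬pu ∷ [])
    lastHit {u = u} p (step e q) with lastHit p q
    ... | inj₂ (z , ys , as , r , pz , no-ys , refl) = inj₂ (z , ys , u ∷ as , r , pz , no-ys , refl)
    ... | inj₁ none with true? (p u)
    ... | inj₁ pu = inj₂ (u , _ , [] , step e q , pu , none , refl)
    ... | inj₂ ¬pu = inj₁ (¬pu ∷ none)

  start∈ : Path G u v xs → u ∈ xs
  start∈ end = here refl
  start∈ (step e p) = here refl

  end∈ : Path G u v xs → v ∈ xs
  end∈ end = here refl
  end∈ (step e p) = there (end∈ p)

  reversePath : Path G u v xs → Path G v u (reverse xs)
  reversePath = reverseWalk λ ()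

  split : Path G u v xs → z ∈ xs → ∃₂ λ as bs → Path G u z (as ++ [ z ]) × Path G z v (z ∷ bs) × xs ≡ as ++ z ∷ bs
  split end (here refl) = [] , [] , end , end , refl
  split (step e p) (here refl) = [] , _ , end , step e p , refl
  split (step {u} e p) (there i) with split p i
  ... | as , bs , q , r , refl = _ ∷ as , bs , step e q , r , refl

  prune : Path G u v xs → ∃ λ ys → Path G u v ys × Unique ys × ys ⊆ xs × length ys ≤ length xs
  prune end = _ , end , [] ∷ [] , (λ i → i) , ≤-refl
  prune {u} (step e p) with prune p
  ... | ys , q , uq , sub , len with u ∈? ys
  ... | no u∉ = u ∷ ys , step e q , Unique-∷ u∉ uq , (λ { (here e) → here e ; (there i) → there (sub i) }) , s≤s len
  ... | yes u∈ with split q u∈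
  ... | as , bs , _ , r , refl = u ∷ bs , r , Unique-++⁻ʳ as uq , (λ i → there (sub (∈-++⁺ʳ as i))) ,
    m≤n⇒m≤1+n (≤-trans (length-++-≤ʳ (u ∷ bs) {as}) len)

  rotate : Cyclic G xs → y ∈ xs → ∃₂ λ u ys → Path G u y ys × ys ↭ xs
  rotate (u , v , p , e) y∈ with split p y∈
  ... | as , [] , q , end , refl = u , _ , q , refl
  ... | as , [] , q , step _ () , refl
  ... | as , b ∷ bs , q , step f r , refl = _ , _ , join r e q ,
    trans (++-comm (b ∷ bs) (as ++ [ _ ])) (↭-reflexive (++-assoc as [ _ ] (b ∷ bs)))

  toCycle : Path G u v xs → Adj G v u → Unique xs → ContainsCycle (length xs) G
  toCycle {u} {v} {xs} p e uq = lookup xs , lookup-injective uq , λ i → edge p e i (next i) (wrap p i)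
    where
    -- The successor is `zero` only at the last position, where the entry is the endpoint `z`; any
    -- other successor is a position in the tail.
    Next : (ys : List V) (z : V) (i j : Fin (length ys)) → Set
    Next (y ∷ ys) z i zero = lookup (y ∷ ys) i ≡ z
    Next (y ∷ ys) z i (suc j) = Adj G (lookup (y ∷ ys) i) (lookup ys j)
    wrap : ∀ {a b ys} → Path G a b ys → (i : Fin (length ys)) → Next ys b i (next i)
    wrap end zero = refl
    wrap (step f end) zero = f
    wrap (step f (step _ _)) zero = f
    wrap (step f end) (suc zero) = refl
    wrap (step f q@(step {xs = w ∷ ws} g q′)) (suc i) with next i | wrap q i
    ... | zero | h = h
    ... | suc j | h = h
    edge : ∀ {a b ys} → Path G a b ys → Adj G b a → (i j : Fin (length ys)) → Next ys b i j →
      Adj G (lookup ys i) (lookup ys j)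
    edge end f zero zero _ = f
    edge (step _ _) f i zero h = subst (λ c → Adj G c _) (sym h) f
    edge (step _ _) f i (suc j) h = h

  -- The list holds the interior vertices of a path from v to w.
  data Link (v : V) : List V → V → Set where
    direct : Adj G v w → Link v [] w
    via    : Adj G v x → Link x xs w → Link v (x ∷ xs) w

  toLink : Adj G v x → Path G x y xs → Adj G y w → Link v xs w
  toLink e end f = via e (direct f)
  toLink e (step g p) f = via e (toLink g p f)

  connect : Link v xs w → Path G w z ys → ∃ λ a → Adj G v a × Path G a z (xs ++ ys)
  connect (direct e) p = _ , e , p
  connect (via e l) p with connect l p
  ... | a , f , q = _ , e , step f q

  bridge : ∀ {ms} → Path G u v xs → Link v ms w → Path G w z ys → Path G u z (xs ++ ms ++ ys)
  bridge p l q with connect l q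
  ... | a , e , r = join p e r

  closeUp : ∀ {ms} → Path G u v xs → Link v ms w → ∃ λ a → Path G u a (xs ++ ms) × Adj G a w
  closeUp {xs = xs} {w = w} p (direct e) = _ , subst (Path G _ _) (sym (++-identityʳ xs)) p , e
  closeUp {xs = xs} p (via {x} {ms} e l) with closeUp (join p e end) l
  ... | a , q , f = a , subst (Path G _ _) (++-assoc xs [ x ] ms) q , f

  reverseLink : Link v xs w → Link w (reverse xs) v
  reverseLink (direct e) = direct (Adj-sym {G = G} e)
  reverseLink (via e l) with closeUp (end {u = _}) l
  ... | a , q , f = toLink (Adj-sym {G = G} f) (reversePath q) (Adj-sym {G = G} e)

module _ {N : ℕ} (G : Graph N) where

  OrePair : List (Fin N) → Fin N → Fin N → Set
  OrePair zs u v = length zs ≤ lc (adj G u) zs + lc (adj G v) zs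

  -- A vertex is not its own neighbour, so both correction terms of `crossing` vanish and the degree
  -- condition exceeds its bound by one.
  crossing-endpoints : ∀ {B u v xs n} → Walk G B u v xs n → length xs ≤ lc (adj G u) xs + lc (adj G v) xs →
    ∃₂ λ x y → ∃₂ λ as bs → ∃₂ λ n₁ n₂ → Walk G B u x as n₁ × Walk G B y v bs n₂ ×
      xs ≡ as ++ bs × Adj G v x × Adj G u y × n₁ + n₂ ≤ n
  crossing-endpoints {u = u} {v} {xs} p h with crossing (adj G u) (adj G v) p
  ... | inj₁ r = r
  ... | inj₂ few = ⊥-elim (1+n≰n (≤-trans (≤-reflexive (+-comm 1 (length xs)))
      (≤-trans (+-monoˡ-≤ 1 h) (≤-trans few (≤-reflexive tidy)))))
    where
    tidy : length xs + ⟨ adj G u u ⟩ + ⟨ adj G v v ⟩ ≡ length xs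
    tidy rewrite irrefl G u | irrefl G v = ≡.trans (+-identityʳ _) (+-identityʳ _)

  -- Each crossing exchange replaces a non-adjacent Ore pair of the cyclic order by two edges.
  ore : (zs : List (Fin N)) → ∀ fuel {u v xs n} → n ≤ fuel → Walk G (OrePair zs) u v xs n →
    OrePair zs v u → xs ↭ zs → ∃ λ ys → Cyclic G ys × ys ↭ zs
  ore-closed : (zs : List (Fin N)) → ∀ fuel {u v xs n} → n ≤ fuel → Walk G (OrePair zs) u v xs n →
    Adj G v u → xs ↭ zs → ∃ λ ys → Cyclic G ys × ys ↭ zs

  ore zs fuel {u} {v} {xs} {n} n≤ p b perm with crossing-endpoints p (≡.subst₂ _≤_ (sym (↭-length perm))
        (≡.trans (+-comm (lc (adj G v) zs) _) (sym (≡.cong₂ _+_ (lc-↭ (adj G u) perm) (lc-↭ (adj G v) perm)))) b)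
  ... | x , y , as , bs , n₁ , n₂ , q , r , refl , e , f , le =
    -- With the second part reversed, the order runs from `u` to `x`, then from `v` to `y`. The two
    -- new adjacencies x-v and y-u are edges, and the bad closing pair is gone.
    ore-closed zs fuel (≤-trans le n≤) (join q (Adj-sym {G = G} e) (reverseWalk swapOre r))
      (Adj-sym {G = G} f) (trans (++⁺ˡ as (↭-reverse bs)) perm)
    where
    swapOre : ∀ {a b} → OrePair zs a b → OrePair zs b a
    swapOre {a} {b} h = ≤-trans h (≤-reflexive (+-comm (lc (adj G a) zs) (lc (adj G b) zs)))

  ore-closed zs _ {n = zero} _ p e perm = _ , (_ , _ , asPath p , e) , perm
  -- The closing pair is an edge, so the order may be cut at the first bad step instead; that step
  -- becomes the closing pair and one bad step fewer remains.
  ore-closed zs (suc fuel) {n = suc n} (s≤s n≤) p e perm with firstSkip p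
  ... | x , y , as , bs , q , b , r , refl = ore zs fuel (≤-trans (≤-reflexive (+-identityʳ n)) n≤) (join r e q) b
    (trans (++-comm bs as) perm)

-- Breadth-first search and long paths

find? : ∀ {n} (p : Sub n) → (∃ λ v → p v ≡ true) ⊎ (∀ v → p v ≡ true → ⊥)
find? p with any? (λ v → dec? (p v))
... | yes r = inj₁ r
... | no ¬r = inj₂ λ v pv → ¬r (v , pv)

some : ∀ {n} → Sub n → Bool
some p = does (any? (λ v → dec? (p v)))

even : ℕ → Bool
even zero = true
even (suc n) = not (even n)

not-swap : ∀ {a b} → a ≡ not b → b ≡ not a
not-swap {false} {true} _ = refl
not-swap {true} {false} _ = refl

module _ {N : ℕ} (G : Graph N) where

  private V = Fin N

  nb : V → Sub N → Sub N
  nb v Y u = Y u ∧ adj G v u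

  Closed : Sub N → Sub N → Set
  Closed Y A = ∀ {u v} → A u ≡ true → Y v ≡ true → Adj G u v → A v ≡ true

  ball : Sub N → V → ℕ → Sub N
  ball Y r zero v = does (v ≟ r)
  ball Y r (suc j) v = ball Y r j v ∨ (Y v ∧ some (λ u → ball Y r j u ∧ adj G u v))

  module _ (Y : Sub N) (r : V) where

    private B = ball Y r

    ball-root : ∀ j → B j r ≡ true
    ball-root zero = dec-true (r ≟ r) refl
    ball-root (suc j) = ∨-introˡ (ball-root j)

    ball-mono : ∀ {i j} → i ≤ j → B i ⊑ B j
    ball-mono {zero} {j} _ v h = subst (λ x → B j x ≡ true) (sym (does-true {d = v ≟ r} h)) (ball-root j)
    ball-mono {suc i} {suc j} (s≤s le) v h with ∨-elim {B i v} h
    ... | inj₁ h′ = ∨-introˡ (ball-mono le v h′)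
    ... | inj₂ h′ with ∧-elim h′
    ... | Yv , s with does-true {d = any? (λ u → dec? (B i u ∧ adj G u v))} s
    ... | u , q = ∨-introʳ (∧-intro Yv (dec-true (any? (λ u → dec? (B j u ∧ adj G u v)))
      (u , ∧-intro (ball-mono le u (proj₁ (∧-elim q))) (proj₂ (∧-elim q)))))

    ball-step : ∀ {j u v} → B j u ≡ true → Y v ≡ true → Adj G u v → B (suc j) v ≡ true
    ball-step {j} {u} {v} h Yv e = ∨-introʳ {B j v} (∧-intro Yv (dec-true (any? (λ u → dec? (B j u ∧ adj G u v)))
      (u , ∧-intro h e)))

    ball-pred : ∀ {j v} → B (suc j) v ≡ true → B j v ≡ true ⊎ ∃ λ u → B j u ≡ true × Adj G u v × Y v ≡ true
    ball-pred {j} {v} h with ∨-elim {B j v} h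
    ... | inj₁ h′ = inj₁ h′
    ... | inj₂ h′ with ∧-elim h′
    ... | Yv , s with does-true {d = any? (λ u → dec? (B j u ∧ adj G u v))} s
    ... | u , q = inj₂ (u , proj₁ (∧-elim q) , proj₂ (∧-elim q) , Yv)

    ball-⊑ : Y r ≡ true → ∀ j → B j ⊑ Y
    ball-⊑ Yr zero v h = subst (λ x → Y x ≡ true) (sym (does-true {d = v ≟ r} h)) Yr
    ball-⊑ Yr (suc j) v h with ball-pred {j} h
    ... | inj₁ h′ = ball-⊑ Yr j v h′
    ... | inj₂ (_ , _ , _ , Yv) = Yv

    closed-later : ∀ {i j} → i ≤ j → Closed Y (B i) → B j ⊑ B i
    closed-later {i} {zero} z≤n c v h = h
    closed-later {i} {suc j} le c v h with m≤n⇒m<n∨m≡n le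
    ... | inj₂ refl = h
    ... | inj₁ (s≤s le′) with ball-pred {j} h
    ... | inj₁ h′ = closed-later le′ c v h′
    ... | inj₂ (u , Bu , e , Yv) = c (closed-later le′ c u Bu) Yv e

    -- The closed neighbourhood: a vertex without a degree condition can be heavy through its own
    -- weight.
    hood : V → Sub N
    hood z u = Y u ∧ (does (u ≟ z) ∨ adj G z u)

    module _ (w : V → ℕ) (δ : ℕ) (heavy : ∀ z → Y z ≡ true → δ ≤ wt w (hood z)) where

      -- The neighbourhood of a vertex on the sphere of radius j + 2 is disjoint from the ball of radius j.
      ball-growth : Y r ≡ true → ∀ i → (∃ λ j → j ≤ i * 3 × Closed Y (B j)) ⊎ i * δ ≤ wt w (B (i * 3))
      ball-growth Yr zero = inj₂ z≤n
      ball-growth Yr (suc i) with ball-growth Yr i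
      ... | inj₁ (j , le , c) = inj₁ (j , ≤-trans le (m≤n+m (i * 3) 3) , c)
      ... | inj₂ big with find? (λ z → B (2 + i * 3) z ∧ not (B (1 + i * 3) z))
      ... | inj₂ none = inj₁ (1 + i * 3 , m≤n+m (1 + i * 3) 2 , closed)
        where
        closed : Closed Y (B (1 + i * 3))
        closed {u} {v} Bu Yv e with true? (B (1 + i * 3) v)
        ... | inj₁ h = h
        ... | inj₂ h = ⊥-elim (none v (∧-intro (ball-step {1 + i * 3} {u} {v} Bu Yv e) (≡.cong not h)))
      ... | inj₁ (z , h) with ∧-elim {B (2 + i * 3) z} h
      ... | Bz , ¬Bz = inj₂ (≤-trans (+-mono-≤ (heavy z (ball-⊑ Yr (2 + i * 3) z Bz)) big)
        (wt-disjoint w {p = hood z} {q = B (i * 3)} {r = B (3 + i * 3)} inside (ball-mono (m≤n+m (i * 3) 3)) apart))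
        where
        inside : hood z ⊑ B (3 + i * 3)
        inside u q with ∧-elim {Y u} q
        ... | Yu , q′ with ∨-elim {does (u ≟ z)} q′
        ... | inj₁ u≡z = subst (λ x → B (3 + i * 3) x ≡ true) (sym (does-true {d = u ≟ z} u≡z))
          (ball-mono (n≤1+n (2 + i * 3)) z Bz)
        ... | inj₂ e = ball-step {2 + i * 3} Bz Yu e
        apart : ∀ u → hood z u ≡ true → B (i * 3) u ≡ true → ⊥
        apart u q Bu with ∧-elim {Y u} q
        ... | Yu , q′ with ∨-elim {does (u ≟ z)} q′
        ... | inj₁ u≡z = true≢false (ball-mono (n≤1+n (i * 3)) z
          (subst (λ x → B (i * 3) x ≡ true) (does-true {d = u ≟ z} u≡z) Bu)) (not-elim ¬Bz)
        ... | inj₂ e = true≢false (ball-step {i * 3} Bu (ball-⊑ Yr (2 + i * 3) z Bz) (Adj-sym {G = G} e))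
            (not-elim ¬Bz)

      -- If no ball up to radius `i * 3` were closed, the last one would weigh `i * δ`, more than
      -- all of `Y`. Once closed, the balls no longer grow.
      ball-closed : Y r ≡ true → ∀ i → wt w Y < i * δ → Closed Y (B (i * 3))
      ball-closed Yr i small with ball-growth Yr i
      ... | inj₂ big = contradiction (≤-trans big (wt-mono w (ball-⊑ Yr (i * 3)))) (<⇒≱ small)
      ... | inj₁ (j , le , c) = λ Bu Yv e → ball-mono le _ (c (closed-later le c _ Bu) Yv e)

    Sphere : ℕ → V → Set
    Sphere zero v = B zero v ≡ true
    Sphere (suc j) v = B (suc j) v ≡ true × B j v ≡ false

    sphere⊑ball : ∀ {j v} → Sphere j v → B j v ≡ true
    sphere⊑ball {zero} h = h
    sphere⊑ball {suc j} (h , _) = h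

    level : ℕ → V → ℕ
    level zero v = 0
    level (suc j) v = if B j v then level j v else suc j

    level-sphere : ∀ j v → B j v ≡ true → Sphere (level j v) v
    level-sphere zero v h = h
    level-sphere (suc j) v h = choose (B j v) refl
      where
      choose : ∀ b → B j v ≡ b → Sphere (if b then level j v else suc j) v
      choose true eq = level-sphere j v eq
      choose false eq = h , eq

    level≤ : ∀ j v → level j v ≤ j
    level≤ zero v = z≤n
    level≤ (suc j) v with B j v
    ... | true = m≤n⇒m≤1+n (level≤ j v)
    ... | false = ≤-refl

    sphere-pred : ∀ {j v} → Sphere (suc j) v → ∃ λ u → Sphere j u × Adj G u v
    sphere-pred {j} {v} (h , ¬h) with ball-pred {j} h
    ... | inj₁ h′ = ⊥-elim (true≢false h′ ¬h)
    ... | inj₂ (u , Bu , e , Yv) = u , on j Bu ¬h , e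
      where
      on : ∀ j → B j u ≡ true → B j v ≡ false → Sphere j u
      on zero Bu _ = Bu
      on (suc j) Bu ¬h = Bu , ¬true⇒false (λ Bu′ → true≢false (ball-step {j} Bu′ Yv e) ¬h)

    sphere-path : ∀ j {v} → Sphere j v →
      ∃ λ xs → Path G r v xs × Unique xs × All (λ x → B j x ≡ true) xs × length xs ≡ suc j
    sphere-path zero {v} h with does-true {d = v ≟ r} h
    ... | refl = r ∷ [] , end , [] ∷ [] , h ∷ [] , refl
    sphere-path (suc j) {v} s@(h , ¬h) with sphere-pred {j} s
    ... | u , s′ , e with sphere-path j s′
    ... | xs , p , uq , all , len = xs ++ [ v ] , join p e end ,
      Unique-++⁺ uq ([] ∷ []) (λ { i (here refl) → true≢false (All.lookup all i) ¬h }) ,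
      AllP.++⁺ (All.map (λ {x} → ball-mono (n≤1+n j) x) all) (h ∷ []) ,
      ≡.trans (length-++ xs) (≡.trans (+-comm (length xs) 1) (cong suc len))

    ball-path : Y r ≡ true → ∀ j {v} → B j v ≡ true →
      ∃ λ xs → Path G r v xs × Unique xs × All (λ x → Y x ≡ true) xs × length xs ≤ suc j
    ball-path Yr j {v} h with sphere-path (level j v) (level-sphere j v h)
    ... | xs , p , uq , all , len = xs , p , uq , All.map (λ {x} → ball-⊑ Yr (level j v) x) all ,
      ≤-trans (≤-reflexive len) (s≤s (level≤ j v))

    sphere-edge : ∀ j {x y} → Sphere j x → Sphere j y → Adj G x y → ∃ λ xs → ∃ λ ys →
      Path G r y xs × Unique xs × length xs ≡ suc j × Path G r y ys × Unique ys × length ys ≡ suc (suc j) ×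
      All (λ z → B j z ≡ true) xs × All (λ z → B j z ≡ true) ys
    sphere-edge zero {x} {y} sx sy e with does-true {d = x ≟ r} sx | does-true {d = y ≟ r} sy
    ... | refl | refl = ⊥-elim (Adj-irrefl G e)
    sphere-edge (suc j) {x} {y} sx@(hx , _) sy@(hy , ¬hy) e with sphere-path (suc j) sy
    ... | xs , p , uq , all , len with sphere-pred {j} sx
    ... | u , su , f with sphere-path j su
    ... | ys , q , vq , all′ , len′ = xs , ys ++ x ∷ y ∷ [] , p , uq , len , join q f (step e end) ,
      Unique-++⁺ vq (((λ { refl → Adj-irrefl G e }) ∷ []) ∷ [] ∷ []) (λ
        { i (here refl) → true≢false (All.lookup all′ i) (proj₂ sx)
        ; i (there (here refl)) → true≢false (All.lookup all′ i) ¬hy }) ,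
      ≡.trans (length-++ ys) (≡.trans (+-comm (length ys) 2) (cong (λ k → suc (suc k)) len′)) , all ,
      AllP.++⁺ (All.map (λ {z} → ball-mono (n≤1+n j) z) all′) (hx ∷ hy ∷ [])

    level-edge : ∀ J → Y ⊑ B J → ∀ {u v} → Y u ≡ true → Y v ≡ true → Adj G u v → level J v ≤ suc (level J u)
    level-edge J reach {u} {v} Yu Yv e = go (level J v) (level-sphere J v (reach v Yv))
      where
      Bv : B (suc (level J u)) v ≡ true
      Bv = ball-step {level J u} (sphere⊑ball {level J u} (level-sphere J u (reach u Yu))) Yv e
      go : ∀ b → Sphere b v → b ≤ suc (level J u)
      go zero _ = z≤n
      go (suc b) (_ , ¬h) with ≤-<-connex (suc b) (suc (level J u))
      ... | inj₁ le = le
      ... | inj₂ (s≤s lt) = ⊥-elim (true≢false (ball-mono lt v Bv) ¬h)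

    -- Levels of adjacent vertices differ by at most one. If no edge lies within a level, they
    -- differ by exactly one, and the parity of the level is a proper colouring.
    level-colouring : ∀ J → Y ⊑ B J →
      (∃ λ j → ∃₂ λ x y → j ≤ J × Sphere j x × Sphere j y × Adj G x y) ⊎
      (∃ λ (col : Sub N) → ∀ {u v} → Y u ≡ true → Y v ≡ true → Adj G u v → col v ≡ not (col u))
    level-colouring J reach with any? (λ x → any? (λ y → dec? (Y x ∧ Y y ∧ adj G x y ∧ does
        (level J x ≟ⁿ level J y))))
    ... | yes (x , y , h) with ∧-elim h
    ... | Yx , h′ with ∧-elim {Y y} h′
    ... | Yy , h″ with ∧-elim {adj G x y} h″
    ... | e , l = inj₁ (level J x , x , y , level≤ J x , level-sphere J x (reach x Yx) ,
      subst (λ j → Sphere j y) (sym (does-true {d = level J x ≟ⁿ level J y} l)) (level-sphere J y (reach y Yy)) , e)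
    level-colouring J reach | no none = inj₂ ((λ v → even (level J v)) , proper)
      where
      proper : ∀ {u v} → Y u ≡ true → Y v ≡ true → Adj G u v → even (level J v) ≡ not (even (level J u))
      proper {u} {v} Yu Yv e with <-cmp (level J u) (level J v)
      ... | tri< lt _ _ = cong even (≤-antisym (level-edge J reach Yu Yv e) lt)
      ... | tri≈ _ eq _ = ⊥-elim (none (u , v , ∧-intro Yu
          (∧-intro Yv (∧-intro e (dec-true (level J u ≟ⁿ level J v) eq)))))
      ... | tri> _ _ gt = not-swap (cong even (≤-antisym (level-edge J reach Yv Yu (Adj-sym {G = G} e)) gt))

  private
    nb-outside : ∀ {H b v xs} → b ≤ # (nb v H) → (∀ w → nb v (H ∖ xs) w ≡ true → ⊥) → b ≤ lc (adj G v) xs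
    nb-outside {H} {b} {v} {xs} deg none = ≤-trans deg (≤-trans (#≤lc+#∖ (nb v H) xs) (≤-trans
      (+-mono-≤ (lc-mono (nb v H) (adj G v) (All.tabulate {xs = xs} (λ {x} _ q → proj₂ (∧-elim {H x} q))))
        (≤-reflexive (wt-empty (λ _ → 1) {p = nb v H ∖ xs} λ w q → case ∖-elim q of λ
          { (h , w∉) → none w (∧-intro (∖-intro (proj₁ (∧-elim h)) w∉) (proj₂ (∧-elim {H w} h))) })))
      (≤-reflexive (+-identityʳ _))))

  -- A path is prolonged by one vertex. If neither end has a neighbour outside it, all their
  -- neighbours lie on it, and as it has fewer than `b + b` vertices the crossing argument closes it
  -- to a cycle on the same vertices.
  longPath : (H : Sub N) (b : ℕ) →
    (∀ A → A ⊑ H → Closed H A → ∀ {a} → A a ≡ true → ∀ v → H v ≡ true → A v ≡ true) →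
    (∀ v → H v ≡ true → b ≤ # (nb v H)) → ∀ p → suc p ≤ # H → suc p ≤ b + b →
    ∃₂ λ u v → ∃ λ xs → Path G u v xs × Unique xs × All (λ x → H x ≡ true) xs × length xs ≡ suc p
  longPath H b conn deg zero h _ with #-find H h
  ... | v , Hv = v , v , v ∷ [] , end , [] ∷ [] , Hv ∷ [] , refl
  longPath H b conn deg (suc p) h le with longPath H b conn deg p (≤-trans (n≤1+n _) h) (≤-trans (n≤1+n _) le)
  ... | u , v , xs , path , uq , all , len with find? (nb u (H ∖ xs))
  ... | inj₁ (w , q) with ∧-elim q
  ... | Hw , e with ∖-elim Hw
  ... | Hw′ , w∉ = w , v , w ∷ xs , step (Adj-sym {G = G} e) path , Unique-∷ w∉ uq , Hw′ ∷ all , cong suc len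
  longPath H b conn deg (suc p) h le | u , v , xs , path , uq , all , len | inj₂ noneᵤ with find? (nb v (H ∖ xs))
  ... | inj₁ (w , q) with ∧-elim q
  ... | Hw , e with ∖-elim Hw
  ... | Hw′ , w∉ = u , w , xs ++ [ w ] , join path e end , Unique-++⁺ uq ([] ∷ []) (λ { i (here refl) → w∉ i }) ,
    AllP.++⁺ all (Hw′ ∷ []) , ≡.trans (length-++ xs) (≡.trans (+-comm (length xs) 1) (cong suc len))
  longPath H b conn deg (suc p) h le | u , v , xs , path , uq , all , len | inj₂ noneᵤ | inj₂ noneᵥ
    with crossing-endpoints G path (≤-trans (≤-reflexive len) (≤-trans (≤-trans (n≤1+n _) le)
      (+-mono-≤ (nb-outside {H} (deg u (All.lookup all (start∈ path))) noneᵤ)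
                (nb-outside {H} (deg v (All.lookup all (end∈ path))) noneᵥ))))
  ... | x , y , as , bs , zero , zero , q , r , refl , e , f , _ =
    -- An edge leaving the cycle yields the longer path. Without one the cycle is closed in `H`, so
    -- by connectedness it covers `H`, which has more vertices.
    extend (find? (λ z → (H ∖ xs) z ∧ some (λ y → mem xs y ∧ adj G y z)))
    where
    cyc : Cyclic G (as ++ reverse bs)
    cyc = _ , _ , join q (Adj-sym {G = G} e) (reversePath r) , Adj-sym {G = G} f
    perm : as ++ reverse bs ↭ xs
    perm = ++⁺ˡ as (↭-reverse bs)
    extend : _ → _
    extend (inj₁ (z , h)) with ∧-elim h
    ... | Hz , s with ∖-elim Hz | does-true {d = any? (λ y → dec? (mem xs y ∧ adj G y z))} s
    ... | Hz′ , z∉ | y , g with ∧-elim g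
    ... | y∈ , y~z with rotate cyc (∈-resp-↭ (↭-sym perm) (does-true {d = y ∈? xs} y∈))
    ... | u′ , ys , path′ , perm′ = u′ , z , ys ++ [ z ] , join path′ y~z end ,
      Unique-++⁺ (Unique-resp-↭ (↭-sym full) uq) ([] ∷ []) (λ { i (here refl) → z∉ (∈-resp-↭ full i) }) ,
      AllP.++⁺ (All-resp-↭ (↭-sym full) all) (Hz′ ∷ []) ,
      ≡.trans (length-++ ys) (≡.trans (+-comm (length ys) 1) (cong suc (≡.trans (↭-length full) len)))
      where
      full : ys ↭ xs
      full = trans perm′ perm
    extend (inj₂ none) = contradiction (≤-trans (wt-mono (λ _ → 1) {p = H} {q = mem xs} covered)
        (≤-trans (#mem≤length xs) (≤-reflexive len))) (<⇒≱ h)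
      where
      closed : Closed H (mem xs)
      closed {a} {c} a∈ Hc g with c ∈? xs
      ... | yes _ = refl
      ... | no c∉ = ⊥-elim (none c (∧-intro (∖-intro Hc c∉) (dec-true (any? (λ y → dec? (mem xs y ∧ adj G y c)))
        (a , ∧-intro a∈ g))))
      covered : ∀ v → H v ≡ true → mem xs v ≡ true
      covered = conn (mem xs) (λ v v∈ → All.lookup all (does-true {d = v ∈? xs} v∈)) closed
        (dec-true (u ∈? xs) (start∈ path))

-- Clusters

swap-last : ∀ x y z → x * y * z ≡ x * z * y
swap-last = solve-∀

chain-avoid : ∀ a m → suc (suc (suc a)) + suc (3 * m) ≡ a + suc (3 * suc m)
chain-avoid = solve-∀

chain-detour : ∀ m → 3 + (suc m + (m + m)) ≡ suc (suc m) + (suc m + suc m)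
chain-detour = solve-∀

∖-++⁻ : ∀ {n} {p : Sub n} {xs ys} → (p ∖ (xs ++ ys)) ⊑ ((p ∖ xs) ∖ ys)
∖-++⁻ {xs = xs} v h with ∖-elim h
... | pv , v∉ = ∖-intro (∖-intro pv (v∉ ∘ ∈-++⁺ˡ)) (v∉ ∘ ∈-++⁺ʳ xs)

∖-++⁺ : ∀ {n} {p : Sub n} {xs ys} → ((p ∖ xs) ∖ ys) ⊑ (p ∖ (xs ++ ys))
∖-++⁺ {xs = xs} v h with ∖-elim h
... | h′ , v∉ys with ∖-elim h′
... | pv , v∉xs = ∖-intro pv λ i → case ∈-++⁻ xs i of λ { (inj₁ i) → v∉xs i ; (inj₂ i) → v∉ys i }

module _ {N : ℕ} (G : Graph N) where

  -- Connectedness after deletion is stated through closed sets: a nonempty closed set is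
  -- everything. This form is what breadth-first search and the failure of a separation deliver
  -- directly.
  Conn : ℕ → Sub N → Set
  Conn k Y = ∀ X → length X ≤ k → ∀ A → A ⊑ (Y ∖ X) → Closed G (Y ∖ X) A →
    ∀ {a} → A a ≡ true → ∀ v → (Y ∖ X) v ≡ true → A v ≡ true

  -- The degree is `b + k` so that `b` survives every deletion that `conn` allows.
  record Cluster (b k : ℕ) (K : Sub N) : Set where
    field
      conn   : Conn k K
      degree : ∀ v → K v ≡ true → b + k ≤ # (nb G v K)

  open Cluster public

  degree-∖ : ∀ {b k} (K : Sub N) (X : List (Fin N)) {v} → length X ≤ k → b + k ≤ # (nb G v K) → b ≤ # (nb G v (K ∖ X))
  degree-∖ {b} {k} K X {v} len h = +-cancelˡ-≤ k _ _ (≤-trans (≤-reflexive (+-comm k b)) (≤-trans h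
    (≤-trans (#≤length+#∖ (nb G v K) X) (+-mono-≤ len (wt-mono (λ _ → 1) {p = nb G v K ∖ X} {q = nb G v (K ∖ X)}
        (λ u q →
      case ∖-elim q of λ { (q′ , u∉) → ∧-intro (∖-intro (proj₁ (∧-elim {K u} q′)) u∉) (proj₂ (∧-elim {K u} q′))
          }))))))

  remove : ∀ {b k l K} (X : List (Fin N)) → length X ≤ k → Cluster b (k + l) K → Cluster b l (K ∖ X)
  conn (remove {k = k} {l} {K} X len C) Y len′ A A⊑ closed Aa v h =
    conn C (X ++ Y) (≤-trans (≤-reflexive (length-++ X)) (+-mono-≤ len len′)) A
      (λ u Au → ∖-++⁺ u (A⊑ u Au)) (λ Au Yv e → closed Au (∖-++⁻ _ Yv) e) Aa v (∖-++⁺ v h)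
  degree (remove {b} {k} {l} {K} X len C) v h = degree-∖ {k = k} K X len
    (≤-trans (≤-reflexive lemma) (degree C v (proj₁ (∖-elim h))))
    where
    lemma : b + l + k ≡ b + (k + l)
    lemma = ≡.trans (+-assoc b l k) (cong (b +_) (+-comm l k))

  weaken : ∀ {b k l K} → l ≤ k → Cluster b k K → Cluster b l K
  conn (weaken le C) X len = conn C X (≤-trans len le)
  degree (weaken {b} le C) v h = ≤-trans (+-monoʳ-≤ b le) (degree C v h)

  Proper : Sub N → Sub N → Set
  Proper K col = ∀ {u v} → K u ≡ true → K v ≡ true → Adj G u v → col v ≡ not (col u)

flip : ℕ → Bool → Bool
flip zero b = b
flip (suc n) b = not (flip n b)

not-fixed : ∀ b → not b ≡ b → ⊥
not-fixed true ()
not-fixed false ()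

flip-fixed : ∀ n b → flip n b ≡ b → ∃ λ h → n ≡ h + h
flip-fixed zero b _ = 0 , refl
flip-fixed (suc zero) b eq = ⊥-elim (not-fixed b eq)
flip-fixed (suc (suc n)) b eq with flip-fixed n b (≡.trans (sym (not-involutive (flip n b))) eq)
... | h , refl = suc h , cong suc (sym (+-suc h h))

halve : ∀ n → ∃ λ h → n ≡ h + h ⊎ n ≡ suc (h + h)
halve zero = 0 , inj₁ refl
halve (suc n) with halve n
... | h , inj₁ refl = h , inj₂ refl
... | h , inj₂ refl = suc h , inj₁ (cong suc (sym (+-suc h h)))

even-difference : ∀ a h j → a + a + j ≡ h + h → ∃ λ g → j ≡ g + g
even-difference zero h j eq = h , eq
even-difference (suc a) zero j ()
even-difference (suc a) (suc h) j eq = even-difference a h j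
  (suc-injective (suc-injective (≡.trans (cong (λ k → suc (k + j)) (sym (+-suc a a)))
      (≡.trans eq (cong suc (+-suc h h))))))

module _ {N : ℕ} {G : Graph N} where

  -- Colours alternate along the path, so the parity of its number of vertices is determined by the
  -- colours of its ends.
  path-flip : ∀ {K col u v xs} → Proper G K col → Path G u v xs → All (λ x → K x ≡ true) xs →
    flip (length xs) (col v) ≡ not (col u)
  path-flip pr end _ = refl
  path-flip {col = col} {u} {v} pr (step {w} {xs = xs} e p) (Ku ∷ Ks) = begin
    not (flip (length xs) (col v)) ≡⟨ cong not (path-flip pr p Ks) ⟩
    not (not (col w))              ≡⟨ not-involutive (col w) ⟩
    col w                          ≡⟨ pr Ku (All.lookup Ks (start∈ p)) e ⟩
    not (col u)                    ∎
    where open ≡.≡-Reasoning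

  -- Adjacent vertices have disjoint neighbourhoods in a properly 2-coloured graph.
  coloured-size : ∀ {K col δ v} → Proper G K col → (∀ v → K v ≡ true → suc δ ≤ # (nb G v K)) → K v ≡ true →
    suc δ + suc δ ≤ # K
  coloured-size {K} {col} {δ} {v} pr deg Kv with #-find (nb G v K) (≤-trans (s≤s z≤n) (deg v Kv))
  ... | u , h with ∧-elim {K u} h
  ... | Ku , e = ≤-trans (+-mono-≤ (deg v Kv) (deg u Ku)) (wt-disjoint (λ _ → 1) {p = nb G v K} {q = nb G u K} {r = K}
    (λ w q → proj₁ (∧-elim {K w} q)) (λ w q → proj₁ (∧-elim {K w} q)) apart)
    where
    apart : ∀ w → nb G v K w ≡ true → nb G u K w ≡ true → ⊥
    apart w q q′ with ∧-elim {K w} q | ∧-elim {K w} q′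
    ... | Kw , f | _ , g = not-fixed (col v) (≡.trans (sym (pr Kv Ku e))
      (≡.trans (not-swap {col w} {col u} (pr Ku Kw g)) (≡.trans (cong not (pr Kv Kw f)) (not-involutive (col v)))))

-- Connectors and chains of 4-cycles in a cluster

module Segments {N : ℕ} (G : Graph N) (b₁ i c e : ℕ)
  (N<ib : N < i * suc b₁) (N<ec : N < e * c) (N<bb : N < suc b₁ * b₁) where

  private
    V = Fin N
    b = suc b₁

  -- `depth` bounds distances after deletions. A link runs to a root and back. `reserveSize` grants
  -- each dominating vertex one path to the root. `range` bounds three links together. `lowest` and
  -- `flexSize` account for the two paths to an edge within a level and for a chain of `range`
  -- 4-cycles.
  depth linkLength reserveSize range lowest flexSize : ℕ
  depth = i * 3
  linkLength = suc depth + suc depth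
  reserveSize = (e + i * c) * suc depth
  range = 3 * linkLength
  lowest = suc depth + suc range
  flexSize = suc depth + suc (suc depth) + suc (3 * range)

  record Square (Q : Sub N) (s : V) : Set where
    field
      y q z : V
      Qy : Q y ≡ true
      Qq : Q q ≡ true
      Qz : Q z ≡ true
      sy : Adj G s y
      yq : Adj G y q
      qz : Adj G q z
      sz : Adj G s z
      s≢q : s ≢ q
      y≢z : y ≢ z

  record Chain (Q : Sub N) (s : V) (m : ℕ) : Set where
    field
      t : V
      F : List V
      inside : All (λ x → Q x ≡ true) F
      size : length F ≤ suc (3 * m)
      route : ∀ j → j ≤ m → ∃ λ xs → Path G s t xs × Unique xs × xs ⊆ F × length xs ≡ suc m + (j + j)

  module _ {k : ℕ} {K : Sub N} (C : Cluster G b k K) where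

    outside-degree : ∀ X → length X ≤ k → ∀ v → K v ≡ true → b ≤ # (nb G v (K ∖ X))
    outside-degree X len v Kv = degree-∖ G {k = k} K X len (degree C v Kv)

    reach : ∀ X → length X ≤ k → ∀ {r} → (K ∖ X) r ≡ true → (K ∖ X) ⊑ ball G (K ∖ X) r depth
    reach X len {r} Kr v = conn C X len (ball G (K ∖ X) r depth) (ball-⊑ G (K ∖ X) r Kr depth)
      (ball-closed G (K ∖ X) r (λ _ → 1) b heavy Kr i (≤-<-trans (#≤n (K ∖ X)) N<ib)) {r}
          (ball-root G (K ∖ X) r depth) v
      where
      heavy : ∀ z → (K ∖ X) z ≡ true → b ≤ # (hood G (K ∖ X) r z)
      heavy z h = ≤-trans (outside-degree X len z (proj₁ (∖-elim h)))
        (wt-mono (λ _ → 1) {p = nb G z (K ∖ X)} {q = hood G (K ∖ X) r z} (λ u q →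
          ∧-intro (proj₁ (∧-elim {(K ∖ X) u} q)) (∨-introʳ (proj₂ (∧-elim {(K ∖ X) u} q)))))

    pathIn : ∀ X → length X ≤ k → ∀ {r v} → (K ∖ X) r ≡ true → (K ∖ X) v ≡ true →
      ∃ λ xs → Path G r v xs × Unique xs × All (λ x → (K ∖ X) x ≡ true) xs × length xs ≤ suc depth
    pathIn X len {r} {v} Kr Kv = ball-path G (K ∖ X) r Kr depth (reach X len Kr v Kv)

    module Reserving (X : List V) (len : length X ≤ k) where

      private Q = K ∖ X

      -- Greedy choice: while `N * c < # U * b`, double counting finds a vertex of `Q` adjacent to
      -- more than `c` vertices of `U`. Each choice lowers `# U` by more than `c`, which limits the
      -- number of choices.
      dominate : ∀ fuel (U : Sub N) → # U ≤ fuel → U ⊑ K → ∃₂ λ D U′ → All (λ d → Q d ≡ true) D × U′ ⊑ U ×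
        (∀ u → U u ≡ true → U′ u ≡ true ⊎ ∃ λ d → d ∈ D × Adj G u d) ×
        length D * c + # U′ ≤ # U × # U′ * b ≤ N * c
      dominate fuel U le U⊑K with N * c <? # U * b
      dominate fuel U le U⊑K | no ¬big = [] , U , [] , (λ _ h → h) , (λ _ h → inj₁ h) , ≤-refl , ≮⇒≥ ¬big
      dominate fuel U le U⊑K | yes big with double-count U (λ u → nb G u Q) b c (λ u Uu → outside-degree X len u
          (U⊑K u Uu)) big
      ... | q , many with #-find (λ u → U u ∧ nb G u Q q) (≤-<-trans z≤n many)
      ... | u₀ , h₀ with ∧-elim {Q q} (proj₂ (∧-elim {U u₀} h₀)) | fuel
      ... | Qq , _ | zero = contradiction (≤-trans (wt-mono (λ _ → 1) {p = λ u → U u ∧ nb G u Q q} {q = U}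
              (λ u h → proj₁ (∧-elim h))) le) (<⇒≱ (≤-<-trans z≤n many))
      ... | Qq , _ | suc fuel′ = result (dominate fuel′ U₁ smaller (λ u h → U⊑K u (proj₁ (∧-elim h))))
        where
        U₁ : Sub N
        U₁ u = U u ∧ not (adj G u q)
        shrink : suc c + # U₁ ≤ # U
        shrink = ≤-trans (+-monoˡ-≤ (# U₁) many) (wt-disjoint (λ _ → 1) {p = λ u → U u ∧ nb G u Q q} {q = U₁} {r = U}
          (λ u h → proj₁ (∧-elim h)) (λ u h → proj₁ (∧-elim h))
          (λ u h h′ → true≢false (proj₂ (∧-elim {Q q} (proj₂ (∧-elim {U u} h))))
              (not-elim (proj₂ (∧-elim {U u} h′)))))
        smaller : # U₁ ≤ fuel′
        smaller = s≤s⁻¹ (≤-trans (≤-trans (s≤s (m≤n+m (# U₁) c)) shrink) le)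
        result : _ → _
        result (D , U′ , all , U′⊑ , dom , size , small) = q ∷ D , U′ , Qq ∷ all ,
          (λ u h → proj₁ (∧-elim (U′⊑ u h))) , dom′ ,
          ≤-trans (≤-reflexive (+-assoc c (length D * c) (# U′))) (≤-trans (+-monoʳ-≤ c size)
              (≤-trans (n≤1+n _) shrink)) , small
          where
          dom′ : ∀ u → U u ≡ true → U′ u ≡ true ⊎ ∃ λ d → d ∈ q ∷ D × Adj G u d
          dom′ u Uu with true? (adj G u q)
          ... | inj₁ e = inj₂ (q , here refl , e)
          ... | inj₂ ¬e with dom u (∧-intro Uu (cong not ¬e))
          ... | inj₁ h = inj₁ h
          ... | inj₂ (d , d∈ , f) = inj₂ (d , there d∈ , f)

      neighbours : (us : List V) → All (λ u → K u ≡ true) us → ∃ λ D → All (λ d → Q d ≡ true) D ×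
        length D ≡ length us × (∀ u → u ∈ us → ∃ λ d → d ∈ D × Adj G u d)
      neighbours [] [] = [] , [] , refl , λ _ ()
      neighbours (u ∷ us) (Ku ∷ Ks) with neighbours us Ks | #-find (nb G u Q)
          (≤-trans (s≤s z≤n) (outside-degree X len u Ku))
      ... | D , all , eq , adjacent | d , h with ∧-elim {Q d} h
      ... | Qd , f = d ∷ D , Qd ∷ all , cong suc eq , λ
        { _ (here refl) → d , here refl , f
        ; v (there v∈) → case adjacent v v∈ of λ { (d′ , d∈ , g) → d′ , there d∈ , g } }

      -- The greedy phase takes fewer than `e` vertices because `N < e * c`. It leaves fewer than
      -- `i * c` vertices because `N < i * b`, and each of these contributes one neighbour. Vertices
      -- of `X` are dominated too, although `D` avoids `X`.
      dominating : ∃ λ D → All (λ d → Q d ≡ true) D × length D ≤ e + i * c × (∀ u → K u ≡ true → ∃ λ d → d ∈ D × Adj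
          G u d)
      dominating with dominate N K (#≤n K) (λ _ h → h)
      ... | D , U′ , all , U′⊑ , dom , size , small with elements U′
      ... | us , uq , inU′ , eq , complete with neighbours us (All.map (λ {u} → U′⊑ u) inU′)
      ... | D′ , all′ , eq′ , adjacent = D ++ D′ , AllP.++⁺ all all′ ,
        ≤-trans (≤-reflexive (length-++ D)) (+-mono-≤ (<⇒≤ few) (≤-trans (≤-reflexive (≡.trans eq′ eq)) (<⇒≤ rest)))
            , covered
        where
        few : length D < e
        few = *-cancelʳ-< c (length D) e (≤-<-trans (≤-trans (m≤m+n (length D * c) (# U′)) (≤-trans size (#≤n K)))
            N<ec)
        c>0 : 0 < c
        c>0 = n≢0⇒n>0 λ { refl → n≮0 (<-≤-trans N<ec (≤-reflexive (*-zeroʳ e))) }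
        rest : # U′ < i * c
        rest = *-cancelʳ-< b (# U′) (i * c) (≤-<-trans small (<-≤-trans (scale c>0) (≤-reflexive (swap-last i b c))))
          where
          scale : 0 < c → N * c < i * b * c
          scale (s≤s {n = c′} _) = *-monoˡ-< (suc c′) N<ib
        covered : ∀ u → K u ≡ true → ∃ λ d → d ∈ D ++ D′ × Adj G u d
        covered u Ku with dom u Ku
        ... | inj₂ (d , d∈ , f) = d , ∈-++⁺ˡ d∈ , f
        ... | inj₁ h with adjacent u (complete u h)
        ... | d , d∈ , f = d , ∈-++⁺ʳ D d∈ , f

      hub : ∀ {r} → Q r ≡ true → (D : List V) → All (λ d → Q d ≡ true) D → ∃ λ W → All (λ d → Q d ≡ true) W ×
        length W ≤ length D * suc depth ×
        (∀ d → d ∈ D → ∃ λ xs → Path G r d xs × xs ⊆ W × length xs ≤ suc depth)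
      hub Qr [] [] = [] , [] , z≤n , λ _ ()
      hub Qr (d ∷ D) (Qd ∷ Qs) with hub Qr D Qs | pathIn X len Qr Qd
      ... | W , all , size , paths | xs , p , _ , inQ , short = xs ++ W , AllP.++⁺ inQ all ,
        ≤-trans (≤-reflexive (length-++ xs)) (+-mono-≤ short size) , λ
        { _ (here refl) → xs , p , ∈-++⁺ˡ , short
        ; d′ (there d∈) → enlarge (paths d′ d∈) }
        where
        enlarge : ∀ {d} → (∃ λ ys → Path G _ d ys × ys ⊆ W × length ys ≤ suc depth) →
          ∃ λ ys → Path G _ d ys × ys ⊆ xs ++ W × length ys ≤ suc depth
        enlarge (ys , q , sub , short′) = ys , q , (λ i → ∈-++⁺ʳ xs (sub i)) , short′

      -- A link enters `W` at a dominating neighbour of `u`, passes through the root `r` and leaves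
      -- at a dominating neighbour of `v`.
      reserve : ∃ λ W → All (λ w → Q w ≡ true) W × length W ≤ reserveSize ×
        (∀ u v → K u ≡ true → K v ≡ true → ∃ λ ms → Link {G = G} u ms v × Unique ms × ms ⊆ W × length ms ≤ linkLength)
      reserve with dominating
      -- An empty dominating set means that `K` is empty, so there is nothing to link.
      ... | [] , _ , _ , dom = [] , [] , z≤n , λ u v Ku _ → case dom u Ku of λ ()
      ... | D@(r ∷ _) , all@(Qr ∷ _) , size , dom with hub Qr D all
      ... | W , all′ , size′ , paths = W , all′ , ≤-trans size′ (*-monoˡ-≤ (suc depth) size) , link
        where
        meet : ∀ {a z xs ys} → Path G a r xs → Path G r z ys → ∃ λ zs → Path G a z zs × zs ⊆ xs ++ ys × length zs ≤
            length (xs ++ ys)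
        meet {xs = xs} p end = xs , p , ∈-++⁺ˡ , length-++-≤ˡ xs
        meet {xs = xs} p (step {xs = ys} f q) = xs ++ ys , join p f q ,
          (λ i → case ∈-++⁻ xs i of λ { (inj₁ i) → ∈-++⁺ˡ i ; (inj₂ i) → ∈-++⁺ʳ xs (there i) }) ,
          ≤-trans (≤-reflexive (length-++ xs)) (≤-trans (+-monoʳ-≤ (length xs) (n≤1+n (length ys)))
              (≤-reflexive (sym (length-++ xs))))
        link : ∀ u v → K u ≡ true → K v ≡ true → ∃ λ ms → Link {G = G} u ms v × Unique ms × ms ⊆ W × length ms ≤
            linkLength
        link u v Ku Kv with dom u Ku | dom v Kv
        ... | d , d∈ , f | d′ , d′∈ , f′ with paths d d∈ | paths d′ d′∈
        ... | xs , p , sub , short | ys , q , sub′ , short′ with meet (reversePath p) q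
        ... | zs , r , sub″ , len″ with prune r
        ... | ms , r′ , uq , sub‴ , len‴ = ms , toLink f r′ (Adj-sym {G = G} f′) , uq ,
          (λ i → case ∈-++⁻ (reverse xs) (sub″ (sub‴ i)) of λ { (inj₁ i) → sub (∈-reverse⁻ xs i) ; (inj₂ i) → sub′ i
              }) ,
          ≤-trans len‴ (≤-trans len″ (≤-trans (≤-reflexive (length-++ (reverse xs)))
            (+-mono-≤ (≤-trans (≤-reflexive (length-reverse xs)) short) short′)))

    open Reserving public using (reserve)

    -- The at least `b` neighbours of `s` each have `b₁` neighbours other than `s`. As `N < b * b₁`,
    -- two of them share one, which is the vertex opposite to `s`.
    square : ∀ X → length X ≤ k → ∀ {s} → (K ∖ X) s ≡ true → Square (K ∖ X) s
    square X len {s} Ks with double-count (nb G s (K ∖ X)) (λ z → nb G z (K ∖ X) ∖ [ s ]) b₁ 1 degrees big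
      where
      Q = K ∖ X
      degrees : ∀ z → nb G s Q z ≡ true → b₁ ≤ # (nb G z Q ∖ [ s ])
      degrees z h = s≤s⁻¹ (≤-trans (outside-degree X len z (proj₁ (∖-elim (proj₁ (∧-elim {Q z} h)))))
          (#≤length+#∖ (nb G z Q) [ s ]))
      big : N * 1 < # (nb G s Q) * b₁
      big = ≤-<-trans (≤-reflexive (*-identityʳ N)) (<-≤-trans N<bb
          (*-monoˡ-≤ b₁ (outside-degree X len s (proj₁ (∖-elim Ks)))))
    ... | q , two with #-find (λ z → nb G s (K ∖ X) z ∧ (nb G z (K ∖ X) ∖ [ s ]) q) (<-trans (s≤s z≤n) two)
    ... | y , hy with fresh (λ z → nb G s (K ∖ X) z ∧ (nb G z (K ∖ X) ∖ [ s ]) q) [ y ] two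
    ... | z , hz , z∉ with ∧-elim {nb G s (K ∖ X) y} hy | ∧-elim {nb G s (K ∖ X) z} hz
    ... | sy , yq | sz , zq with ∖-elim yq | ∖-elim zq
    ... | yq′ , q∉ | zq′ , _ = record
      { y = y ; q = q ; z = z ; Qy = proj₁ (∧-elim sy) ; Qq = proj₁ (∧-elim {(K ∖ X) q} yq′) ; Qz = proj₁ (∧-elim sz)
      ; sy = proj₂ (∧-elim {(K ∖ X) y} sy) ; yq = proj₂ (∧-elim {(K ∖ X) q} yq′)
      ; qz = Adj-sym {G = G} (proj₂ (∧-elim {(K ∖ X) q} zq′)) ; sz = proj₂ (∧-elim {(K ∖ X) z} sz)
      ; s≢q = λ { refl → q∉ (here refl) } ; y≢z = λ { refl → z∉ (here refl) } }

    -- Each 4-cycle of the chain is traversed along one edge or along the other three.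
    chain : ∀ m X {s} → (K ∖ X) s ≡ true → length X + suc (3 * m) ≤ k → Chain (K ∖ X) s m
    chain zero X {s} Ks len = record
      { t = s ; F = s ∷ [] ; inside = Ks ∷ [] ; size = ≤-refl
      ; route = λ { zero _ → s ∷ [] , end , [] ∷ [] , (λ i → i) , refl } }
    chain (suc m) X {s} Ks len = grow (square X (≤-trans (m≤m+n (length X) _) len) Ks)
      where
      grow : Square (K ∖ X) s → Chain (K ∖ X) s (suc m)
      grow sq = record { t = Chain.t rest ; F = s ∷ y ∷ q ∷ F ; inside = Ks ∷ Qy ∷ Qq ∷ All.map inQ
          (Chain.inside rest)
        ; size = ≤-trans (+-monoʳ-≤ 3 (Chain.size rest)) (≤-reflexive (chain-avoid 0 m)) ; route = route }
        where
        open Square sq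
        z∉ : z ∉ s ∷ y ∷ q ∷ X
        z∉ (here refl) = Adj-irrefl G sz
        z∉ (there (here e)) = y≢z (sym e)
        z∉ (there (there (here refl))) = Adj-irrefl G qz
        z∉ (there (there (there i))) = proj₂ (∖-elim Qz) i
        rest : Chain (K ∖ (s ∷ y ∷ q ∷ X)) z m
        rest = chain m (s ∷ y ∷ q ∷ X) (∖-intro (proj₁ (∖-elim Qz)) z∉)
            (≤-trans (≤-reflexive (chain-avoid (length X) m)) len)
        open Chain rest using (F)
        inQ : ∀ {x} → (K ∖ (s ∷ y ∷ q ∷ X)) x ≡ true → (K ∖ X) x ≡ true
        inQ h = ∖-intro (proj₁ (∖-elim h)) (λ i → proj₂ (∖-elim h) (there (there (there i))))
        avoid : ∀ {x} → x ∈ F → x ∉ s ∷ y ∷ q ∷ X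
        avoid i = proj₂ (∖-elim (All.lookup (Chain.inside rest) i))
        Route : ℕ → List V → ℕ → Set
        Route n F′ j = ∃ λ xs → Path G s (Chain.t rest) xs × Unique xs × xs ⊆ F′ × length xs ≡ suc n + (j + j)
        short : ∀ {j} → (∃ λ xs → Path G z (Chain.t rest) xs × Unique xs × xs ⊆ F × length xs ≡ suc m + (j + j)) →
          Route (suc m) (s ∷ y ∷ q ∷ F) j
        short (xs , p , uq , sub , eq) = s ∷ xs , step sz p , Unique-∷ (λ i → avoid (sub i) (here refl)) uq ,
          (λ { (here e) → here e ; (there i) → there (there (there (sub i))) }) , cong suc eq
        long : (∃ λ xs → Path G z (Chain.t rest) xs × Unique xs × xs ⊆ F × length xs ≡ suc m + (m + m)) →
          Route (suc m) (s ∷ y ∷ q ∷ F) (suc m)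
        long (xs , p , uq , sub , eq) = s ∷ y ∷ q ∷ xs , step sy (step yq (step qz p)) ,
          Unique-∷ (λ { (here refl) → Adj-irrefl G sy ; (there (here e)) → s≢q e ; (there (there i)) → avoid (sub i)
              (here refl) })
          (Unique-∷ (λ { (here refl) → Adj-irrefl G yq ; (there i) → avoid (sub i) (there (here refl)) })
          (Unique-∷ (λ i → avoid (sub i) (there (there (here refl)))) uq)) ,
          (λ { (here e) → here e ; (there (here e)) → there (here e) ; (there (there (here e))) → there
              (there (here e))
             ; (there (there (there i))) → there (there (there (sub i))) }) ,
          ≡.trans (cong (λ n → suc (suc (suc n))) eq) (chain-detour m)
        route : ∀ j → j ≤ suc m → Route (suc m) (s ∷ y ∷ q ∷ F) j
        route j le with m≤n⇒m<n∨m≡n le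
        ... | inj₁ (s≤s le′) = short {j} (Chain.route rest j le′)
        ... | inj₂ refl = long (Chain.route rest m ≤-refl)

-- Paths of prescribed length in a cluster

Even : ℕ → Set
Even j = ∃ λ h → j ≡ h + h

assembled-length : ∀ a b c d e f → 1 + (a + ((b + c) + (d + (e + (f + 1))))) ≡ 2 + (a + d + f) + b + e + c
assembled-length = solve-∀

regroup-base : ∀ a b p j → 2 + a + b + suc p + j ≡ 3 + (a + j) + b + p
regroup-base = solve-∀

odd-length : ∀ j r h → suc (suc j) + (suc r + h) ≡ suc j + suc r + suc h
odd-length = solve-∀

slack : ∀ {a b c l} → a ≤ l → b ≤ l → c ≤ l → ∃ λ j → j ≤ 3 * l × a + b + c + j ≡ 3 * l
slack {a} {b} {c} {l} a≤ b≤ c≤ = (l ∸ a) + (l ∸ b) + (l ∸ c) ,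
  ≤-trans (+-mono-≤ (+-mono-≤ (m∸n≤m l a) (m∸n≤m l b)) (m∸n≤m l c)) (≤-reflexive (triple l)) ,
  ≡.trans (regroup a b c (l ∸ a) (l ∸ b) (l ∸ c))
    (≡.trans (≡.cong₂ _+_ (≡.cong₂ _+_ (m+[n∸m]≡n a≤) (m+[n∸m]≡n b≤)) (m+[n∸m]≡n c≤)) (triple l))
  where
  triple : ∀ l → l + l + l ≡ 3 * l
  triple = solve-∀
  regroup : ∀ a b c x y z → a + b + c + (x + y + z) ≡ (a + x) + (b + y) + (c + z)
  regroup = solve-∀

module Routing {N : ℕ} (G : Graph N) (b₁ i c e : ℕ)
  (N<ib : N < i * suc b₁) (N<ec : N < e * c) (N<bb : N < suc b₁ * b₁) where

  open Segments G b₁ i c e N<ib N<ec N<bb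

  private
    V = Fin N
    b = suc b₁

  -- `Allowed` records which offsets are realised: 4-cycles alone give the even ones, and a
  -- preceding choice between two paths of different parity gives all.
  record Flex (Q : Sub N) (Allowed : ℕ → Set) : Set where
    field
      s t : V
      F : List V
      shortest : ℕ
      shortest≤ : shortest ≤ lowest
      inside : All (λ x → Q x ≡ true) F
      size : length F ≤ flexSize
      s∈ : s ∈ F
      t∈ : t ∈ F
      route : ∀ j → j ≤ range → Allowed j → ∃ λ xs → Path G s t xs × Unique xs × xs ⊆ F × length xs ≡ shortest + j

  module _ {k : ℕ} {K : Sub N} (C : Cluster G b k K) where

    evenFlex : ∀ X {r} → (K ∖ X) r ≡ true → length X + flexSize ≤ k → Flex (K ∖ X) Even
    evenFlex X {r} Kr len = flex (chain C range X Kr (≤-trans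
        (+-monoʳ-≤ (length X) (m≤n+m (suc (3 * range)) (suc depth + suc (suc depth)))) len))
      where
      flex : Chain (K ∖ X) r range → Flex (K ∖ X) Even
      flex ch = record { s = r ; t = t ; F = F ; shortest = suc range ; shortest≤ = m≤n+m (suc range) (suc depth)
        ; inside = inside ; size = ≤-trans size (m≤n+m (suc (3 * range)) (suc depth + suc (suc depth)))
        ; s∈ = ends (λ p sub → sub (start∈ p)) ; t∈ = ends (λ p sub → sub (end∈ p))
        ; route = λ { _ le (h , refl) → route h (≤-trans (m≤m+n h h) le) } }
        where
        open Chain ch
        ends : ∀ {x} → (∀ {xs} → Path G r t xs → xs ⊆ F → x ∈ F) → x ∈ F
        ends f with route 0 z≤n
        ... | xs , p , _ , sub , _ = f p (λ {z} i → sub {z} i)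

    -- Two paths from `r` to `y` have `suc j` and `suc (suc j)` vertices, the longer one using the
    -- edge xy. A chain starting at a fresh neighbour of `y` and avoiding both supplies the even
    -- part of the offset.
    oddFlex : ∀ X {r} → (K ∖ X) r ≡ true → length X + flexSize ≤ k →
      ∀ {j x y} → j ≤ depth → Sphere G (K ∖ X) r j x → Sphere G (K ∖ X) r j y → Adj G x y → Flex (K ∖ X) (λ _ → ⊤)
    oddFlex X {r} Kr len {j} {x} {y} j≤ sx sy xy with sphere-edge G (K ∖ X) r j sx sy xy
    ... | xs , ys , p , uq , lenx , q , vq , leny , inx , iny = flex
        (next-vertex (fresh (nb G y (K ∖ X)) (xs ++ ys) room))
      where
      Q = K ∖ X
      ball⊑ : ball G Q r j ⊑ Q
      ball⊑ = ball-⊑ G Q r Kr j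
      Qy : Q y ≡ true
      Qy = ball⊑ y (sphere⊑ball G Q r {j} sy)
      short : length (xs ++ ys) ≤ suc depth + suc (suc depth)
      short = ≤-trans (≤-reflexive (length-++ xs)) (+-mono-≤ (≤-trans (≤-reflexive lenx) (s≤s j≤))
          (≤-trans (≤-reflexive leny) (s≤s (s≤s j≤))))
      short′ : length (X ++ xs ++ ys) + suc (3 * range) ≤ k
      short′ = ≤-trans (+-monoˡ-≤ _ (≤-trans (≤-reflexive (length-++ X)) (+-monoʳ-≤ (length X) short)))
        (≤-trans (≤-reflexive (+-assoc (length X) (suc depth + suc (suc depth)) (suc (3 * range)))) len)
      room : length (xs ++ ys) < # (nb G y Q)
      room = +-cancelˡ-< (length X) _ _ (≤-<-trans (≤-trans (≤-reflexive (sym (length-++ X)))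
        (≤-trans (m≤m+n _ (suc (3 * range))) short′)) (<-≤-trans (s≤s (m≤n+m k b₁))
            (≤-trans (degree C y (proj₁ (∖-elim Qy)))
        (≤-trans (#≤length+#∖ (nb G y K) X) (+-monoʳ-≤ (length X) (wt-mono (λ _ → 1) {p = nb G y K ∖ X}
            {q = nb G y Q} (λ u h →
          case ∖-elim h of λ { (h′ , u∉) → ∧-intro (∖-intro (proj₁ (∧-elim {K u} h′)) u∉) (proj₂ (∧-elim {K u} h′))
              })))))))
      next-vertex : (∃ λ s → nb G y Q s ≡ true × s ∉ xs ++ ys) → ∃ λ s → Adj G y s × Chain (K ∖ (X ++ xs ++ ys)) s
          range
      next-vertex (s , h , s∉) with ∧-elim {Q s} h
      ... | Qs , e = s , e , chain C range (X ++ xs ++ ys) (∖-++⁺ {xs = X} s (∖-intro Qs s∉)) short′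
      flex : (∃ λ s → Adj G y s × Chain (K ∖ (X ++ xs ++ ys)) s range) → Flex Q (λ _ → ⊤)
      flex (s , ys~s , ch) = record { s = r ; t = t ; F = (xs ++ ys) ++ F ; shortest = suc j + suc range
        ; shortest≤ = +-monoˡ-≤ (suc range) (s≤s j≤)
        ; inside = AllP.++⁺ (AllP.++⁺ (All.map (λ {z} → ball⊑ z) inx) (All.map (λ {z} → ball⊑ z) iny))
            (All.map (λ {z} h → proj₁ (∖-elim (∖-++⁻ {xs = X} z h))) inside)
        ; size = ≤-trans (≤-reflexive (length-++ (xs ++ ys))) (+-mono-≤ short size)
        ; s∈ = ∈-++⁺ˡ (∈-++⁺ˡ (start∈ p))
        ; t∈ = ∈-++⁺ʳ (xs ++ ys) (last∈ (route 0 z≤n))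
        ; route = routes }
        where
        open Chain ch
        last∈ : (∃ λ zs → Path G s t zs × Unique zs × zs ⊆ F × length zs ≡ suc range + 0) → t ∈ F
        last∈ (zs , z , _ , sub , _) = sub (end∈ z)
        apart : ∀ {z} → z ∈ xs ++ ys → z ∈ F → ⊥
        apart i i′ = proj₂ (∖-elim (∖-++⁻ {xs = X} _ (All.lookup inside i′))) i
        Route : ℕ → Set
        Route n = ∃ λ zs → Path G r t zs × Unique zs × zs ⊆ (xs ++ ys) ++ F × length zs ≡ n
        extend : ∀ {as n} → Path G r y as → Unique as → as ⊆ xs ++ ys →
          (∃ λ zs → Path G s t zs × Unique zs × zs ⊆ F × length zs ≡ n) → Route (length as + n)
        extend {as} a ua sub (zs , z , uz , sub′ , eq) = as ++ zs , join a ys~s z ,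
          Unique-++⁺ ua uz (λ i i′ → apart (sub i) (sub′ i′)) ,
          (λ i → case ∈-++⁻ as i of λ { (inj₁ i) → ∈-++⁺ˡ (sub i) ; (inj₂ i) → ∈-++⁺ʳ (xs ++ ys) (sub′ i) }) ,
          ≡.trans (length-++ as) (cong (length as +_) eq)
        routes : ∀ n → n ≤ range → ⊤ → Route (suc j + suc range + n)
        -- The parity of the offset selects the path to `y`, half of it the number of 4-cycles
        -- passed the long way.
        routes n le _ with halve n
        ... | h , inj₁ refl = subst Route (≡.trans (cong (_+ (suc range + (h + h))) lenx)
            (sym (+-assoc (suc j) (suc range) (h + h))))
          (extend p uq (λ i → ∈-++⁺ˡ i) (route h (≤-trans (m≤m+n h h) le)))
        ... | h , inj₂ refl = subst Route (≡.trans (cong (_+ (suc range + (h + h))) leny)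
            (odd-length j range (h + h)))
          (extend q vq (λ i → ∈-++⁺ʳ xs i) (route h (≤-trans (m≤m+n h h) (≤-trans (n≤1+n (h + h)) le))))

    flexible : ∀ X {r} → (K ∖ X) r ≡ true → length X + flexSize ≤ k →
      Flex (K ∖ X) (λ _ → ⊤) ⊎ ∃ λ col → Proper G (K ∖ X) col
    flexible X {r} Kr len with level-colouring G (K ∖ X) r depth (reach C X (≤-trans (m≤m+n (length X) flexSize) len)
        Kr)
    ... | inj₂ colouring = inj₂ colouring
    ... | inj₁ (j , x , y , j≤ , sx , sy , e) = inj₁ (oddFlex X Kr len j≤ sx sy e)

    Links : List V → Set
    Links W = ∀ u v → K u ≡ true → K v ≡ true → ∃ λ ms → Link {G = G} u ms v × Unique ms × ms ⊆ W × length ms ≤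
        linkLength

    -- One set for each of the three links, so that the links cannot meet. The sets are fixed before
    -- the long path is found, since its ends cannot be prescribed; they can still be linked because
    -- each set serves all of `K`.
    record Reserves (x y : V) : Set where
      field
        W₁ W₂ W₃ : List V
        in₁ : All (λ w → (K ∖ (x ∷ y ∷ [])) w ≡ true) W₁
        in₂ : All (λ w → (K ∖ (W₁ ++ x ∷ y ∷ [])) w ≡ true) W₂
        in₃ : All (λ w → (K ∖ (W₂ ++ W₁ ++ x ∷ y ∷ [])) w ≡ true) W₃
        links₁ : Links W₁
        links₂ : Links W₂
        links₃ : Links W₃
        size : length (W₃ ++ W₂ ++ W₁ ++ x ∷ y ∷ []) ≤ 2 + 3 * reserveSize
      reserved : List V
      reserved = W₃ ++ W₂ ++ W₁ ++ x ∷ y ∷ []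

    reserves : 2 + 3 * reserveSize ≤ k → ∀ x y → Reserves x y
    reserves room x y = build
      where
      within : ∀ j → j ≤ 3 → 2 + j * reserveSize ≤ k
      within j le = ≤-trans (+-monoʳ-≤ 2 (*-monoˡ-≤ reserveSize le)) room
      grow : ∀ j {W X : List V} → length W ≤ reserveSize → length X ≤ 2 + j * reserveSize → length (W ++ X) ≤ 2 + suc
          j * reserveSize
      grow j {W} {X} lw lx = ≤-trans (≤-reflexive (length-++ W))
          (≤-trans (+-mono-≤ lw lx) (≤-reflexive (shift reserveSize (j * reserveSize))))
        where
        shift : ∀ a b → a + suc (suc b) ≡ suc (suc (a + b))
        shift a b = ≡.trans (+-suc a (suc b)) (cong suc (+-suc a b))
      Result : List V → Set
      Result X = ∃ λ W → All (λ w → (K ∖ X) w ≡ true) W × length W ≤ reserveSize × Links W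
      next-reserve : ∀ X → length X ≤ k → Result X
      next-reserve X = reserve C X
      build : Reserves x y
      build with next-reserve (x ∷ y ∷ []) (within 0 z≤n)
      ... | W₁ , in₁ , size₁ , l₁ with next-reserve (W₁ ++ x ∷ y ∷ []) (≤-trans (grow 0 {W₁} size₁ ≤-refl)
          (within 1 (s≤s z≤n)))
      ... | W₂ , in₂ , size₂ , l₂ with next-reserve (W₂ ++ W₁ ++ x ∷ y ∷ [])
              (≤-trans (grow 1 {W₂} size₂ (grow 0 {W₁} size₁ ≤-refl)) (within 2 (s≤s (s≤s z≤n))))
      ... | W₃ , in₃ , size₃ , l₃ = record { W₁ = W₁ ; W₂ = W₂ ; W₃ = W₃ ; in₁ = in₁ ; in₂ = in₂ ; in₃ = in₃
        ; links₁ = l₁ ; links₂ = l₂ ; links₃ = l₃ ; size = grow 2 {W₃} size₃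
            (grow 1 {W₂} size₂ (grow 0 {W₁} size₁ ≤-refl)) }

    -- The offset is kept apart from `base` because in a bipartite cluster its parity is known only
    -- after a route of offset 0 has revealed the parity of `base`.
    record Routes (Allowed : ℕ → Set) (x y : V) (L : ℕ) : Set where
      field
        base offset : ℕ
        total : base + offset ≡ L
        offset≤ : offset ≤ range
        route : ∀ j → j ≤ range → Allowed j →
          ∃ λ xs → Path G x y xs × Unique xs × All (λ v → K v ≡ true) xs × length xs ≡ base + j

    -- The route is x – W₁ – F – W₂ – long path – W₃ – y.
    assemble : ∀ {Allowed x y L} → x ≢ y → K x ≡ true → K y ≡ true → (R : Reserves x y) →
      Flex (K ∖ Reserves.reserved R) Allowed → 2 + 3 * reserveSize + flexSize ≤ k →
      3 + range + lowest ≤ L → L ≤ b + b → L + k ≤ # K → Routes Allowed x y L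
    assemble {Allowed} {x} {y} {L} x≢y Kx Ky R fl room low high large = result (longPath G H b connected degrees p
        enough double)
      where
      open Reserves R renaming (size to reserved-size)
      open Flex fl renaming (size to F-size; inside to inF; route to flex-route)
      X₁ X₂ X₃ X₅ : List V
      X₁ = x ∷ y ∷ []
      X₂ = W₁ ++ X₁
      X₃ = W₂ ++ X₂
      X₅ = F ++ reserved
      H : Sub N
      H = K ∖ X₅
      X₅≤k : length X₅ ≤ k
      X₅≤k = ≤-trans (≤-reflexive (length-++ F)) (≤-trans (+-mono-≤ F-size reserved-size)
        (≤-trans (≤-reflexive (+-comm flexSize (2 + 3 * reserveSize))) room))
      connected : ∀ A → A ⊑ H → Closed G H A → ∀ {a} → A a ≡ true → ∀ v → H v ≡ true → A v ≡ true
      connected = conn C X₅ X₅≤k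
      degrees : ∀ v → H v ≡ true → b ≤ # (nb G v H)
      degrees v h = outside-degree C X₅ X₅≤k v (proj₁ (∖-elim h))
      p : ℕ
      -- The long path has `suc p` vertices. From `L` are set aside the ends `x` and `y`, the
      -- shortest form of the flexible part, and `range` vertices for the three links.
      p = L ∸ (3 + range + shortest)
      p-def : 3 + range + shortest + p ≡ L
      p-def = m+[n∸m]≡n (≤-trans (+-monoʳ-≤ (3 + range) shortest≤) low)
      suc-p≤L : suc p ≤ L
      suc-p≤L = ≤-trans (s≤s (m≤n+m p (2 + range + shortest))) (≤-reflexive p-def)
      enough : suc p ≤ # H
      enough = ≤-trans suc-p≤L (+-cancelʳ-≤ k L (# H) (≤-trans large (≤-trans (#≤length+#∖ K X₅)
        (≤-trans (+-monoˡ-≤ (# H) X₅≤k) (≤-reflexive (+-comm k (# H)))))))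
      double : suc p ≤ b + b
      double = ≤-trans suc-p≤L high

      result : (∃₂ λ u v → ∃ λ xs → Path G u v xs × Unique xs × All (λ x → H x ≡ true) xs × length xs ≡ suc p) →
          Routes Allowed x y L
      result (u , v , ps , path , up , inH , len) = connectAll (links₁ x s Kx (inK inF s∈))
          (links₂ t u (inK inF t∈) (inK inH (start∈ path)))
        (links₃ v y (inK inH (end∈ path)) Ky)
        where
        inK : ∀ {X xs z} → All (λ x → (K ∖ X) x ≡ true) xs → z ∈ xs → K z ≡ true
        inK all i = proj₁ (∖-elim (All.lookup all i))
        out : ∀ {X xs z} → All (λ x → (K ∖ X) x ≡ true) xs → z ∈ xs → z ∉ X
        out all i = proj₂ (∖-elim (All.lookup all i))
        Conn₁ : List V → V → V → Set
        Conn₁ W a z = ∃ λ ms → Link {G = G} a ms z × Unique ms × ms ⊆ W × length ms ≤ linkLength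
        connectAll : Conn₁ W₁ x s → Conn₁ W₂ t u → Conn₁ W₃ v y → Routes Allowed x y L
        connectAll (m₁ , l₁ , u₁ , sub₁ , len₁) (m₂ , l₂ , u₂ , sub₂ , len₂) (m₃ , l₃ , u₃ , sub₃ , len₃) =
          finish (slack len₁ len₂ len₃)
          where
          base : ℕ
          base = 2 + (length m₁ + length m₂ + length m₃) + shortest + suc p
          compose : ∀ j → (∃ λ fs → Path G s t fs × Unique fs × fs ⊆ F × length fs ≡ shortest + j) →
            ∃ λ xs → Path G x y xs × Unique xs × All (λ v → K v ≡ true) xs × length xs ≡ base + j
          compose j (fs , q , uf , subf , lenf) = list , bridge end l₁ (bridge q l₂ (bridge path l₃ end)) , unique ,
              inside , size
            where
            tail₄ tail₃ tail₂ tail₁ list : List V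
            tail₄ = m₃ ++ [ y ]
            tail₃ = ps ++ tail₄
            tail₂ = m₂ ++ tail₃
            tail₁ = fs ++ tail₂
            list = [ x ] ++ m₁ ++ tail₁
            in-m₁ : ∀ {z} → z ∈ m₁ → z ∈ X₂
            in-m₁ i = ∈-++⁺ˡ (sub₁ i)
            X₂⊆X₃ : ∀ {z} → z ∈ X₂ → z ∈ X₃
            X₂⊆X₃ = ∈-++⁺ʳ W₂
            X₃⊆X₄ : ∀ {z} → z ∈ X₃ → z ∈ reserved
            X₃⊆X₄ = ∈-++⁺ʳ W₃
            X₄⊆X₅ : ∀ {z} → z ∈ reserved → z ∈ X₅
            X₄⊆X₅ = ∈-++⁺ʳ F
            X₁⊆X₂ : ∀ {z} → z ∈ X₁ → z ∈ X₂
            X₁⊆X₂ = ∈-++⁺ʳ W₁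
            y∈X₂ : y ∈ X₂
            y∈X₂ = X₁⊆X₂ (there (here refl))
            tail₄-X₄ : ∀ {z} → z ∈ tail₄ → z ∈ reserved
            tail₄-X₄ i = case ∈-++⁻ m₃ i of λ { (inj₁ i) → ∈-++⁺ˡ (sub₃ i) ; (inj₂ (here refl)) → X₃⊆X₄ (X₂⊆X₃ y∈X₂) }
            sep-m₁ : ∀ {z} → z ∈ m₁ → z ∉ tail₁
            sep-m₁ i i′ with ∈-++⁻ fs i′
            ... | inj₁ k = out inF (subf k) (X₃⊆X₄ (X₂⊆X₃ (in-m₁ i)))
            ... | inj₂ k with ∈-++⁻ m₂ k
            ... | inj₁ k = out in₂ (sub₂ k) (in-m₁ i)
            ... | inj₂ k with ∈-++⁻ ps k
            ... | inj₁ k = out inH k (X₄⊆X₅ (X₃⊆X₄ (X₂⊆X₃ (in-m₁ i))))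
            ... | inj₂ k with ∈-++⁻ m₃ k
            ... | inj₁ k = out in₃ (sub₃ k) (X₂⊆X₃ (in-m₁ i))
            ... | inj₂ (here refl) = out in₁ (sub₁ i) (there (here refl))
            sep-fs : ∀ {z} → z ∈ fs → z ∉ tail₂
            sep-fs i i′ with ∈-++⁻ m₂ i′
            ... | inj₁ k = out inF (subf i) (X₃⊆X₄ (∈-++⁺ˡ (sub₂ k)))
            ... | inj₂ k with ∈-++⁻ ps k
            ... | inj₁ k = out inH k (∈-++⁺ˡ (subf i))
            ... | inj₂ k = out inF (subf i) (tail₄-X₄ k)
            sep-m₂ : ∀ {z} → z ∈ m₂ → z ∉ tail₃
            sep-m₂ i i′ with ∈-++⁻ ps i′
            ... | inj₁ k = out inH k (X₄⊆X₅ (X₃⊆X₄ (∈-++⁺ˡ (sub₂ i))))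
            ... | inj₂ k with ∈-++⁻ m₃ k
            ... | inj₁ k = out in₃ (sub₃ k) (∈-++⁺ˡ (sub₂ i))
            ... | inj₂ (here refl) = out in₂ (sub₂ i) y∈X₂
            x∉ : x ∉ m₁ ++ tail₁
            x∉ i with ∈-++⁻ m₁ i
            ... | inj₁ k = out in₁ (sub₁ k) (here refl)
            ... | inj₂ k with ∈-++⁻ fs k
            ... | inj₁ k = out inF (subf k) (X₃⊆X₄ (X₂⊆X₃ (X₁⊆X₂ (here refl))))
            ... | inj₂ k with ∈-++⁻ m₂ k
            ... | inj₁ k = out in₂ (sub₂ k) (X₁⊆X₂ (here refl))
            ... | inj₂ k with ∈-++⁻ ps k
            ... | inj₁ k = out inH k (X₄⊆X₅ (X₃⊆X₄ (X₂⊆X₃ (X₁⊆X₂ (here refl)))))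
            ... | inj₂ k with ∈-++⁻ m₃ k
            ... | inj₁ k = out in₃ (sub₃ k) (X₂⊆X₃ (X₁⊆X₂ (here refl)))
            ... | inj₂ (here e) = x≢y e
            unique : Unique list
            unique = Unique-∷ x∉ (Unique-++⁺ u₁ (Unique-++⁺ uf (Unique-++⁺ u₂ (Unique-++⁺ up
              (Unique-++⁺ u₃ ([] ∷ []) (λ { i (here refl) → out in₃ (sub₃ i) (X₂⊆X₃ y∈X₂) }))
              (λ i i′ → out inH i (X₄⊆X₅ (tail₄-X₄ i′)))) sep-m₂) sep-fs) sep-m₁)
            inside : All (λ v → K v ≡ true) list
            inside = Kx ∷ AllP.++⁺ (All.tabulate (λ i → inK in₁ (sub₁ i)))
                (AllP.++⁺ (All.tabulate (λ i → inK inF (subf i)))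
              (AllP.++⁺ (All.tabulate (λ i → inK in₂ (sub₂ i))) (AllP.++⁺ (All.tabulate (λ i → inK inH i))
              (AllP.++⁺ (All.tabulate (λ i → inK in₃ (sub₃ i))) (Ky ∷ [])))))
            size : length list ≡ base + j
            size rewrite length-++ m₁ {tail₁} | length-++ fs {tail₂} | length-++ m₂ {tail₃} | length-++ ps {tail₄} |
                length-++ m₃ {[ y ]} | lenf | len =
              assembled-length (length m₁) shortest j (length m₂) (suc p) (length m₃)
          -- Links shorter than their allowance are compensated by the offset: together they make up
          -- exactly `range`.
          finish : (∃ λ j → j ≤ range × length m₁ + length m₂ + length m₃ + j ≡ range) → Routes Allowed x y L
          finish (j₀ , j₀≤ , eq) = record { base = base ; offset = j₀ ; offset≤ = j₀≤ ; route = λ j le al → compose j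
              (flex-route j le al)
            ; total = ≡.trans (regroup-base (length m₁ + length m₂ + length m₃) shortest p j₀)
                (≡.trans (cong (λ q → 3 + q + shortest + p) eq) p-def) }

module _ {N : ℕ} (G : Graph N) (b₁ i c e : ℕ)
  (N<ib : N < i * suc b₁) (N<ec : N < e * c) (N<bb : N < suc b₁ * b₁) where

  open Segments G b₁ i c e N<ib N<ec N<bb
  open Routing G b₁ i c e N<ib N<ec N<bb

  private
    V = Fin N
    b = suc b₁

  module _ {k : ℕ} (room : 2 + 3 * reserveSize + flexSize ≤ k) (long : 3 + range + lowest ≤ b + b) where

    private
      room₁ : 2 + 3 * reserveSize ≤ k
      room₁ = ≤-trans (m≤m+n (2 + 3 * reserveSize) flexSize) room

    -- Between the adjacent vertices `r` and `y` all paths have an even number of vertices. Hence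
    -- `base` is even, so is the offset missing to `b + b`, and 4-cycles suffice.
    colouredCycle : ∀ {K col r} → Cluster G b k K → Proper G K col → K r ≡ true → ContainsCycle (b + b) G
    colouredCycle {K} {col} {r} C proper Kr with #-find (nb G r K) (≤-trans (s≤s z≤n) (degree C r Kr))
    ... | y , h with ∧-elim {K y} h
    ... | Ky , e = go (reserves C room₁ r y)
      where
      large : b + b + k ≤ # K
      large = ≤-trans (≤-trans (m≤m+n (b + b + k) k) (≤-reflexive (regroup b k))) (coloured-size {G = G} {K} {col}
          proper (degree C) Kr)
        where
        regroup : ∀ b k → b + b + k + k ≡ b + k + (b + k)
        regroup = solve-∀
      r≢y : r ≢ y
      r≢y refl = Adj-irrefl G e
      close : Routes C Even r y (b + b) → ContainsCycle (b + b) G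
      close routes = cycle (route offset offset≤ even-offset)
        where
        open Routes routes
        even-base : Even base
        even-base with route 0 z≤n (0 , refl)
        ... | xs , p , _ , inK , len = flip-fixed base (col y)
            (≡.trans (cong (λ n → flip n (col y)) (≡.trans (sym (+-identityʳ base)) (sym len)))
          (≡.trans (path-flip {K = K} {col} proper p inK) (sym (proper Kr Ky e))))
        even-offset : Even offset
        even-offset with even-base
        ... | h , eq = even-difference h b offset (≡.trans (cong (_+ offset) (sym eq)) total)
        cycle : (∃ λ xs → Path G r y xs × Unique xs × All (λ v → K v ≡ true) xs × length xs ≡ base + offset) →
            ContainsCycle (b + b) G
        cycle (xs , p , uq , _ , len) = subst (λ n → ContainsCycle n G) (≡.trans len total)
            (toCycle p (Adj-sym {G = G} e) uq)
      module _ (R : Reserves C r y) where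
        open Reserves R
        start : (∃ λ z → K z ≡ true × z ∉ reserved) → ContainsCycle (b + b) G
        start (z , Kz , z∉) = close (assemble C r≢y Kr Ky R flex room long ≤-refl large)
          where
          flex : Flex (K ∖ reserved) Even
          flex = evenFlex C reserved (∖-intro Kz z∉) (≤-trans (+-monoˡ-≤ flexSize size) room)
      go : Reserves C r y → ContainsCycle (b + b) G
      go R = start R (fresh K (Reserves.reserved R)
        (≤-<-trans (≤-trans (Reserves.size R) room₁) (<-≤-trans (s≤s (m≤n+m k (b₁ + b))) large)))

    -- The parameter `k + k` pays twice: if the cluster without the reserved sets turns out
    -- bipartite, it is still a cluster with parameter `k`. A path of length `L` may then be
    -- excluded by parity, but a cycle of length `b + b` is found at once.
    segment : ∀ {K x y L} → Cluster G b (k + k) K → x ≢ y → K x ≡ true → K y ≡ true →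
      3 + range + lowest ≤ L → L ≤ b + b → L + k ≤ # K →
      (∃ λ xs → Path G x y xs × Unique xs × All (λ v → K v ≡ true) xs × length xs ≡ L) ⊎ ContainsCycle (b + b) G
    segment {K} {x} {y} {L} C x≢y Kx Ky low high large = go (reserves C′ room₁ x y)
      where
      C′ : Cluster G b k K
      C′ = weaken G (m≤m+n k k) C
      Goal : Set
      Goal = (∃ λ xs → Path G x y xs × Unique xs × All (λ v → K v ≡ true) xs × length xs ≡ L) ⊎ ContainsCycle (b + b)
          G
      use : Routes C′ (λ _ → ⊤) x y L → Goal
      use routes = found (route offset offset≤ tt)
        where
        open Routes routes
        found : (∃ λ xs → Path G x y xs × Unique xs × All (λ v → K v ≡ true) xs × length xs ≡ base + offset) → Goal
        found (xs , p , uq , inK , len) = inj₁ (xs , p , uq , inK , ≡.trans len total)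
      module _ (R : Reserves C′ x y) where
        open Reserves R
        try : ∀ {z} → (K ∖ reserved) z ≡ true → Flex (K ∖ reserved) (λ _ → ⊤) ⊎ (∃ λ col → Proper G (K ∖ reserved)
            col) → Goal
        try Kz (inj₁ fl) = use (assemble C′ x≢y Kx Ky R fl room low high large)
        try Kz (inj₂ (col , proper)) = inj₂ (colouredCycle (remove G reserved (≤-trans size room₁) C) proper Kz)
        start : (∃ λ z → K z ≡ true × z ∉ reserved) → Goal
        start (z , Kz , z∉) = try Kout (flexible C′ reserved Kout (≤-trans (+-monoˡ-≤ flexSize size) room))
          where
          Kout : (K ∖ reserved) z ≡ true
          Kout = ∖-intro Kz z∉
      go : Reserves C′ x y → Goal
      go R = start R (fresh K (Reserves.reserved R)
        (≤-<-trans (≤-trans (Reserves.size R) room₁) (<-≤-trans (m<n+m k (≤-trans (s≤s z≤n) low)) large)))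

-- Hamiltonian cycles

module _ {N : ℕ} where

  private
    V = Fin N
    differ : V → V → Bool
    differ u v = not (does (u ≟ v))

    differ-sym : ∀ u v → differ u v ≡ differ v u
    differ-sym u v = cong not (does-sym u v)

    differ-irrefl : ∀ v → differ v v ≡ false
    differ-irrefl v = cong not (dec-true (v ≟ v) refl)

    differ-intro : ∀ {u v} → u ≢ v → differ u v ≡ true
    differ-intro {u} {v} u≢v = cong not (dec-false (u ≟ v) u≢v)

  complete : Graph N
  complete = record { adj = differ ; sym = differ-sym ; irrefl = differ-irrefl }

  completePath : ∀ {x xs} → Unique (x ∷ xs) → ∃ λ v → Path complete x v (x ∷ xs)
  completePath {x} {[]} _ = x , end
  completePath {x} {y ∷ xs} ((x≢y ∷ _) ∷ uq) with completePath uq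
  ... | v , p = v , step (differ-intro x≢y) p

  -- One stage of the closure, read backwards: the edges of the cycle that are missing in G′ become
  -- bad steps with Ore's condition in G′, and `ore` repairs them.
  ore-stage : ∀ {G G′ : Graph N} {xs zs} →
    (∀ {u v} → u ∈ zs → v ∈ zs → Adj G u v → Adj G′ u v ⊎ OrePair G′ zs u v) →
    Cyclic G xs → xs ↭ zs → ∃ λ ys → Cyclic G′ ys × ys ↭ zs
  ore-stage {G} {G′} {xs} {zs} h (u , v , p , e) perm = go (convert p (∈-resp-↭ perm)) (h (∈-resp-↭ perm (end∈ p))
      (∈-resp-↭ perm (start∈ p)) e)
    where
    convert : ∀ {a b ys} → Path G a b ys → (∀ {y} → y ∈ ys → y ∈ zs) → ∃ λ n → Walk G′ (OrePair G′ zs) a b ys n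
    convert end _ = 0 , end
    convert (step e q) sub with convert q (λ i → sub (there i)) | h (sub (here refl)) (sub (there (start∈ q))) e
    ... | n , w | inj₁ e′ = n , step e′ w
    ... | n , w | inj₂ o = suc n , skip o w
    go : (∃ λ n → Walk G′ (OrePair G′ zs) u v xs n) → Adj G′ v u ⊎ OrePair G′ zs v u → ∃ λ ys → Cyclic G′ ys × ys ↭ zs
    go (n , w) (inj₁ e′) = ore-closed G′ zs n ≤-refl w e′ perm
    go (n , w) (inj₂ o) = ore G′ zs n ≤-refl w o perm

  lc-complement : (p : Sub N) (xs : List V) → lc p xs + lc (not ∘ p) xs ≡ length xs
  lc-complement p [] = refl
  lc-complement p (x ∷ xs) with p x
  ... | true = cong suc (lc-complement p xs)
  ... | false = ≡.trans (+-suc (lc p xs) _) (cong suc (lc-complement p xs))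

  lc-except : (p q : Sub N) (u : V) {xs : List V} → Unique xs → (∀ x → x ≢ u → p x ≡ true → q x ≡ true) → lc p xs ≤
      suc (lc q xs)
  lc-except p q u [] h = z≤n
  lc-except p q u {x ∷ xs} (x≢ ∷ uq) h with x ≟ u
  ... | yes refl = ≤-trans (+-mono-≤ (bit (p x)) (lc-mono p q (All.map (λ {z} x≢z → h z (λ z≡x → x≢z (sym z≡x))) x≢)))
    (s≤s (m≤n+m (lc q xs) _))
    where
    bit : ∀ a → ⟨ a ⟩ ≤ 1
    bit true = ≤-refl
    bit false = z≤n
  ... | no x≢u with p x in px
  ... | false = ≤-trans (m≤n⇒m≤o+n ⟨ q x ⟩ (lc-except p q u uq h)) (≤-reflexive (+-suc ⟨ q x ⟩ (lc q xs)))
  ... | true rewrite h x x≢u px = s≤s (lc-except p q u uq h)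

  end≢start : ∀ {G : Graph N} {u v w xs} → Path G u v (u ∷ w ∷ xs) → Unique (u ∷ w ∷ xs) → v ≢ u
  end≢start (step _ p) (u≢ ∷ _) v≡u = All.lookup u≢ (end∈ p) (sym v≡u)

  -- The Bondy–Chvátal closure is complete: first the pairs of vertices of degree at least ℓ are joined,
  -- then the pairs with one such vertex, then all pairs.
  hamilton : (G : Graph N) (p : Sub N) (ℓ s : ℕ) (zs : List V) → Unique zs → 2 ≤ length zs → length zs ≤ ℓ + ℓ →
    (∀ v → v ∈ zs → p v ≡ true → ℓ ≤ lc (adj G v) zs) → (∀ v → v ∈ zs → p v ≡ false → suc s ≤ lc (adj G v) zs) →
    lc (not ∘ p) zs ≤ s → s + s ≤ length zs → ContainsCycle (length zs) G
  hamilton G p ℓ s (z ∷ []) uq (s≤s ()) _ _ _ _ _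
  hamilton G p ℓ s zs@(z ∷ z′ ∷ rest) uq _ z≤2ℓ rich poor few half = result (completePath uq)
    where
    G₁ G₂ : Graph N
    G₁ = record
      { adj = λ u v → adj G u v ∨ (p u ∧ p v ∧ differ u v)
      ; sym = λ u v → ≡.cong₂ _∨_ (Graph.sym G u v) (≡.trans (∧-swap (p u) (p v) (differ u v))
          (cong (λ d → p v ∧ p u ∧ d) (differ-sym u v)))
      ; irrefl = λ v → ≡.cong₂ _∨_ (irrefl G v) (≡.trans (cong (λ d → p v ∧ p v ∧ d) (differ-irrefl v))
          (∧-false (p v))) }
      where
      ∧-swap : ∀ a b c → a ∧ b ∧ c ≡ b ∧ a ∧ c
      ∧-swap true true c = refl
      ∧-swap true false c = refl
      ∧-swap false true c = refl
      ∧-swap false false c = refl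
      ∧-false : ∀ a → a ∧ a ∧ false ≡ false
      ∧-false true = refl
      ∧-false false = refl
    G₂ = record
      { adj = λ u v → differ u v ∧ (p u ∨ p v)
      ; sym = λ u v → ≡.cong₂ _∧_ (differ-sym u v) (∨-comm (p u) (p v))
      ; irrefl = λ v → cong (_∧ (p v ∨ p v)) (differ-irrefl v) }
    pures : length zs ≤ lc p zs + s
    pures = ≤-trans (≤-reflexive (sym (lc-complement p zs))) (+-monoʳ-≤ (lc p zs) few)
    s≤pures : s ≤ lc p zs
    s≤pures = +-cancelʳ-≤ s s (lc p zs) (≤-trans half pures)
    rich₂ : ∀ u → p u ≡ false → lc p zs ≤ lc (adj G₂ u) zs
    rich₂ u ¬pu = lc-mono p (adj G₂ u) (All.tabulate {xs = zs} λ {x} _ px → ∧-intro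
        (differ-intro {u} {x} (λ { refl → true≢false px ¬pu })) (∨-introʳ {p u} px))
    rich₁ : ∀ u → p u ≡ true → lc p zs ≤ suc (lc (adj G₁ u) zs)
    rich₁ u pu = lc-except p (adj G₁ u) u uq (λ x x≢u px → ∨-introʳ {adj G u x}
        (∧-intro pu (∧-intro px (differ-intro (λ u≡x → x≢u (sym u≡x))))))
    poor₁ : ∀ v → v ∈ zs → p v ≡ false → suc s ≤ lc (adj G₁ v) zs
    poor₁ v v∈ ¬pv = ≤-trans (poor v v∈ ¬pv) (lc-mono (adj G v) (adj G₁ v) (All.tabulate {xs = zs} λ {x} _ e →
        ∨-introˡ e))
    -- The vertex in `p` is adjacent to all but itself of the vertices in `p`; the `suc s` in the
    -- degree of the other vertex makes up for this loss of one.
    mixed : ∀ {u v} → v ∈ zs → p u ≡ true → p v ≡ false → length zs ≤ lc (adj G₁ u) zs + lc (adj G₁ v) zs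
    mixed {u} {v} v∈ pu ¬pv = ≤-trans pures (≤-trans (+-monoˡ-≤ s (rich₁ u pu))
        (≤-trans (≤-reflexive (sym (+-suc (lc (adj G₁ u) zs) s)))
      (+-monoʳ-≤ (lc (adj G₁ u) zs) (poor₁ v v∈ ¬pv))))
    -- Two vertices outside `p` are adjacent in `G₂` to every vertex of `zs` in `p`. These number at
    -- least `s`, and with `s` more at least all of `zs`.
    stage₂ : ∀ {u v} → u ∈ zs → v ∈ zs → Adj complete u v → Adj G₂ u v ⊎ OrePair G₂ zs u v
    stage₂ {u} {v} _ _ u≢v with true? (p u) | true? (p v)
    ... | inj₁ pu | _ = inj₁ (∧-intro u≢v (∨-introˡ pu))
    ... | inj₂ _ | inj₁ pv = inj₁ (∧-intro u≢v (∨-introʳ {p u} pv))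
    ... | inj₂ ¬pu | inj₂ ¬pv = inj₂ (≤-trans pures (+-mono-≤ (rich₂ u ¬pu) (≤-trans s≤pures (rich₂ v ¬pv))))
    stage₁ : ∀ {u v} → u ∈ zs → v ∈ zs → Adj G₂ u v → Adj G₁ u v ⊎ OrePair G₁ zs u v
    stage₁ {u} {v} u∈ v∈ h with ∧-elim {differ u v} h
    ... | u≢v , _ with true? (p u) | true? (p v)
    ... | inj₁ pu | inj₁ pv = inj₁ (∨-introʳ {adj G u v} (∧-intro pu (∧-intro pv u≢v)))
    ... | inj₁ pu | inj₂ ¬pv = inj₂ (mixed v∈ pu ¬pv)
    ... | inj₂ ¬pu | inj₁ pv = inj₂ (≤-trans (mixed u∈ pv ¬pu)
        (≤-reflexive (+-comm (lc (adj G₁ v) zs) (lc (adj G₁ u) zs))))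
    ... | inj₂ ¬pu | inj₂ ¬pv with ∨-elim {p u} (proj₂ (∧-elim {differ u v} h))
    ... | inj₁ pu = ⊥-elim (true≢false pu ¬pu)
    ... | inj₂ pv = ⊥-elim (true≢false pv ¬pv)
    stage₀ : ∀ {u v} → u ∈ zs → v ∈ zs → Adj G₁ u v → Adj G u v ⊎ OrePair G zs u v
    stage₀ {u} {v} u∈ v∈ h with ∨-elim {adj G u v} h
    ... | inj₁ e = inj₁ e
    ... | inj₂ q with ∧-elim {p u} q
    ... | pu , q′ = inj₂ (≤-trans z≤2ℓ (+-mono-≤ (rich u u∈ pu) (rich v v∈ (proj₁ (∧-elim {p v} q′)))))
    result : (∃ λ v → Path complete z v zs) → ContainsCycle (length zs) G
    result (v , path) with ore-stage {complete} {G₂} stage₂ (z , v , path , differ-intro (end≢start path uq)) refl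
    ... | ys₂ , cyc₂ , perm₂ with ore-stage {G₂} {G₁} stage₁ cyc₂ perm₂
    ... | ys₁ , cyc₁ , perm₁ with ore-stage {G₁} {G} stage₀ cyc₁ perm₁
    ... | ys , (u , w , q , f) , perm = subst (λ n → ContainsCycle n G) (↭-length perm)
        (toCycle q f (Unique-resp-↭ (↭-sym perm) uq))

-- Splitting at single vertices

-- Splittings and separations are existence statements about arbitrary subsets. As the goal is ⊥
-- whenever a case distinction on them is made, excluded middle is available.
em : ∀ {P : Set} → (P ⊎ ¬ P → ⊥) → ⊥
em k = k (inj₂ λ p → k (inj₁ p))

#-full : ∀ {n} → n ≤ #_ {n} (λ _ → true)
#-full {zero} = z≤n
#-full {suc n} = s≤s #-full

lc≤# : ∀ {n} (p : Sub n) {xs : List (Fin n)} → Unique xs → lc p xs ≤ # p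
lc≤# p [] = z≤n
lc≤# {n} p {x ∷ xs} (x≢ ∷ uq) with true? (p x)
... | inj₂ ¬px rewrite ¬px = lc≤# p uq
... | inj₁ px = ≤-trans (≤-reflexive (cong (λ a → ⟨ a ⟩ + lc p xs) px)) (≤-trans
  (+-mono-≤ (≤-reflexive (sym (wt-single (λ _ → 1) x)))
    (≤-trans (lc-mono p (p ∖ [ x ]) (All.map (λ x≢v pv → ∖-intro pv λ { (here e) → x≢v (sym e) }) x≢))
        (lc≤# (p ∖ [ x ]) uq)))
  (wt-disjoint (λ _ → 1) {p = λ v → does (v ≟ x)} {q = p ∖ [ x ]} {r = p}
    (λ v e → ≡.trans (cong p (does-true {d = v ≟ x} e)) px) (λ v h → proj₁ (∖-elim h))
    (λ v e h → proj₂ (∖-elim h) (here (does-true {d = v ≟ x} e)))))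

module _ {N : ℕ} (G : Graph N) where

  private V = Fin N

  Full : Sub N → List V → Set
  Full Y S = ∀ {v} → Y v ≡ true → v ∉ S → ∀ {u} → Adj G v u → Y u ≡ true

  -- Only vertices outside `S` have to stay together, since a closed set consisting of splitting
  -- vertices obeys no degree condition and may be tiny.
  Unsplit : Sub N → List V → Set
  Unsplit Y S = ∀ x A → A ⊑ (Y ∖ [ x ]) → Closed G (Y ∖ [ x ]) A → ∀ {a} → A a ≡ true → a ∉ S →
    ∀ {v} → (Y ∖ [ x ]) v ≡ true → v ∉ S → A v ≡ true

  Core : ℕ → Sub N → Sub N
  Core D Y v = Y v ∧ does (D ≤? # (nb G v Y))

  module Decomposition (d : ℕ) (d>0 : 0 < d) (degrees : ∀ v → d ≤ # (adj G v)) where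

    private
      Part : Set
      Part = Sub N × List V

      record Splitting (Y : Sub N) (S : List V) : Set where
        field
          x : V
          A : Sub N
          A⊑ : A ⊑ (Y ∖ [ x ])
          closed : Closed G (Y ∖ [ x ]) A
          a v : V
          Aa : A a ≡ true
          a∉S : a ∉ S
          Yv : (Y ∖ [ x ]) v ≡ true
          v∉S : v ∉ S
          ¬Av : A v ≡ false

      record Good (c : ℕ) (part : Part) : Set where
        field
          full : Full (proj₁ part) (proj₂ part)
          unsplit : Unsplit (proj₁ part) (proj₂ part)
          small : length (proj₂ part) < c

      Good-mono : ∀ {c c′ part} → c ≤ c′ → Good c part → Good c′ part
      Good-mono le g = record { full = Good.full g ; unsplit = Good.unsplit g ; small = ≤-trans (Good.small g) le }

      -- The halves of a cut share at most one vertex, and (p d + 1) + (q d + 1) - 1 = (p + q) d +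
      -- 1, so `size` is inherited; it bounds the number of parts. Each cut adds one splitting
      -- vertex and at least one part, which gives the bound in `good`.
      record Leaves (Y : Sub N) (S : List V) : Set where
        field
          parts : List Part
          some-part : 1 ≤ length parts
          good : All (Good (length S + length parts)) parts
          size : suc (length parts * d) ≤ # Y
          edges : ∀ u v → Y u ≡ true → Y v ≡ true → Adj G u v → Any (λ (Y′ , _) → Y′ u ≡ true × Y′ v ≡ true) parts

    piece-size : ∀ {Y a} → Y a ≡ true → (∀ {u} → Adj G a u → Y u ≡ true) → suc d ≤ # Y
    piece-size {Y} {a} Ya inside = ≤-trans (+-mono-≤ (≤-reflexive (sym (wt-single (λ _ → 1) a))) (degrees a))
      (wt-disjoint (λ _ → 1) {p = λ v → does (v ≟ a)} {q = adj G a} {r = Y}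
        (λ v e → ≡.trans (cong Y (does-true {d = v ≟ a} e)) Ya) (λ v e → inside e)
        (λ v e f → Adj-irrefl G (subst (λ z → Adj G a z) (does-true {d = v ≟ a} e) f)))

    private
      module Cut {Y : Sub N} {S : List V} (full : Full Y S) (sp : Splitting Y S) where
        open Splitting sp

        Y₁ Y₂ : Sub N
        Y₁ u = A u ∨ (Y u ∧ does (u ≟ x))
        Y₂ u = Y u ∧ not (A u)

        A⊑Y : A ⊑ Y
        A⊑Y u h = proj₁ (∖-elim (A⊑ u h))

        full₁ : Full Y₁ (x ∷ S)
        full₁ {u} Y₁u u∉ {w} e with ∨-elim {A u} Y₁u
        ... | inj₂ h = ⊥-elim (u∉ (here (does-true {d = u ≟ x} (proj₂ (∧-elim {Y u} h)))))
        ... | inj₁ Au with w ≟ x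
        ... | yes refl = ∨-introʳ {A w} (∧-intro (full (A⊑Y u Au) (u∉ ∘ there) e) refl)
        ... | no w≢x = ∨-introˡ (closed Au (∖-intro (full (A⊑Y u Au) (u∉ ∘ there) e) λ { (here w≡x) → w≢x w≡x }) e)

        full₂ : Full Y₂ (x ∷ S)
        full₂ {u} Y₂u u∉ {w} e with ∧-elim {Y u} Y₂u
        ... | Yu , ¬Au = ∧-intro (full Yu (u∉ ∘ there) e) (cong not (¬true⇒false λ Aw →
          true≢false (closed Aw (∖-intro Yu λ { (here u≡x) → u∉ (here u≡x) }) (Adj-sym {G = G} e)) (not-elim ¬Au)))

        a∉ : a ∉ x ∷ S
        a∉ (here a≡x) = proj₂ (∖-elim (A⊑ a Aa)) (here a≡x)
        a∉ (there i) = a∉S i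

        v∉ : v ∉ x ∷ S
        v∉ (here v≡x) = proj₂ (∖-elim Yv) (here v≡x)
        v∉ (there i) = v∉S i

        Y₁a : Y₁ a ≡ true
        Y₁a = ∨-introˡ Aa

        Y₂v : Y₂ v ≡ true
        Y₂v = ∧-intro (proj₁ (∖-elim Yv)) (cong not ¬Av)

        sizes : # Y₁ + # Y₂ ≤ suc (# Y)
        sizes = ≤-trans (+-monoˡ-≤ (# Y₂) (≤-trans (#-cover {q = λ u → does (u ≟ x)} {r = A} cover)
            (+-monoˡ-≤ (# A) (≤-reflexive (wt-single (λ _ → 1) x)))))
          (s≤s (wt-disjoint (λ _ → 1) {p = A} {q = Y₂} {r = Y} A⊑Y (λ u h → proj₁ (∧-elim h))
            (λ u h h′ → true≢false h (not-elim (proj₂ (∧-elim {Y u} h′))))))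
          where
          cover : ∀ u → Y₁ u ≡ true → does (u ≟ x) ≡ true ⊎ A u ≡ true
          cover u h with ∨-elim {A u} h
          ... | inj₁ Au = inj₂ Au
          ... | inj₂ h′ = inj₁ (proj₂ (∧-elim {Y u} h′))

        smaller₁ : ∀ {fuel} → # Y ≤ suc fuel → # Y₁ ≤ fuel
        smaller₁ {fuel} le = lin (# Y₁ ∷ # Y₂ ∷ # Y ∷ fuel ∷ d ∷ []) (λ y₁ y₂ y f d →
          (1 ⊠ y₁ :+ y₂ :≤ con 1 :+ y) ∷ (1 ⊠ con 1 :+ d :≤ y₂) ∷ (1 ⊠ y :≤ con 1 :+ f) ∷ (1 ⊠ con 1 :≤ d) ∷ [] ⊢
              (1 ⊠ y₁ :≤ f))
          sizes (piece-size Y₂v (full₂ Y₂v v∉)) le d>0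

        smaller₂ : ∀ {fuel} → # Y ≤ suc fuel → # Y₂ ≤ fuel
        smaller₂ {fuel} le = lin (# Y₁ ∷ # Y₂ ∷ # Y ∷ fuel ∷ d ∷ []) (λ y₁ y₂ y f d →
          (1 ⊠ y₁ :+ y₂ :≤ con 1 :+ y) ∷ (1 ⊠ con 1 :+ d :≤ y₁) ∷ (1 ⊠ y :≤ con 1 :+ f) ∷ (1 ⊠ con 1 :≤ d) ∷ [] ⊢
              (1 ⊠ y₂ :≤ f))
          sizes (piece-size Y₁a (full₁ Y₁a a∉)) le d>0

        merge : Leaves Y₁ (x ∷ S) → Leaves Y₂ (x ∷ S) → Leaves Y S
        merge L₁ L₂ = record
          { parts = L₁.parts ++ L₂.parts
          ; some-part = ≤-trans L₁.some-part (≤-trans (m≤m+n _ _) (≤-reflexive (sym (length-++ L₁.parts))))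
          ; good = AllP.++⁺ (All.map (Good-mono bound₁) L₁.good) (All.map (Good-mono bound₂) L₂.good)
          ; size = ≤-trans (s≤s (≤-reflexive (≡.trans (cong (_* d) (length-++ L₁.parts))
              (*-distribʳ-+ d (length L₁.parts) (length L₂.parts)))))
              (lin (length L₁.parts * d ∷ length L₂.parts * d ∷ # Y₁ ∷ # Y₂ ∷ # Y ∷ []) (λ p q y₁ y₂ y →
                (1 ⊠ con 1 :+ p :≤ y₁) ∷ (1 ⊠ con 1 :+ q :≤ y₂) ∷ (1 ⊠ y₁ :+ y₂ :≤ con 1 :+ y) ∷ [] ⊢
                    (1 ⊠ con 1 :+ (p :+ q) :≤ y))
                L₁.size L₂.size sizes)
          ; edges = both }
          where
          module L₁ = Leaves L₁
          module L₂ = Leaves L₂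
          bound₁ : suc (length S) + length L₁.parts ≤ length S + length (L₁.parts ++ L₂.parts)
          bound₁ = ≤-trans (lin (length S ∷ length L₁.parts ∷ length L₂.parts ∷ []) (λ s p q →
            (1 ⊠ con 1 :≤ q) ∷ [] ⊢ (1 ⊠ con 1 :+ s :+ p :≤ s :+ (p :+ q))) L₂.some-part)
            (≤-reflexive (cong (λ k → length S + k) (sym (length-++ L₁.parts))))
          bound₂ : suc (length S) + length L₂.parts ≤ length S + length (L₁.parts ++ L₂.parts)
          bound₂ = ≤-trans (lin (length S ∷ length L₁.parts ∷ length L₂.parts ∷ []) (λ s p q →
            (1 ⊠ con 1 :≤ p) ∷ [] ⊢ (1 ⊠ con 1 :+ s :+ q :≤ s :+ (p :+ q))) L₁.some-part)
            (≤-reflexive (cong (λ k → length S + k) (sym (length-++ L₁.parts))))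
          Y₁-neighbour : ∀ {u w} → A u ≡ true → Y w ≡ true → Adj G u w → Y₁ w ≡ true
          Y₁-neighbour {u} {w} Au Yw e with w ≟ x
          ... | yes refl = ∨-introʳ {A w} (∧-intro Yw refl)
          ... | no w≢x = ∨-introˡ (closed Au (∖-intro Yw λ { (here w≡x) → w≢x w≡x }) e)
          both : ∀ u w → Y u ≡ true → Y w ≡ true → Adj G u w → Any (λ (Y′ , _) → Y′ u ≡ true × Y′ w ≡ true)
              (L₁.parts ++ L₂.parts)
          both u w Yu Yw e with true? (A u) | true? (A w)
          ... | inj₁ Au | _ = AnyP.++⁺ˡ (L₁.edges u w (∨-introˡ Au) (Y₁-neighbour Au Yw e) e)
          ... | inj₂ _ | inj₁ Aw = AnyP.++⁺ˡ (L₁.edges u w (Y₁-neighbour Aw Yu (Adj-sym {G = G} e)) (∨-introˡ Aw) e)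
          ... | inj₂ ¬Au | inj₂ ¬Aw = AnyP.++⁺ʳ L₁.parts (L₂.edges u w (∧-intro Yu (cong not ¬Au))
              (∧-intro Yw (cong not ¬Aw)) e)

      decompose : ∀ fuel Y S → # Y ≤ fuel → Full Y S → ∀ {a} → Y a ≡ true → a ∉ S → (Leaves Y S → ⊥) → ⊥
      decompose zero Y S le full Ya a∉ k = n≮0 (≤-trans (piece-size Ya (full Ya a∉)) le)
      decompose (suc fuel) Y S le full {a} Ya a∉ k = em cases
        where
        leaf : ¬ Splitting Y S → Leaves Y S
        leaf ¬sp = record { parts = (Y , S) ∷ [] ; some-part = ≤-refl
          ; good = record { full = full ; unsplit = unsplit ; small = ≤-reflexive (+-comm 1 (length S)) } ∷ []
          ; size = ≤-trans (≤-reflexive (cong suc (*-identityˡ d))) (piece-size Ya (full Ya a∉))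
          ; edges = λ u v Yu Yv _ → here (Yu , Yv) }
          where
          unsplit : Unsplit Y S
          unsplit x A A⊑ closed {a} Aa a∉S {v} Yv v∉S with true? (A v)
          ... | inj₁ Av = Av
          ... | inj₂ ¬Av = ⊥-elim (¬sp (record { x = x ; A = A ; A⊑ = A⊑ ; closed = closed ; a = a ; v = v
            ; Aa = Aa ; a∉S = a∉S ; Yv = Yv ; v∉S = v∉S ; ¬Av = ¬Av }))
        cases : Splitting Y S ⊎ ¬ Splitting Y S → ⊥
        cases (inj₂ ¬sp) = k (leaf ¬sp)
        cases (inj₁ sp) = decompose fuel Y₁ (x ∷ S) (smaller₁ le) full₁ Y₁a a∉′ λ L₁ →
          decompose fuel Y₂ (x ∷ S) (smaller₂ le) full₂ Y₂v v∉ λ L₂ → k (merge L₁ L₂)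
          where
          open Splitting sp using (x)
          open Cut full sp renaming (a∉ to a∉′)

    -- There are at most `t` parts since `N ≤ suc t * d`. The `d` neighbours of a vertex are spread
    -- over them and `t * D₁ < d`, so every vertex is in the core of some part. As `t * M < N`, one
    -- core has more than `M` vertices.
    largeCore : ∀ t D₁ M → 1 ≤ t → N ≤ suc t * d → t * M < N → t * suc D₁ ≤ d →
      (∀ Y S → Full Y S → Unsplit Y S → length S < t → M < # (Core (suc D₁) Y) → ⊥) → ⊥
    largeCore t D₁ M t>0 N≤ tM<N tD≤d k with #-find {N} (λ _ → true) (<-≤-trans (≤-<-trans z≤n tM<N) #-full)
    ... | a , _ = decompose N (λ _ → true) [] (#≤n {N} (λ _ → true)) (λ _ _ _ → refl) {a} refl (λ ()) finish
      where
      finish : Leaves (λ _ → true) [] → ⊥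
      finish L = done (All.all? (λ part → # (Core (suc D₁) (proj₁ part)) ≤? M) parts)
        where
        open Leaves L
        q≤t : length parts ≤ t
        q≤t = s≤s⁻¹ (*-cancelʳ-< d (length parts) (suc t) (<-≤-trans size (≤-trans (#≤n {N} (λ _ → true)) N≤)))
        covered : ∀ v → Any (λ part → Core (suc D₁) (proj₁ part) v ≡ true) parts
        covered v with Any.any? (λ part → dec? (Core (suc D₁) (proj₁ part) v)) parts
        ... | yes c = c
        ... | no ¬c = contradiction (≤-trans (degrees v)
            (≤-trans (#-cover-list (λ part u → proj₁ part v ∧ nb G v (proj₁ part) u) (adj G v) D₁ parts
                (λ u e → Any.map (λ { {Y , _} (Yv , Yu) → ∧-intro Yv (∧-intro Yu e) }) (edges v u refl refl e))
                (All.map (λ { {Y , _} ¬core → few Y ¬core }) (AllP.¬Any⇒All¬ parts ¬c))) (*-monoˡ-≤ D₁ q≤t)))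
              (<⇒≱ (<-≤-trans (lin (t ∷ t * D₁ ∷ []) (λ t p → (1 ⊠ con 1 :≤ t) ∷ [] ⊢ (1 ⊠ con 1 :+ p :≤ t :+ p)) t>0)
                (≤-trans (≤-reflexive (sym (*-suc t D₁))) tD≤d)))
          where
          few : ∀ Y → ¬ Core (suc D₁) Y v ≡ true → # (λ u → Y v ∧ nb G v Y u) ≤ D₁
          few Y ¬core with true? (Y v)
          ... | inj₂ ¬Yv = ≤-trans (≤-reflexive (wt-empty (λ _ → 1) {p = λ u → Y v ∧ nb G v Y u} λ u h → true≢false
              (proj₁ (∧-elim {Y v} h)) ¬Yv)) z≤n
          ... | inj₁ Yv = s≤s⁻¹ (≰⇒> λ le → ¬core (∧-intro Yv (dec-true (suc D₁ ≤? # (nb G v Y))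
            (≤-trans le (wt-mono (λ _ → 1) {p = λ u → Y v ∧ nb G v Y u} {q = nb G v Y}
                (λ u h → proj₂ (∧-elim {Y v} h)))))))
        done : Dec (All (λ part → # (Core (suc D₁) (proj₁ part)) ≤ M) parts) → ⊥
        done (yes small) = <⇒≱ tM<N (≤-trans #-full (≤-trans (#-cover-list (λ part → Core (suc D₁) (proj₁ part))
            (λ _ → true) M parts
          (λ v _ → covered v) small) (*-monoˡ-≤ M q≤t)))
        done (no ¬small) = pick (AllP.¬All⇒Any¬ (λ part → # (Core (suc D₁) (proj₁ part)) ≤? M) parts ¬small) good
          where
          pick : ∀ {ps} → Any (λ part → ¬ # (Core (suc D₁) (proj₁ part)) ≤ M) ps →
            All (Good (length parts)) ps → ⊥
          pick (here big) (g ∷ _) = k _ _ (Good.full g) (Good.unsplit g) (<-≤-trans (Good.small g) q≤t) (≰⇒> big)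
          pick (there i) (_ ∷ gs) = pick i gs

-- Separations and disjoint paths

module _ {N : ℕ} (G : Graph N) where

  private V = Fin N

  record Separation (k : ℕ) (Q : Sub N) : Set where
    field
      X : List V
      X≤k : length X ≤ k
      A : Sub N
      A⊑ : A ⊑ (Q ∖ X)
      closed : Closed G (Q ∖ X) A
      a v : V
      Aa : A a ≡ true
      Qv : (Q ∖ X) v ≡ true
      ¬Av : A v ≡ false
    A′ : Sub N
    A′ u = (Q ∖ X) u ∧ not (A u)
    A′v : A′ v ≡ true
    A′v = ∧-intro Qv (cong not ¬Av)
    A⊑Q : A ⊑ Q
    A⊑Q u h = proj₁ (∖-elim (A⊑ u h))
    A′⊑Q : A′ ⊑ Q
    A′⊑Q u h = proj₁ (∖-elim (proj₁ (∧-elim h)))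
    apart : ∀ u → A u ≡ true → A′ u ≡ true → ⊥
    apart u Au A′u = true≢false Au (not-elim (proj₂ (∧-elim {(Q ∖ X) u} A′u)))
    degree-A : ∀ {m} → (∀ u → Q u ≡ true → m + k ≤ # (nb G u Q)) → ∀ u → A u ≡ true → m ≤ # (nb G u A)
    degree-A {m} deg u Au = ≤-trans (degree-∖ G {k = k} Q X X≤k (deg u (A⊑Q u Au)))
      (wt-mono (λ _ → 1) {p = nb G u (Q ∖ X)} {q = nb G u A} (λ w h → case ∧-elim {(Q ∖ X) w} h of λ
        { (Qw , e) → ∧-intro (closed Au Qw e) e }))
    degree-A′ : ∀ {m} → (∀ u → Q u ≡ true → m + k ≤ # (nb G u Q)) → ∀ u → A′ u ≡ true → m ≤ # (nb G u A′)
    degree-A′ {m} deg u A′u = ≤-trans (degree-∖ G {k = k} Q X X≤k (deg u (A′⊑Q u A′u)))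
      (wt-mono (λ _ → 1) {p = nb G u (Q ∖ X)} {q = nb G u A′} (λ w h → case ∧-elim {(Q ∖ X) w} h of λ
        { (Qw , e) → ∧-intro (∧-intro Qw (cong not (¬true⇒false λ Aw → apart u (closed Aw (proj₁ (∧-elim A′u))
            (Adj-sym {G = G} e)) A′u))) e }))

  connected : ∀ {k Q} → ¬ Separation k Q → Conn G k Q
  connected ¬sep X X≤k A A⊑ closed {a} Aa v Qv with true? (A v)
  ... | inj₁ Av = Av
  ... | inj₂ ¬Av = ⊥-elim (¬sep (record { X = X ; X≤k = X≤k ; A = A ; A⊑ = A⊑ ; closed = closed ; a = a ; v = v ;
      Aa = Aa ; Qv = Qv ; ¬Av = ¬Av }))

  nb≤# : ∀ u Q → # (nb G u Q) ≤ # Q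
  nb≤# u Q = wt-mono (λ _ → 1) {p = nb G u Q} {q = Q} (λ w h → proj₁ (∧-elim {Q w} h))

  -- If `Q` can be separated, pass to one side. The other side has minimum degree at least `b`,
  -- hence at least `b` vertices, so the size drops by `b` while the degree drops by `k`. After `n`
  -- rounds fewer than `b` vertices would be left, too few for degree `b`.
  clusterIn : ∀ b k n Q → # Q < suc n * b → ∀ {v} → Q v ≡ true → (∀ u → Q u ≡ true → b + k + n * k ≤ # (nb G u Q)) →
    (∀ K → K ⊑ Q → ∀ {v} → K v ≡ true → Cluster G b k K → ⊥) → ⊥
  clusterIn b k n Q small {v} Qv deg found = em cases
    where
    cases : Separation k Q ⊎ ¬ Separation k Q → ⊥
    cases (inj₂ ¬sep) = found Q (λ _ h → h) Qv (record { conn = connected ¬sep ; degree = λ u Qu → ≤-trans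
        (m≤m+n (b + k) (n * k)) (deg u Qu) })
    cases (inj₁ sep) = smaller n small deg
      where
      open Separation sep
      smaller : ∀ n → # Q < suc n * b → (∀ u → Q u ≡ true → b + k + n * k ≤ # (nb G u Q)) → ⊥
      smaller zero small deg = <⇒≱ small (≤-trans (≤-reflexive (+-identityʳ b))
          (≤-trans (m≤m+n b k) (≤-trans (m≤m+n (b + k) 0) (≤-trans (deg a (A⊑Q a Aa)) (nb≤# a Q)))))
      smaller (suc n) small deg = clusterIn b k n A small′ Aa (degree-A deg′)
          (λ K K⊑ → found K (λ u h → A⊑Q u (K⊑ u h)))
        where
        deg′ : ∀ u → Q u ≡ true → b + k + n * k + k ≤ # (nb G u Q)
        deg′ u Qu = ≤-trans (lin (b ∷ k ∷ n * k ∷ []) (λ b k p → [] ⊢ (1 ⊠ b :+ k :+ p :+ k :≤ b :+ k :+ (k :+ p))))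
            (deg u Qu)
        small′ : # A < suc n * b
        small′ = lin (# A ∷ # A′ ∷ # Q ∷ b ∷ n * b ∷ k + n * k ∷ []) (λ a a′ q b p r →
          (1 ⊠ a :+ a′ :≤ q) ∷ (1 ⊠ b :+ r :≤ a′) ∷ (1 ⊠ con 1 :+ q :≤ b :+ (b :+ p)) ∷ [] ⊢
              (1 ⊠ con 1 :+ a :≤ b :+ p))
          (wt-disjoint (λ _ → 1) {p = A} {q = A′} {r = Q} A⊑Q A′⊑Q apart)
          (≤-trans (≤-reflexive (sym (+-assoc b k (n * k)))) (≤-trans (degree-A′ deg′ v′ A′v) (nb≤# v′ A′))) small
          where v′ = Separation.v sep

  glue : ∀ {u z w as ys} → Path G u z (as ++ [ z ]) → Path G z w (z ∷ ys) → Path G u w (as ++ z ∷ ys)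
  glue p end = p
  glue {z = z} {as = as} p (step {xs = ys} e q) = subst (Path G _ _) (++-assoc as [ z ] ys) (join p e q)

  -- A path may meet the clusters many times. Between its last vertex in `K` and the first one in
  -- `K′` after that it avoids both.
  record Trimmed (K K′ : Sub N) (xs : List V) : Set where
    field
      a b : V
      ms : List V
      Ka : K a ≡ true
      Kb : K′ b ≡ true
      link : Link {G = G} a ms b
      unique : Unique ms
      outside : All (λ v → K v ≡ false × K′ v ≡ false) ms
      a∈ : a ∈ xs
      b∈ : b ∈ xs
      ms⊆ : ms ⊆ xs

  private
    record Front (K K′ : Sub N) (u : V) (xs : List V) : Set where
      field
        b : V
        ms : List V
        Kb : K′ b ≡ true
        link : ∀ {a} → Adj G a u → Link {G = G} a ms b
        unique : Unique ms
        outside : All (λ v → K v ≡ false × K′ v ≡ false) ms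
        b∈ : b ∈ xs
        ms⊆ : ms ⊆ xs

    scan : ∀ {K K′ u v xs} → Path G u v xs → Unique xs → K′ v ≡ true → Trimmed K K′ xs ⊎ Front K K′ u xs
    scan end uq K′v = inj₂ (record { b = _ ; ms = [] ; Kb = K′v ; link = direct ; unique = [] ; outside = [] ; b∈ =
        here refl ; ms⊆ = λ () })
    scan {K} {K′} {u} (step {xs = xs} e p) (u≢ ∷ uq) K′v with scan {K} {K′} p uq K′v
    ... | inj₁ t = inj₁ (record { Trimmed t hiding (a∈; b∈; ms⊆) ; a∈ = there (Trimmed.a∈ t) ; b∈ = there
        (Trimmed.b∈ t) ; ms⊆ = λ i → there (Trimmed.ms⊆ t i) })
    ... | inj₂ f with true? (K u) | true? (K′ u)
    ... | inj₁ Ku | _ = inj₁ (record { a = u ; b = Front.b f ; ms = Front.ms f ; Ka = Ku ; Kb = Front.Kb f ; link =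
        Front.link f e
      ; unique = Front.unique f ; outside = Front.outside f ; a∈ = here refl ; b∈ = there (Front.b∈ f) ; ms⊆ = λ i →
          there (Front.ms⊆ f i) })
    ... | inj₂ _ | inj₁ K′u = inj₂ (record { b = u ; ms = [] ; Kb = K′u ; link = direct ; unique = [] ; outside = []
        ; b∈ = here refl ; ms⊆ = λ () })
    ... | inj₂ ¬Ku | inj₂ ¬K′u = inj₂ (record { b = Front.b f ; ms = u ∷ Front.ms f ; Kb = Front.Kb f ; link = λ e′ →
        via e′ (Front.link f e)
      ; unique = Unique-∷ (λ i → All≢⇒∉ u≢ (Front.ms⊆ f i)) (Front.unique f) ; outside = (¬Ku , ¬K′u) ∷ Front.outside
          f
      ; b∈ = there (Front.b∈ f) ; ms⊆ = λ { (here e) → here e ; (there i) → there (Front.ms⊆ f i) } })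

  trim : ∀ {K K′ u v xs} → (∀ w → K w ≡ true → K′ w ≡ true → ⊥) → Path G u v xs → Unique xs → K u ≡ true → K′ v ≡
      true → Trimmed K K′ xs
  trim {K} {K′} disj end uq Ku K′v = ⊥-elim (disj _ Ku K′v)
  trim {K} {K′} disj (step e p) (_ ∷ uq) Ku K′v with scan {K} {K′} p uq K′v
  ... | inj₁ t = record { Trimmed t hiding (a∈; b∈; ms⊆) ; a∈ = there (Trimmed.a∈ t) ; b∈ = there (Trimmed.b∈ t) ;
      ms⊆ = λ i → there (Trimmed.ms⊆ t i) }
  ... | inj₂ f = record { a = _ ; b = Front.b f ; ms = Front.ms f ; Ka = Ku ; Kb = Front.Kb f ; link = Front.link f e
      ; unique = Front.unique f ; outside = Front.outside f ; a∈ = here refl ; b∈ = there (Front.b∈ f) ; ms⊆ = λ i →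
          there (Front.ms⊆ f i) }

  record TwoPaths (K : Sub N) (y y′ : V) (n : ℕ) : Set where
    field
      a a′ : V
      α α′ : List V
      Ka : K a ≡ true
      Ka′ : K a′ ≡ true
      path : Path G a y α
      path′ : Path G a′ y′ α′
      unique : Unique (α ++ α′)
      short : length α + length α′ ≤ n

  -- The inductive step of Menger's theorem for two paths. Follow ρ from its last vertex `z` on the
  -- given paths. If there is none, keep ρ and α. If `z` is on α, turn there into ρ and prolong α′
  -- by the edge to `y`, which is free as `z` differs from `y`. If `z` is on α′, turn there into ρ
  -- and keep α.
  advance : ∀ {K y y′ w r ρ n m} → TwoPaths K y y′ n → Adj G y′ y → K r ≡ true → Path G r w ρ → Unique ρ → y ∉ ρ →
    length ρ ≤ m → TwoPaths K w y (n + suc m)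
  advance {K} {y} {y′} {w} {r} {ρ} {n} {m} T y′~y Kr R uρ y∉ρ ρ≤m = go (lastHit (mem (α ++ α′)) R)
    where
    open TwoPaths T
    uα : Unique α
    uα = Unique-++⁻ˡ α unique
    uα′ : Unique α′
    uα′ = Unique-++⁻ʳ α unique
    missed : ∀ {ys z} → All (λ x → mem (α ++ α′) x ≡ false) ys → z ∈ ys → z ∉ α ++ α′
    missed none i j = true≢false (dec-true (_ ∈? (α ++ α′)) j) (All.lookup none i)
    length-split : ∀ (as : List V) {z : V} (bs : List V) → length as + suc (length bs) ≡ length (as ++ z ∷ bs)
    length-split as bs = sym (length-++ as)
    go : All (λ x → mem (α ++ α′) x ≡ false) ρ ⊎ (∃₂ λ z ys → ∃ λ as → Path G z w (z ∷ ys) × mem (α ++ α′) z ≡ true ×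
           All (λ x → mem (α ++ α′) x ≡ false) ys × ρ ≡ as ++ z ∷ ys) → TwoPaths K w y (n + suc m)
    go (inj₁ none) = record { a = r ; a′ = a ; α = ρ ; α′ = α ; Ka = Kr ; Ka′ = Ka ; path = R ; path′ = path
      ; unique = Unique-++⁺ uρ uα (λ i j → missed none i (∈-++⁺ˡ j))
      ; short = lin (length ρ ∷ length α ∷ length α′ ∷ n ∷ m ∷ []) (λ r a a′ n m →
          (1 ⊠ r :≤ m) ∷ (1 ⊠ a :+ a′ :≤ n) ∷ [] ⊢ (1 ⊠ r :+ a :≤ n :+ (con 1 :+ m))) ρ≤m short }
    go (inj₂ (z , ys , as , Z , z∈ , none , refl)) with ∈-++⁻ α (does-true {d = z ∈? (α ++ α′)} z∈)
    ... | inj₁ z∈α = hit (split path z∈α)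
      where
      z≢y : z ≢ y
      z≢y refl = y∉ρ (∈-++⁺ʳ as (here refl))
      uzys : Unique (z ∷ ys)
      uzys = Unique-++⁻ʳ as uρ
      ys≤ : suc (length ys) ≤ m
      ys≤ = ≤-trans (m≤n+m (suc (length ys)) (length as)) (≤-trans (≤-reflexive (length-split as ys)) ρ≤m)
      hit : (∃₂ λ cs ds → Path G a z (cs ++ [ z ]) × Path G z y (z ∷ ds) × α ≡ cs ++ z ∷ ds) → TwoPaths K w y
          (n + suc m)
      hit (cs , ds , P , Q , eq) = record { a = a ; a′ = a′ ; α = cs ++ z ∷ ys ; α′ = α′ ++ [ y ] ; Ka = Ka ; Ka′ =
          Ka′
        ; path = glue P Z ; path′ = join path′ y′~y end
        ; unique = Unique-++⁺ (Unique-++⁺ (Unique-++⁻ˡ cs uα″) uzys sep)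
            (Unique-++⁺ uα′ ([] ∷ []) (λ { i (here refl) → Unique-disjoint α unique (end∈ path) i })) sep′
        ; short = ≤-trans (≤-reflexive (≡.cong₂ _+_ (length-++ cs {z ∷ ys}) (length-++ α′ {[ y ]})))
            (lin (length cs ∷ length ys ∷ length ds ∷ length α′ ∷ n ∷ m ∷ []) (λ c y d a′ n m →
              (1 ⊠ con 1 :+ y :≤ m) ∷ (1 ⊠ c :+ (con 1 :+ d) :+ a′ :≤ n) ∷ [] ⊢
                  (1 ⊠ c :+ (con 1 :+ y) :+ (a′ :+ con 1) :≤ n :+ (con 1 :+ m)))
              ys≤ (≤-trans (≤-reflexive (cong (_+ length α′) (≡.trans (length-split cs ds) (cong length (sym eq)))))
                  short)) }
        where
        uα″ : Unique (cs ++ z ∷ ds)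
        uα″ = subst Unique eq uα
        inα : ∀ {x} → x ∈ cs → x ∈ α
        inα i = subst (_ ∈_) (sym eq) (∈-++⁺ˡ i)
        sep : ∀ {x} → x ∈ cs → x ∈ z ∷ ys → ⊥
        sep i (here refl) = Unique-disjoint cs uα″ i (here refl)
        sep i (there j) = missed none j (∈-++⁺ˡ (inα i))
        y∈ds : y ∈ z ∷ ds → y ∈ ds
        y∈ds (here y≡z) = ⊥-elim (z≢y (sym y≡z))
        y∈ds (there i) = i
        sep′ : ∀ {x} → x ∈ cs ++ z ∷ ys → x ∈ α′ ++ [ y ] → ⊥
        sep′ i j with ∈-++⁻ cs i | ∈-++⁻ α′ j
        ... | inj₁ i | inj₁ j = Unique-disjoint α unique (inα i) j
        ... | inj₁ i | inj₂ (here refl) = Unique-disjoint cs uα″ i (there (y∈ds (end∈ Q)))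
        ... | inj₂ (here refl) | inj₁ j = Unique-disjoint α unique z∈α j
        ... | inj₂ (here refl) | inj₂ (here e) = z≢y e
        ... | inj₂ (there i) | inj₁ j = missed none i (∈-++⁺ʳ α j)
        ... | inj₂ (there i) | inj₂ (here refl) = y∉ρ (∈-++⁺ʳ as (there i))
    ... | inj₂ z∈α′ = hit (split path′ z∈α′)
      where
      uzys : Unique (z ∷ ys)
      uzys = Unique-++⁻ʳ as uρ
      ys≤ : suc (length ys) ≤ m
      ys≤ = ≤-trans (m≤n+m (suc (length ys)) (length as)) (≤-trans (≤-reflexive (length-split as ys)) ρ≤m)
      hit : (∃₂ λ cs ds → Path G a′ z (cs ++ [ z ]) × Path G z y′ (z ∷ ds) × α′ ≡ cs ++ z ∷ ds) → TwoPaths K w y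
          (n + suc m)
      hit (cs , ds , P , Q , eq) = record { a = a′ ; a′ = a ; α = cs ++ z ∷ ys ; α′ = α ; Ka = Ka′ ; Ka′ = Ka
        ; path = glue P Z ; path′ = path
        ; unique = Unique-++⁺ (Unique-++⁺ (Unique-++⁻ˡ cs uα″) uzys sep) uα sep′
        ; short = ≤-trans (≤-reflexive (cong (_+ length α) (length-++ cs {z ∷ ys})))
            (lin (length cs ∷ length ys ∷ length ds ∷ length α ∷ n ∷ m ∷ []) (λ c y d a n m →
              (1 ⊠ con 1 :+ y :≤ m) ∷ (1 ⊠ a :+ (c :+ (con 1 :+ d)) :≤ n) ∷ [] ⊢ (1 ⊠ c :+ (con 1 :+ y) :+ a :≤ n :+
                  (con 1 :+ m)))
              ys≤ (≤-trans (≤-reflexive (cong (λ k → length α + k) (≡.trans (length-split cs ds)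
                  (cong length (sym eq))))) short)) }
        where
        uα″ : Unique (cs ++ z ∷ ds)
        uα″ = subst Unique eq uα′
        inα′ : ∀ {x} → x ∈ cs → x ∈ α′
        inα′ i = subst (_ ∈_) (sym eq) (∈-++⁺ˡ i)
        sep : ∀ {x} → x ∈ cs → x ∈ z ∷ ys → ⊥
        sep i (here refl) = Unique-disjoint cs uα″ i (here refl)
        sep i (there j) = missed none j (∈-++⁺ʳ α (inα′ i))
        sep′ : ∀ {x} → x ∈ cs ++ z ∷ ys → x ∈ α → ⊥
        sep′ i j with ∈-++⁻ cs i
        ... | inj₁ i = Unique-disjoint α unique j (inα′ i)
        ... | inj₂ (here refl) = Unique-disjoint α unique j z∈α′
        ... | inj₂ (there i) = missed none i (∈-++⁺ˡ j)

  back : ∀ {Y A u v xs} → Closed G Y A → Path G u v xs → All (λ x → Y x ≡ true) xs → A v ≡ true → A u ≡ true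
  back closed end _ Av = Av
  back closed (step e p) (Yu ∷ Ys) Av = closed (back closed p Ys Av) Yu (Adj-sym {G = G} e)

wt-const : ∀ {n} (b : ℕ) (q : Sub n) → wt (λ _ → b) q ≡ # q * b
wt-const {zero} b q = refl
wt-const {suc n} b q with q zero
... | true = cong (b +_) (wt-const b (q ∘ suc))
... | false = wt-const b (q ∘ suc)

-- Splitting vertices may have few neighbours in the piece. Weight `b` lets each of them count like
-- a whole neighbourhood in the growth of balls, at a total cost of `length S * b`.
weight : ∀ {n} → List (Fin n) → ℕ → Fin n → ℕ
weight S b v = if mem S v then b else 1

wt-weight : ∀ {n} (S : List (Fin n)) b (p : Sub n) → wt (weight S b) p ≤ n + length S * b
wt-weight {n} S b p = ≤-trans (sum-mono pointwise) (≤-trans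
  (≤-reflexive (∑-distrib-+ (λ v → if p v then 1 else 0) (λ v → if mem S v then b else 0)))
  (+-mono-≤ (#≤n p) (≤-trans (≤-reflexive (wt-const b (mem S))) (*-monoˡ-≤ b (#mem≤length S)))))
  where
  pointwise : ∀ v → (if p v then weight S b v else 0) ≤ (if p v then 1 else 0) + (if mem S v then b else 0)
  pointwise v with p v | mem S v
  ... | true | true = n≤1+n b
  ... | true | false = ≤-refl
  ... | false | _ = z≤n

length+#∖≤# : ∀ {n} (p : Sub n) {xs} → Unique xs → All (λ x → p x ≡ true) xs → length xs + # (p ∖ xs) ≤ # p
length+#∖≤# p {xs} uq inp = ≤-trans (+-monoˡ-≤ (# (p ∖ xs))
    (unique-length (mem xs) uq (All.tabulate λ {x} i → dec-true (x ∈? xs) i)))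
  (wt-disjoint (λ _ → 1) {p = mem xs} {q = p ∖ xs} {r = p} (λ v v∈ → All.lookup inp (does-true {d = v ∈? xs} v∈))
      (λ v h → proj₁ (∖-elim h))
    (λ v v∈ h → proj₂ (∖-elim h) (does-true {d = v ∈? xs} v∈)))

module TwoPathsIn {N : ℕ} (G : Graph N) (b i t : ℕ) (b>0 : 0 < b) (N<ib : N < i * b) (Y : Sub N) (S : List (Fin N))
  (S≤t : length S ≤ t) (unsplit : Unsplit G Y S) (degrees : ∀ v → Y v ≡ true → v ∉ S → b + 1 ≤ # (nb G v Y)) where

  private V = Fin N

  -- The total weight is below `(i + t) * b`, so searches end at depth `(i + t) * 3` and their paths
  -- have at most `radius` vertices. Each use of `advance` adds at most `suc radius` vertices, and
  -- the initial pair counts as one more.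
  radius spread : ℕ
  radius = suc ((i + t) * 3)
  spread = (2 + radius) * suc radius

  private
    B : V → V → Sub N
    B x r = ball G (Y ∖ [ x ]) r ((i + t) * 3)

    closedBall : ∀ x r → (Y ∖ [ x ]) r ≡ true → Closed G (Y ∖ [ x ]) (B x r)
    closedBall x r Yr = ball-closed G (Y ∖ [ x ]) r (weight S b) b heavy Yr (i + t)
      (≤-<-trans (wt-weight S b (Y ∖ [ x ])) (<-≤-trans (+-mono-<-≤ N<ib (*-monoˡ-≤ b S≤t))
          (≤-reflexive (sym (*-distribʳ-+ b i t)))))
      where
      w≥1 : ∀ v → 1 ≤ weight S b v
      w≥1 v with mem S v
      ... | true = b>0
      ... | false = ≤-refl
      heavy : ∀ z → (Y ∖ [ x ]) z ≡ true → b ≤ wt (weight S b) (hood G (Y ∖ [ x ]) r z)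
      heavy z h with z ∈? S
      ... | yes z∈ = ≤-trans (≤-reflexive (cong (λ q → if q then b else 1) (sym (dec-true (z ∈? S) z∈))))
        (wt-point (weight S b) {p = hood G (Y ∖ [ x ]) r z} (∧-intro h (∨-introˡ (dec-true (z ≟ z) refl))))
      ... | no z∉ = ≤-trans (degree-∖ G {k = 1} Y [ x ] ≤-refl (degrees z (proj₁ (∖-elim h)) z∉))
        (≤-trans (wt-mono (λ _ → 1) {p = nb G z (Y ∖ [ x ])} {q = hood G (Y ∖ [ x ]) r z} (λ u q →
            ∧-intro (proj₁ (∧-elim {(Y ∖ [ x ]) u} q)) (∨-introʳ (proj₂ (∧-elim {(Y ∖ [ x ]) u} q)))))
          (wt-mono-weight (hood G (Y ∖ [ x ]) r z) (λ v _ → w≥1 v)))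

    out : ∀ {v y : V} → Y v ≡ true → v ≢ y → (Y ∖ [ y ]) v ≡ true
    out Yv v≢y = ∖-intro Yv λ { (here e) → v≢y e }

    reached : ∀ x {r v} → (Y ∖ [ x ]) r ≡ true → r ∉ S → (Y ∖ [ x ]) v ≡ true → v ∉ S → B x r v ≡ true
    reached x {r} Yr r∉ Yv v∉ = unsplit x (B x r) (ball-⊑ G (Y ∖ [ x ]) r Yr ((i + t) * 3)) (closedBall x r Yr)
        (ball-root G (Y ∖ [ x ]) r ((i + t) * 3)) r∉ Yv v∉

  module _ {K K′ : Sub N} (K⊑ : K ⊑ Y) (K′⊑ : K′ ⊑ Y) (Kpure : ∀ v → K v ≡ true → v ∉ S) (K′pure : ∀ v → K′ v ≡ true
      → v ∉ S)
    (disj : ∀ v → K v ≡ true → K′ v ≡ true → ⊥) {k₁ k₂ v w : V} (Kk₁ : K k₁ ≡ true) (Kk₂ : K k₂ ≡ true)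
        (k₁≢k₂ : k₁ ≢ k₂)
    (K′v : K′ v ≡ true) (K′w : K′ w ≡ true) (v≢w : v ≢ w) where

    private
      record Detour (y w : V) : Set where
        field
          r : V
          ρ : List V
          Kr : K r ≡ true
          path : Path G r w ρ
          unique : Unique ρ
          y∉ : y ∉ ρ
          short : length ρ ≤ radius

      detour : ∀ {y w r} → K r ≡ true → r ≢ y → B y r w ≡ true → Detour y w
      detour {y} {w} {r} Kr r≢y h with ball-path G (Y ∖ [ y ]) r (out (K⊑ r Kr) r≢y) _ h
      ... | ρ , p , uq , inY , len = record { r = r ; ρ = ρ ; Kr = Kr ; path = p ; unique = uq
        ; y∉ = λ i → proj₂ (∖-elim (All.lookup inY i)) (here refl) ; short = len }

      other : ∀ y → ∃ λ r → K r ≡ true × r ≢ y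
      other y with k₁ ≟ y
      ... | no k₁≢y = k₁ , Kk₁ , k₁≢y
      ... | yes refl = k₂ , Kk₂ , λ e → k₁≢k₂ (sym e)

      -- Deleting y leaves y₁ within reach of K, because the rest of the given path leads from y₁ to K′.
      around : ∀ {y y₁ qs} → Path G y₁ v qs → Unique (y ∷ qs) → All (λ x → Y x ≡ true) qs → Detour y y₁
      around {y} {y₁} {qs} p (y≢ ∷ _) inY with other y
      ... | r , Kr , r≢y = detour Kr r≢y (back G (closedBall y r Yr) p inY′
        (reached y Yr (Kpure r Kr) (out (K′⊑ v K′v) (λ e → All.lookup y≢ (end∈ p) (sym e))) (K′pure v K′v)))
        where
        Yr = out (K⊑ r Kr) r≢y
        inY′ : All (λ x → (Y ∖ [ y ]) x ≡ true) qs
        inY′ = All.map (λ (Yx , y≢x) → out Yx (λ e → y≢x (sym e))) (All.zip (inY , y≢))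

      follow : ∀ {y w y′ n} → TwoPaths G K y y′ n → Adj G y′ y → Detour y w → TwoPaths G K w y (n + suc radius)
      follow T e D = advance G T e Kr path unique y∉ short
        where open Detour D

      relax : ∀ {y y′ n n′} → n ≤ n′ → TwoPaths G K y y′ n → TwoPaths G K y y′ n′
      relax le T = record { TwoPaths T hiding (short) ; short = ≤-trans (TwoPaths.short T) le }

      -- Induction along the path to `v`. The two disjoint paths end at the current vertex and its
      -- predecessor; a detour avoiding the current vertex moves them one step on.
      climb : ∀ {y y′ qs n} → Path G y v qs → Unique qs → All (λ x → Y x ≡ true) qs → TwoPaths G K y y′ n → Adj G y′
          y →
        ∃ λ v′ → TwoPaths G K v v′ (n + length qs * suc radius) × Adj G v′ v
      climb {n = n} end uq inY T e = _ , relax (m≤m+n n _) T , e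
      climb {n = n} (step {xs = qs} f p) uq@(_ ∷ uq′) (_ ∷ inY) T e with climb p uq′ inY
          (follow T e (around p uq inY)) f
      ... | v′ , T′ , e′ = v′ , relax (≤-reflexive (+-assoc n (suc radius) (length qs * suc radius))) T′ , e′

      start : ∀ {qs} → Path G k₁ v qs → Unique qs → All (λ x → Y x ≡ true) qs → length qs ≤ radius →
        ∃ λ v′ → TwoPaths G K v v′ (suc radius + radius * suc radius) × Adj G v′ v
      start end _ _ _ = ⊥-elim (disj _ Kk₁ K′v)
      start (step {xs = qs} f p) uq@(_ ∷ uq′) (_ ∷ inY) len with around p uq inY
      -- The first pair consists of the single vertex `k₁` and a detour that avoids it.
      ... | D with climb p uq′ inY (record { a = r ; a′ = k₁ ; α = ρ ; α′ = [ k₁ ] ; Ka = Kr ; Ka′ = Kk₁ ; path =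
          path ; path′ = end
              ; unique = Unique-++⁺ unique ([] ∷ []) (λ { i (here refl) → y∉ i }) ; short = ≤-trans
                  (+-monoˡ-≤ 1 short) (≤-reflexive (+-comm radius 1)) }) f
        where open Detour D
      ... | v′ , T , e = v′ , relax (+-monoʳ-≤ (suc radius)
          (*-monoˡ-≤ (suc radius) (≤-trans (n≤1+n (length qs)) len))) T , e

    twoPaths : TwoPaths G K w v spread
    -- Any path from `k₁` to `v` inside `Y` will do; it is found with `k₂` deleted, because
    -- `unsplit` speaks about a piece without one vertex.
    twoPaths with ball-path G (Y ∖ [ k₂ ]) k₁ (out (K⊑ k₁ Kk₁) k₁≢k₂) _
      (reached k₂ (out (K⊑ k₁ Kk₁) k₁≢k₂) (Kpure k₁ Kk₁) (out (K′⊑ v K′v) (λ { refl → disj v Kk₂ K′v }))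
          (K′pure v K′v))
    ... | qs , q , uq , inY , len with start q uq (All.map (λ h → proj₁ (∖-elim h)) inY) len
    -- The last step leads to `w`, which need not be adjacent to `v`: `advance` uses only the edge
    -- between v′ and `v`.
    ... | v′ , T , e = relax (≤-reflexive (regroup radius (suc radius))) (follow T e (detour Kk₁ k₁≢v
        (reached v (out (K⊑ k₁ Kk₁) k₁≢v) (Kpure k₁ Kk₁) (out (K′⊑ w K′w) (λ e → v≢w (sym e))) (K′pure w K′w))))
      where
      k₁≢v : k₁ ≢ v
      k₁≢v refl = disj k₁ Kk₁ K′v
      regroup : ∀ r s → s + r * s + s ≡ (2 + r) * s
      regroup = solve-∀

-- A graph without the cycle has no large core

module Main {N : ℕ} (G : Graph N) (b₁ n c e t D₁ d k : ℕ)
  (N<ib : N < suc n * suc b₁) (N<ec : N < e * c) (N<bb : N < suc b₁ * b₁) where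

  open Segments G b₁ (suc n) c e N<ib N<ec N<bb

  private
    V = Fin N
    b = suc b₁
    κ = k + k

  spread : ℕ
  spread = (2 + suc ((suc n + t) * 3)) * suc (suc ((suc n + t) * 3))

  module _ (room : 2 + 3 * reserveSize + flexSize ≤ k) (spread-room : spread + (3 + range + lowest) ≤ b)
      (noCycle : ¬ ContainsCycle (b + b) G) where

    private
      long : 3 + range + lowest ≤ b
      long = ≤-trans (m≤n+m (3 + range + lowest) spread) spread-room
      long₂ : 3 + range + lowest ≤ b + b
      long₂ = ≤-trans long (m≤m+n b b)

    Segment : Sub N → V → V → ℕ → Set
    Segment K x y L = ∃ λ xs → Path G x y xs × Unique xs × All (λ v → K v ≡ true) xs × length xs ≡ L

    resolve : ∀ {A : Set} → A ⊎ ContainsCycle (b + b) G → A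
    resolve (inj₁ a) = a
    resolve (inj₂ cyc) = ⊥-elim (noCycle cyc)

    clusterPath : ∀ {K x y L} → Cluster G b κ K → x ≢ y → K x ≡ true → K y ≡ true →
      3 + range + lowest ≤ L → L ≤ b + b → L + k ≤ # K → Segment K x y L
    clusterPath C x≢y Kx Ky low high large =
      resolve (segment G b₁ (suc n) c e N<ib N<ec N<bb room long₂ C x≢y Kx Ky low high large)

    cluster-size : ∀ {K v} → Cluster G b κ K → K v ≡ true → b + k ≤ # K
    cluster-size {K} {v} C Kv = ≤-trans (+-monoʳ-≤ b (m≤m+n k k)) (≤-trans (degree C v Kv) (nb≤# G v K))

    neighbour : ∀ {K v} → Cluster G b κ K → K v ≡ true → ∃ λ u → K u ≡ true × Adj G v u
    neighbour {K} {v} C Kv with #-find (nb G v K) (≤-trans (s≤s z≤n) (degree C v Kv))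
    ... | u , h = u , ∧-elim {K u} h

    oneCluster : ∀ {K v} → Cluster G b κ K → K v ≡ true → b + b + k ≤ # K → ⊥
    oneCluster {K} {v} C Kv large = go (neighbour C Kv)
      where
      close : ∀ {u} → Adj G v u → Segment K v u (b + b) → ⊥
      close e (xs , p , uq , _ , len) = noCycle (subst (λ n → ContainsCycle n G) len (toCycle p (Adj-sym {G = G} e)
          uq))
      go : (∃ λ u → K u ≡ true × Adj G v u) → ⊥
      go (u , Ku , e) = close e (clusterPath C (λ { refl → Adj-irrefl G e }) Kv Ku long₂ ≤-refl large)

    module _ {K K′ : Sub N} (C : Cluster G b κ K) (C′ : Cluster G b κ K′) (disj : ∀ v → K v ≡ true → K′ v ≡ true → ⊥)
        where

      -- `K′` contributes `b` vertices, and `K` contributes `b` minus the interiors of the two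
      -- connections. Each cluster has at least `b + k` vertices, so both segments exist.
      trimmedCycle : ∀ {xs ys} → (T : Trimmed G K K′ xs) (T′ : Trimmed G K K′ ys) → (∀ {x} → x ∈ xs → x ∈ ys → ⊥) →
        length (Trimmed.ms T) + length (Trimmed.ms T′) + (3 + range + lowest) ≤ b → ⊥
      trimmedCycle {xs} {ys} T T′ apart few = close
        (clusterPath C (λ e → apart (Trimmed.a∈ T) (subst (_∈ ys) e (Trimmed.a∈ T′))) (Trimmed.Ka T′) (Trimmed.Ka T)
            low high large)
        (clusterPath C′ b≢b′ (Trimmed.Kb T) (Trimmed.Kb T′) long (m≤m+n b b) (cluster-size C′ (Trimmed.Kb T)))
        where
        module T = Trimmed T
        module T′ = Trimmed T′
        L : ℕ
        L = b ∸ (length T.ms + length T′.ms)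
        total : length T.ms + length T′.ms + L ≡ b
        total = m+[n∸m]≡n {length T.ms + length T′.ms} (≤-trans (m≤m+n (length T.ms + length T′.ms)
            (3 + range + lowest)) few)
        low : 3 + range + lowest ≤ L
        low = +-cancelˡ-≤ (length T.ms + length T′.ms) _ _ (≤-trans few (≤-reflexive (sym total)))
        L≤b : L ≤ b
        L≤b = m∸n≤m b (length T.ms + length T′.ms)
        high : L ≤ b + b
        high = ≤-trans L≤b (m≤m+n b b)
        large : L + k ≤ # K
        large = ≤-trans (+-monoˡ-≤ k L≤b) (cluster-size C T.Ka)
        b≢b′ : T.b ≢ T′.b
        b≢b′ e = apart T.b∈ (subst (_∈ ys) (sym e) T′.b∈)
        close : Segment K T′.a T.a L → Segment K′ T.b T′.b b → ⊥
        close (ps , p , up , inK , lenp) (qs , q , uq , inK′ , lenq) with closeUp (bridge p T.link q)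
            (reverseLink T′.link)
        ... | z , r , f = noCycle (subst (λ n → ContainsCycle n G) size (toCycle r f unique))
          where
          outK : ∀ {ms zs x} → All (λ v → K v ≡ false × K′ v ≡ false) ms → All (λ v → K v ≡ true) zs → x ∈ zs → x ∈
              ms → ⊥
          outK o a i j = true≢false (All.lookup a i) (proj₁ (All.lookup o j))
          outK′ : ∀ {ms zs x} → All (λ v → K v ≡ false × K′ v ≡ false) ms → All (λ v → K′ v ≡ true) zs → x ∈ zs → x ∈
              ms → ⊥
          outK′ o a i j = true≢false (All.lookup a i) (proj₂ (All.lookup o j))
          sep₁ : ∀ {x} → x ∈ ps → x ∈ T.ms ++ qs → ⊥
          sep₁ i j with ∈-++⁻ T.ms j
          ... | inj₁ j = outK T.outside inK i j
          ... | inj₂ j = disj _ (All.lookup inK i) (All.lookup inK′ j)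
          sep₂ : ∀ {x} → x ∈ ps ++ T.ms ++ qs → x ∈ reverse T′.ms → ⊥
          sep₂ i j with ∈-reverse⁻ T′.ms j | ∈-++⁻ ps i
          ... | j | inj₁ i = outK T′.outside inK i j
          ... | j | inj₂ i with ∈-++⁻ T.ms i
          ... | inj₁ i = apart (T.ms⊆ i) (T′.ms⊆ j)
          ... | inj₂ i = outK′ T′.outside inK′ i j
          unique : Unique ((ps ++ T.ms ++ qs) ++ reverse T′.ms)
          unique = Unique-++⁺ (Unique-++⁺ up (Unique-++⁺ T.unique uq (λ i j → outK′ T.outside inK′ j i)) sep₁)
            (Unique-resp-↭ (↭-sym (↭-reverse T′.ms)) T′.unique) sep₂
          size : length ((ps ++ T.ms ++ qs) ++ reverse T′.ms) ≡ b + b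
          size rewrite length-++ (ps ++ T.ms ++ qs) {reverse T′.ms} | length-++ ps {T.ms ++ qs} | length-++ T.ms {qs}
              | length-reverse T′.ms | lenp | lenq =
            ≡.trans (regroup L (length T.ms) (length T′.ms) b) (cong (_+ b) total)
            where
            regroup : ∀ L m m′ b → L + (m + b) + m′ ≡ m + m′ + L + b
            regroup = solve-∀

    module _ (t>0 : 1 ≤ t) (tD≤d : t * suc D₁ ≤ d) (dirac-room : b + t + t + κ ≤ d) (core-room : suc (t + t + t) ≤
        suc D₁)
      (t≤b : t ≤ b) (cluster-room : b + κ + n * κ + κ + t ≤ d) (degrees : ∀ v → d ≤ # (adj G v)) where

      private
        D = suc D₁

        D≤d : D ≤ d
        D≤d = ≤-trans (≤-trans (≤-reflexive (sym (*-identityˡ D))) (*-monoˡ-≤ D t>0)) tD≤d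

      module Piece (Y : Sub N) (S : List V) (full : Full G Y S) (unsplit : Unsplit G Y S) (S<t : length S < t)
        (large : b + b ≤ # (Core G D Y)) where

        private
          C : Sub N
          C = Core G D Y

          S≤t : length S ≤ t
          S≤t = <⇒≤ S<t

          pure : Sub N
          pure v = not (mem S v)

          pure-intro : ∀ {v} → v ∉ S → pure v ≡ true
          pure-intro {v} v∉ = cong not (dec-false (v ∈? S) v∉)

          pure-elim : ∀ {v} → pure v ≡ true → v ∉ S
          pure-elim {v} h = does-false {d = v ∈? S} (not-elim h)

          C⊑Y : C ⊑ Y
          C⊑Y v h = proj₁ (∧-elim {Y v} h)

          degree-Y : ∀ {v} → Y v ≡ true → v ∉ S → d ≤ # (nb G v Y)
          degree-Y {v} Yv v∉ = ≤-trans (degrees v) (wt-mono (λ _ → 1) {p = adj G v} {q = nb G v Y}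
              (λ u e → ∧-intro (full Yv v∉ e) e))

          pure-core : ∀ {v} → Y v ≡ true → v ∉ S → C v ≡ true
          pure-core {v} Yv v∉ = ∧-intro Yv (dec-true (D ≤? # (nb G v Y)) (≤-trans D≤d (degree-Y Yv v∉)))

          -- A neighbour in `Y` outside the core must be a splitting vertex, since all others keep
          -- degree `d`.
          core-degree : ∀ v → # (nb G v Y) ≤ # (nb G v C) + t
          core-degree v = ≤-trans (#-cover {p = nb G v Y} {q = nb G v C} {r = mem S} cover)
            (+-monoʳ-≤ (# (nb G v C)) (≤-trans (#mem≤length S) S≤t))
            where
            cover : ∀ u → nb G v Y u ≡ true → nb G v C u ≡ true ⊎ mem S u ≡ true
            cover u h with ∧-elim {Y u} h | u ∈? S
            ... | _ , _ | yes u∈ = inj₂ refl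
            ... | Yu , e | no u∉ = inj₁ (∧-intro (pure-core Yu u∉) e)

          list-degree : ∀ v zs {r} → # (C ∖ zs) ≤ r → # (nb G v Y) ≤ lc (adj G v) zs + r + t
          list-degree v zs {r} few = ≤-trans (core-degree v) (+-monoˡ-≤ t (≤-trans (#≤lc+#∖ (nb G v C) zs)
            (+-mono-≤ (lc-mono (nb G v C) (adj G v) (All.tabulate {xs = zs} (λ {u} _ h → proj₂ (∧-elim {C u} h))))
              (≤-trans (wt-mono (λ _ → 1) {p = nb G v C ∖ zs} {q = C ∖ zs} (λ u h → case ∖-elim h of λ
                { (h′ , u∉) → ∖-intro (proj₁ (∧-elim {C u} h′)) u∉ })) few))))

          -- Here `r` bounds the core vertices outside `zs`. A splitting vertex in `zs` has only
          -- core degree `D` and can afford to lose `t` of them; if `zs` contains none, the surplus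
          -- of `d` allows a loss of `t + κ`.
          hamiltonian : ∀ zs → Unique zs → All (λ z → C z ≡ true) zs → length zs ≡ b + b → ∀ {r} → # (C ∖ zs) ≤ r → r
              ≤ t + κ →
            (r ≤ t ⊎ All (λ z → pure z ≡ true) zs) → ⊥
          hamiltonian zs uq inC len {r} few r≤ alt = noCycle (subst (λ n → ContainsCycle n G) len
            (hamilton G pure b t zs uq (≤-trans (+-mono-≤ (s≤s z≤n) (s≤s z≤n)) (≤-reflexive (sym len)))
                (≤-reflexive len) rich poor impure-few
              (≤-trans (+-mono-≤ t≤b t≤b) (≤-reflexive (sym len)))))
            where
            rich : ∀ v → v ∈ zs → pure v ≡ true → b ≤ lc (adj G v) zs
            rich v v∈ pv = lin (b ∷ t ∷ κ ∷ d ∷ # (nb G v Y) ∷ lc (adj G v) zs ∷ r ∷ []) (λ b t κ d y l r →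
              (1 ⊠ b :+ t :+ t :+ κ :≤ d) ∷ (1 ⊠ d :≤ y) ∷ (1 ⊠ y :≤ l :+ r :+ t) ∷ (1 ⊠ r :≤ t :+ κ) ∷ [] ⊢
                  (1 ⊠ b :≤ l))
              dirac-room (degree-Y (C⊑Y v (All.lookup inC v∈)) (pure-elim pv)) (list-degree v zs few) r≤
            poor : ∀ v → v ∈ zs → pure v ≡ false → suc t ≤ lc (adj G v) zs
            poor v v∈ ¬pv = case alt of λ
              { (inj₂ allPure) → ⊥-elim (true≢false (All.lookup allPure v∈) ¬pv)
              ; (inj₁ r≤t) → lin (t ∷ D ∷ # (nb G v Y) ∷ lc (adj G v) zs ∷ r ∷ []) (λ t D y l r →
                (1 ⊠ con 1 :+ (t :+ t :+ t) :≤ D) ∷ (1 ⊠ D :≤ y) ∷ (1 ⊠ y :≤ l :+ r :+ t) ∷ (1 ⊠ r :≤ t) ∷ [] ⊢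
                    (1 ⊠ con 1 :+ t :≤ l))
                core-room (does-true {d = D ≤? # (nb G v Y)} (proj₂ (∧-elim {Y v} (All.lookup inC v∈))))
                    (list-degree v zs few) r≤t }
            impure-few : lc (not ∘ pure) zs ≤ t
            impure-few = ≤-trans (lc-mono (not ∘ pure) (mem S)
                (All.tabulate {xs = zs} (λ {u} _ h → ≡.trans (sym (not-involutive (mem S u))) h)))
              (≤-trans (lc≤# (mem S) uq) (≤-trans (#mem≤length S) S≤t))

          -- If `b + b` core vertices are not splitting vertices, only such are taken. Otherwise all
          -- of them are taken and completed by splitting vertices, so that at most `t` core
          -- vertices are left out.
          smallCore : # C ≤ b + b + (t + κ) → ⊥
          smallCore C≤ with ≤-total (b + b) (# (C ∖ S))
          ... | inj₁ enough = fromPure (take-fresh (C ∖ S) (b + b) enough)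
            where
            fromPure : (∃ λ zs → Unique zs × All (λ x → (C ∖ S) x ≡ true) zs × length zs ≡ b + b) → ⊥
            fromPure (zs , uq , inP , len) = hamiltonian zs uq inC len few ≤-refl
                (inj₂ (All.map (λ h → pure-intro (proj₂ (∖-elim h))) inP))
              where
              inC : All (λ z → C z ≡ true) zs
              inC = All.map (λ h → proj₁ (∖-elim h)) inP
              few : # (C ∖ zs) ≤ t + κ
              few = +-cancelˡ-≤ (b + b) _ _ (≤-trans (≤-trans (+-monoˡ-≤ (# (C ∖ zs)) (≤-reflexive (sym len)))
                  (length+#∖≤# C uq inC)) C≤)
          ... | inj₂ scarce = fromAll (elements (C ∖ S))
            where
            Cˢ : Sub N
            Cˢ v = C v ∧ mem S v
            fromAll : (∃ λ ps → Unique ps × All (λ x → (C ∖ S) x ≡ true) ps × length ps ≡ # (C ∖ S) ×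
                (∀ v → (C ∖ S) v ≡ true → v ∈ ps)) → ⊥
            fromAll (ps , up , inP , lenp , complete) = extend (take-fresh Cˢ (b + b ∸ length ps) enough)
              where
              ps≤ : length ps ≤ b + b
              ps≤ = ≤-trans (≤-reflexive lenp) scarce
              enough : b + b ∸ length ps ≤ # Cˢ
              enough = ≤-trans (∸-monoˡ-≤ (length ps) (≤-trans large (#-cover {p = C} {q = C ∖ S} {r = Cˢ} cover)))
                (≤-reflexive (≡.trans (cong (λ k → # (C ∖ S) + # Cˢ ∸ k) lenp) (m+n∸m≡n (# (C ∖ S)) (# Cˢ))))
                where
                cover : ∀ v → C v ≡ true → (C ∖ S) v ≡ true ⊎ Cˢ v ≡ true
                cover v Cv with v ∈? S
                ... | yes v∈ = inj₂ (∧-intro Cv refl)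
                ... | no v∉ = inj₁ (∖-intro Cv v∉)
              extend : (∃ λ is → Unique is × All (λ x → Cˢ x ≡ true) is × length is ≡ b + b ∸ length ps) → ⊥
              extend (is , ui , inI , leni) = hamiltonian (ps ++ is)
                (Unique-++⁺ up ui (λ {x} i j → proj₂ (∖-elim (All.lookup inP i))
                    (does-true {d = x ∈? S} (proj₂ (∧-elim {C x} (All.lookup inI j))))))
                (AllP.++⁺ (All.map (λ h → proj₁ (∖-elim h)) inP) (All.map (λ {x} h → proj₁ (∧-elim {C x} h)) inI))
                (≡.trans (length-++ ps) (≡.trans (cong (λ k → length ps + k) leni) (m+[n∸m]≡n ps≤)))
                few (m≤m+n t κ) (inj₁ ≤-refl)
                where
                few : # (C ∖ (ps ++ is)) ≤ t
                few = ≤-trans (wt-mono (λ _ → 1) {p = C ∖ (ps ++ is)} {q = mem S} inS) (≤-trans (#mem≤length S) S≤t)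
                  where
                  inS : ∀ v → (C ∖ (ps ++ is)) v ≡ true → mem S v ≡ true
                  inS v h with v ∈? S
                  ... | yes _ = refl
                  ... | no v∉ = ⊥-elim (proj₂ (∖-elim h) (∈-++⁺ˡ (complete v (∖-intro (proj₁ (∖-elim h)) v∉))))

          P : Sub N
          P = Y ∖ S

          -- Deleting `S` costs `t`. Of the surplus over `b`, one κ is for a first separation,
          -- `n * κ` for the search in a side, and one κ for the cluster found.
          P-degree : ∀ v → P v ≡ true → b + κ + n * κ + κ ≤ # (nb G v P)
          P-degree v h = degree-∖ G {k = t} Y S S≤t (≤-trans cluster-room (degree-Y (proj₁ (∖-elim h))
              (proj₂ (∖-elim h))))

          large-P : b + b + (t + κ) ≤ # C → b + b + k ≤ # P
          large-P big = +-cancelʳ-≤ t _ _ (≤-trans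
            (lin (b ∷ t ∷ k ∷ []) (λ b t k → [] ⊢ (1 ⊠ b :+ b :+ k :+ t :≤ b :+ b :+ (t :+ (k :+ k)))))
            (≤-trans big (≤-trans (#-cover {p = C} {q = P} {r = mem S} cover)
                (+-monoʳ-≤ (# P) (≤-trans (#mem≤length S) S≤t)))))
            where
            cover : ∀ v → C v ≡ true → P v ≡ true ⊎ mem S v ≡ true
            cover v Cv with v ∈? S
            ... | yes _ = inj₂ refl
            ... | no v∉ = inj₁ (∖-intro (C⊑Y v Cv) v∉)

          module Paths = TwoPathsIn G b (suc n) t (s≤s z≤n) N<ib Y S S≤t unsplit
            (λ v Yv v∉ → ≤-trans (≤-trans (+-monoʳ-≤ b t>0) (≤-trans (m≤m+n (b + t) (t + κ))
                (≤-trans (≤-reflexive (sym (+-assoc (b + t) t κ))) dirac-room))) (degree-Y Yv v∉))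

          pair : ∀ {K v} → Cluster G b κ K → K v ≡ true → ∃₂ λ x y → K x ≡ true × K y ≡ true × x ≢ y
          pair {K} {v} C Kv with neighbour C Kv
          ... | u , Ku , e = v , u , Kv , Ku , λ { refl → Adj-irrefl G e }

          twoClusters : ∀ {K K′ v v′} → K ⊑ P → K′ ⊑ P → (∀ v → K v ≡ true → K′ v ≡ true → ⊥) → K v ≡ true → K′ v′ ≡
              true →
            Cluster G b κ K → Cluster G b κ K′ → ⊥
          twoClusters {K} {K′} K⊑ K′⊑ disj Kv K′v C C′ = go (pair C Kv) (pair C′ K′v)
            where
            finish : ∀ {v w} → K′ v ≡ true → K′ w ≡ true → TwoPaths G K w v Paths.spread → ⊥
            finish K′v K′w T = trimmedCycle C C′ disj t₁ t₂ (λ i j → Unique-disjoint α unique i j)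
              (≤-trans (+-monoˡ-≤ (3 + range + lowest) (≤-trans
                  (+-mono-≤ (inside (Trimmed.unique t₁) (Trimmed.ms⊆ t₁)) (inside (Trimmed.unique t₂)
                  (Trimmed.ms⊆ t₂))) short)) spread-room)
              where
              open TwoPaths T
              t₁ : Trimmed G K K′ α
              t₁ = trim G disj path (Unique-++⁻ˡ α unique) Ka K′w
              t₂ : Trimmed G K K′ α′
              t₂ = trim G disj path′ (Unique-++⁻ʳ α unique) Ka′ K′v
              inside : ∀ {ms xs : List V} → Unique ms → ms ⊆ xs → length ms ≤ length xs
              inside {ms} {xs} um sub = ≤-trans (unique-length (mem xs) um (All.tabulate λ {x} i → dec-true (x ∈? xs)
                  (sub i))) (#mem≤length xs)
            go : (∃₂ λ x y → K x ≡ true × K y ≡ true × x ≢ y) → (∃₂ λ x y → K′ x ≡ true × K′ y ≡ true × x ≢ y) → ⊥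
            go (x , y , Kx , Ky , x≢y) (v , w , K′v , K′w , v≢w) = finish K′v K′w (Paths.twoPaths
              (λ u h → proj₁ (∖-elim (K⊑ u h))) (λ u h → proj₁ (∖-elim (K′⊑ u h)))
              (λ u h → proj₂ (∖-elim (K⊑ u h))) (λ u h → proj₂ (∖-elim (K′⊑ u h))) disj Kx Ky x≢y K′v K′w v≢w)

          bigCore : b + b + (t + κ) ≤ # C → ⊥
          bigCore big = em cases
            where
            nonempty-P : ∃ λ v → P v ≡ true
            nonempty-P = #-find P (≤-trans (s≤s z≤n) (large-P big))
            cases : Separation G κ P ⊎ ¬ Separation G κ P → ⊥
            cases (inj₂ ¬sep) = oneCluster (record { conn = connected G ¬sep ; degree = λ v Pv →
              ≤-trans (≤-trans (m≤m+n (b + κ) (n * κ)) (m≤m+n (b + κ + n * κ) κ)) (P-degree v Pv) })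
                  (proj₂ nonempty-P) (large-P big)
            -- Each side keeps enough degree to contain a cluster, and the two clusters are disjoint
            -- because the sides are.
            cases (inj₁ sep) = clusterIn G b κ n A (≤-<-trans (#≤n A) N<ib) Aa (degree-A P-degree) λ K K⊑ Kv CK →
              clusterIn G b κ n A′ (≤-<-trans (#≤n A′) N<ib) A′v (degree-A′ P-degree) λ K′ K′⊑ K′v CK′ →
              twoClusters (λ u h → A⊑Q u (K⊑ u h)) (λ u h → A′⊑Q u (K′⊑ u h)) (λ u h h′ → apart u (K⊑ u h)
                  (K′⊑ u h′)) Kv K′v CK CK′
              where open Separation sep

        contradictory : ⊥
        contradictory with ≤-total (# C) (b + b + (t + κ))
        ... | inj₁ small = smallCore small
        ... | inj₂ big = bigCore big

      upperBound : N ≤ suc t * d → t * (b₁ + b) < N → ⊥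
      upperBound N≤ N> = Decomposition.largeCore G d (≤-trans (s≤s z≤n) (≤-trans D≤d ≤-refl)) degrees t D₁ (b₁ + b)
          t>0 N≤ N> tD≤d
        (λ Y S full unsplit S<t large → Piece.contradictory Y S full unsplit S<t large)

-- The upper bound

anyVec? : ∀ {N} k {P : Vec (Fin N) k → Set} → (∀ xs → Dec (P xs)) → Dec (∃ P)
anyVec? zero P? = map′ (λ p → [] , p) (λ { ([] , p) → p }) (P? [])
anyVec? (suc k) P? = map′ (λ { (x , xs , p) → x ∷ xs , p }) (λ { (x ∷ xs , p) → x , xs , p })
  (any? λ x → anyVec? k λ xs → P? (x ∷ xs))

-- This decision turns the refutation of "no cycle" into an actual cycle.
containsCycle? : ∀ {N} k (G : Graph N) → Dec (ContainsCycle k G)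
containsCycle? {N} k G = map′ to from (anyVec? k λ xs →
  all? (λ i → all? λ j → (lookupᵥ xs i ≟ lookupᵥ xs j) →-dec (i ≟ j)) ×-dec
  all? (λ i → dec? (adj G (lookupᵥ xs i) (lookupᵥ xs (next i)))))
  where
  to : (∃ λ xs → (∀ i j → lookupᵥ xs i ≡ lookupᵥ xs j → i ≡ j) × (∀ i → Adj G (lookupᵥ xs i) (lookupᵥ xs (next i))))
      → ContainsCycle k G
  to (xs , inj , edges) = lookupᵥ xs , (λ {i} {j} → inj i j) , edges
  from : ContainsCycle k G → ∃ λ xs → (∀ i j → lookupᵥ xs i ≡ lookupᵥ xs j → i ≡ j) × (∀ i → Adj G (lookupᵥ xs i)
      (lookupᵥ xs (next i)))
  from (φ , inj , edges) = tabulateᵥ φ ,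
    (λ i j e → inj (≡.trans (sym (lookup∘tabulate φ i)) (≡.trans e (lookup∘tabulate φ j)))) ,
    λ i → ≡.subst₂ (λ u v → Adj G u v) (sym (lookup∘tabulate φ i)) (sym (lookup∘tabulate φ (next i))) (edges i)

enumerate : ∀ {N m} (p : Sub N) → m ≤ # p → Σ (Fin m → Fin N) λ ψ → Injective _≡_ _≡_ ψ × (∀ i → p (ψ i) ≡ true)
enumerate {N} {m} p le with take-fresh p m le
... | xs , uq , inp , refl = lookup xs , lookup-injective uq , λ i → All.lookup inp (∈-lookup i)

-- A vertex that is not the centre of a star has at most n - 1 non-neighbours besides itself, hence
-- at least N - 1 - (n - 1) = `d` neighbours.
star⊎degree : ∀ {N} (G : Graph N) n d → n + d ≡ N → ComplContainsStar n G ⊎ (∀ v → d ≤ # (adj G v))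
star⊎degree {N} G n d n+d≡N with any? (λ v → n ≤? # (far v))
  where
  far : Fin N → Sub N
  far v u = not (adj G v u) ∧ not (does (u ≟ v))
... | yes (v , le) with enumerate (λ u → not (adj G v u) ∧ not (does (u ≟ v))) le
... | ψ , inj , h = inj₁ (v , ψ , inj , (λ i → does-false {d = ψ i ≟ v}
    (not-elim (proj₂ (∧-elim {not (adj G v (ψ i))} (h i))))) ,
  λ i → not-elim (proj₁ (∧-elim (h i))))
star⊎degree {N} G n d n+d≡N | no few = inj₂ λ v → bound v
  where
  far : Fin N → Sub N
  far v u = not (adj G v u) ∧ not (does (u ≟ v))
  bound : ∀ v → d ≤ # (adj G v)
  bound v = lin (N ∷ n ∷ d ∷ # (far v) ∷ # (adj G v) ∷ # notFar ∷ # (λ u → does (u ≟ v)) ∷ []) (λ N n d f a m s →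
      (1 ⊠ N :≤ f :+ m) ∷ (1 ⊠ m :≤ a :+ s) ∷ (1 ⊠ s :≤ con 1) ∷ (1 ⊠ con 1 :+ f :≤ n) ∷ (1 ⊠ n :+ d :≤ N) ∷ [] ⊢
          (1 ⊠ d :≤ a))
    (≤-trans #-full (#-cover {p = λ _ → true} {q = far v} {r = notFar} cover₁)) (#-cover {p = notFar} {q = adj G v}
        {r = λ u → does (u ≟ v)} cover₂)
    (≤-reflexive (wt-single (λ _ → 1) v)) (≰⇒> (λ le → few (v , le))) (≤-reflexive n+d≡N)
    where
    notFar : Sub N
    notFar u = not (far v u)
    cover₁ : ∀ u → true ≡ true → far v u ≡ true ⊎ notFar u ≡ true
    cover₁ u _ with far v u
    ... | true = inj₁ refl
    ... | false = inj₂ refl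
    cover₂ : ∀ u → notFar u ≡ true → adj G v u ≡ true ⊎ does (u ≟ v) ≡ true
    cover₂ u h with adj G v u | does (u ≟ v)
    ... | true | _ = inj₁ refl
    ... | false | true = inj₂ refl

-- Arithmetic of the threshold and of the constants

module Threshold (t n M : ℕ) .{{_ : NonZero t}} (n>0 : 1 ≤ n) (n<tM : n ∸ 1 < t * M) where

  q N d : ℕ
  q = (n ∸ 1) / t
  N = suc ((t * M) ⊔ (n + q))
  d = N ∸ n

  n≡ : suc (n ∸ 1) ≡ n
  n≡ = m+[n∸m]≡n n>0

  n+q<N : n + q < N
  n+q<N = s≤s (m≤n⊔m (t * M) (n + q))

  n+d≡N : n + d ≡ N
  n+d≡N = m+[n∸m]≡n (≤-trans (m≤m+n n q) (<⇒≤ n+q<N))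

  tM<N : t * M < N
  tM<N = s≤s (m≤m⊔n (t * M) (n + q))

  q<M : q < M
  q<M = m<n*o⇒m/o<n (<-≤-trans n<tM (≤-reflexive (*-comm t M)))

  N≤ : N ≤ suc t * M
  N≤ = ⊔-lub
    (lin (t * M ∷ M ∷ q ∷ []) (λ x m q → (1 ⊠ con 1 :+ q :≤ m) ∷ [] ⊢ (1 ⊠ con 1 :+ x :≤ m :+ x)) q<M)
    (lin (t * M ∷ M ∷ q ∷ n ∷ n ∸ 1 ∷ []) (λ x m q n p →
      (1 ⊠ con 1 :+ q :≤ m) ∷ (1 ⊠ n :≤ con 1 :+ p) ∷ (1 ⊠ con 1 :+ p :≤ x) ∷ [] ⊢ (1 ⊠ con 1 :+ (n :+ q) :≤ m :+ x))
      q<M (≤-reflexive (sym n≡)) n<tM)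

  -- From `n + q < N` follows `q < d`. As n - 1 = q t + r with r < t, this gives n ≤ t (q + 1) ≤ t
  -- d.
  N≤[1+t]d : N ≤ suc t * d
  N≤[1+t]d = lin (N ∷ n ∷ n ∸ 1 ∷ q * t ∷ (n ∸ 1) % t ∷ t ∷ d ∷ t * d ∷ []) (λ N n p qt r t d td →
      (1 ⊠ N :≤ n :+ d) ∷ (1 ⊠ n :≤ con 1 :+ p) ∷ (1 ⊠ p :≤ r :+ qt) ∷ (1 ⊠ con 1 :+ r :≤ t) ∷ (1 ⊠ t :+ qt :≤ td) ∷
          [] ⊢ (1 ⊠ N :≤ d :+ td))
    (≤-reflexive (sym n+d≡N)) (≤-reflexive (sym n≡)) (≤-reflexive (m≡m%n+[m/n]*n (n ∸ 1) t)) (m%n<n (n ∸ 1) t)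
    (≤-trans (*-monoˡ-≤ t q<d) (≤-reflexive (*-comm d t)))
    where
    q<d : q < d
    q<d = +-cancelˡ-< n q d (<-≤-trans n+q<N (≤-reflexive (sym n+d≡N)))

  -- Indeed 2 t M < 2 N ≤ 2 (t + 1) d ≤ 3 t d, the last step because t ≥ 2.
  2M≤3d : 2 ≤ t → 2 * M ≤ 3 * d
  2M≤3d t≥2 = *-cancelˡ-≤ t (lin (t * (2 * M) ∷ t * M ∷ t * d ∷ d ∷ N ∷ t * (3 * d) ∷ M ∷ []) (λ a x y d N z M →
      (1 ⊠ a :≤ 2 :* x) ∷ (2 ⊠ con 1 :+ x :≤ N) ∷ (2 ⊠ N :≤ d :+ y) ∷ (1 ⊠ 2 :* d :≤ y) ∷ (1 ⊠ 3 :* y :≤ z) ∷ [] ⊢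
          (1 ⊠ a :≤ z))
    (≤-reflexive (exchange 2 t M)) tM<N N≤[1+t]d (*-monoˡ-≤ d t≥2) (≤-reflexive (sym (exchange 3 t d))))
    where
    exchange : ∀ a b c → b * (a * c) ≡ a * (b * c)
    exchange = solve-∀

division : ∀ a m → 0 < m → ∃ λ q → q * m ≤ a × a < suc q * m
division a m m>0 = a / m , ≤-trans (m≤n+m _ (a % m)) (≤-reflexive (sym eq)) ,
  ≤-trans (s≤s (≤-reflexive eq)) (+-monoˡ-≤ (a / m * m) (m%n<n a m))
  where
  instance _ = >-nonZero m>0
  eq = m≡m%n+[m/n]*n a m

private
  ninth : ∀ t → t * (t * (t * (t * (t * (t * (t * (t * (t * 1)))))))) ≡ (t * t * t) * (t * t * t * (t * t * t))
  ninth = solve-∀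

  -- The powers of 10 and 191 enter as variables, so that no unary unfolding takes place; only
  -- `A * B ≤ C` is evaluated. The rest is t^9 = t^3 u ≥ u.
  cancel-large : ∀ t ℓ A B C u → 0 < A → 0 < t → A * B ≤ C → C * (t ^ 9) ≤ A * ℓ → u ≡ t * t * t * (t * t * t) → u *
      B ≤ ℓ
  cancel-large t ℓ A B C u A>0 t>0 AB≤C h refl = *-cancelˡ-≤ A {{>-nonZero A>0}} (≤-trans (≤-reflexive (assoc A B u))
    (≤-trans (*-mono-≤ AB≤C (≤-trans (≤-trans (≤-reflexive (sym (*-identityˡ u)))
        (*-monoˡ-≤ u (*-mono-≤ (*-mono-≤ t>0 t>0) t>0)))
      (≤-reflexive (sym (ninth t))))) h))
    where
    assoc : ∀ a b u → a * (u * b) ≡ a * b * u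
    assoc = solve-∀

  sixth-power : ∀ t ℓ → 0 < t → (191 ^ 9) * (t ^ 9) ≤ (10 ^ 9) * ℓ → t * t * t * (t * t * t) * 100000000 ≤ ℓ
  sixth-power t ℓ t>0 h = cancel-large t ℓ (10 ^ 9) 100000000 (191 ^ 9) (t * t * t * (t * t * t)) (s≤s z≤n) t>0
    (≤ᵇ⇒≤ (10 ^ 9 * 100000000) (191 ^ 9) _) h refl

module Parameters (t ℓ : ℕ) (t≥2 : 2 ≤ t) (large : t * t * t * (t * t * t) * 100000000 ≤ ℓ) where

  private
    t>0 : 1 ≤ t
    t>0 = ≤-trans (s≤s z≤n) t≥2

  -- A dominating set of size e + i * c is used; c is chosen so that both terms are of order ℓ / t² at most.
  s u i x m c : ℕ
  s = t * t
  u = t * t * t * (t * t * t)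
  i = 2 + (t + t)
  x = i * 3
  m = s * 1300
  c = t * t * t * 3900

  s>0 : 1 ≤ s
  s>0 = *-mono-≤ t>0 t>0

  cube>0 : 1 ≤ t * t * t
  cube>0 = *-mono-≤ s>0 t>0

  t≤s : t ≤ s
  t≤s = ≤-trans (≤-reflexive (sym (*-identityˡ t))) (*-monoˡ-≤ t t>0)

  s≤u : s ≤ u
  s≤u = ≤-trans (≤-trans (≤-reflexive (sym (*-identityʳ s))) (*-monoʳ-≤ s t>0))
    (≤-trans (≤-reflexive (sym (*-identityʳ (t * t * t)))) (*-monoʳ-≤ (t * t * t) cube>0))

  u>0 : 1 ≤ u
  u>0 = *-mono-≤ cube>0 cube>0

  quotient : ∃ λ q → q * m ≤ ℓ × ℓ < suc q * m
  quotient = division ℓ m (≤-trans s>0 (m≤m*n s 1300))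

  q e : ℕ
  q = proj₁ quotient
  e = suc q

  q-small : q * s * 1300 ≤ ℓ
  q-small = ≤-trans (≤-reflexive (*-assoc q s 1300)) (proj₁ (proj₂ quotient))

  e-large : 3 * t * ℓ < e * c
  -- By the choice of constants `c` is `3 * t * m`, and `e * m` exceeds ℓ.
  e-large = <-≤-trans (*-monoʳ-< (3 * t) {{>-nonZero (*-mono-≤ {1} {3} {1} (s≤s z≤n) t>0)}} (proj₂ (proj₂ quotient)))
    (≤-reflexive (≡.trans (lemma t e 1300) (cong (λ z → e * (t * t * t * z)) refl)))
    where
    lemma : ∀ t e z → 3 * t * (e * (t * t * z)) ≡ e * (t * t * t * (3 * z))
    lemma = solve-∀

  -- `k` is exactly the room demanded by three reserved sets and a flexible part; `kk` is a simpler
  -- upper bound, using `i ≤ 3 * t` and `suc x ≤ 10 * t`.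
  k kk : ℕ
  k = 2 + 3 * ((e + i * c) * suc x) + (suc x + suc (suc x) + suc (3 * (3 * (suc x + suc x))))
  kk = 3 * ((e + 3 * t * c) * (10 * t)) + 192 * t

  x-def : x ≡ 6 + 6 * t
  x-def = lemma t
    where
    lemma : ∀ t → (2 + (t + t)) * 3 ≡ 6 + 6 * t
    lemma = solve-∀

  i≤3t : i ≤ 3 * t
  i≤3t = lin (t ∷ []) (λ t → (1 ⊠ con 2 :≤ t) ∷ [] ⊢ (1 ⊠ con 2 :+ (t :+ t) :≤ 3 :* t)) t≥2

  k≤kk : k ≤ kk
  k≤kk = lin (A ∷ B ∷ x ∷ t ∷ []) (λ A B x t →
      (3 ⊠ A :≤ B) ∷ (20 ⊠ x :≤ con 6 :+ 6 :* t) ∷ (72 ⊠ con 2 :≤ t) ∷ [] ⊢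
      (1 ⊠ con 2 :+ 3 :* A :+ (con 1 :+ x :+ (con 2 :+ x) :+ (con 1 :+ 3 :* (3 :* (con 1 :+ x :+ (con 1 :+ x))))) :≤
          3 :* B :+ 192 :* t))
    (*-mono-≤ (+-monoʳ-≤ e (*-monoˡ-≤ c i≤3t)) x<10t) (≤-reflexive x-def) t≥2
    where
    A = (e + i * c) * suc x
    B = (e + 3 * t * c) * (10 * t)
    x<10t : suc x ≤ 10 * t
    x<10t = lin (x ∷ t ∷ []) (λ x t → (1 ⊠ x :≤ con 6 :+ 6 :* t) ∷ (4 ⊠ con 2 :≤ t) ∷ [] ⊢
        (1 ⊠ con 1 :+ x :≤ 10 :* t)) (≤-reflexive x-def) t≥2

  tk-bound : t * k ≤ 30 * (q * s) + 30 * s + 90 * (u * 3900) + 192 * s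
  tk-bound = ≤-trans (*-monoʳ-≤ t k≤kk) (≤-reflexive (lemma t q 3900))
    where
    lemma : ∀ t q z → t * (3 * ((suc q + 3 * t * (t * t * t * z)) * (10 * t)) + 192 * t) ≡
      30 * (q * (t * t)) + 30 * (t * t) + 90 * (t * t * t * (t * t * t) * z) + 192 * (t * t)
    lemma = solve-∀

  -- Three times the degree lost on the way to a cluster, plus the 2 from 4ℓ ≤ 3d + 2; the single ℓ
  -- on the right is the difference between 4ℓ and 3ℓ.
  k-bound : 12 * (t * k) + 18 * k + 3 * t + 2 ≤ ℓ
  k-bound = lin (t * k ∷ k ∷ t ∷ q * s ∷ s ∷ u ∷ ℓ ∷ []) (λ tk k t qs s u ℓ →
      (11700 ⊠ 2 :* k :≤ tk) ∷ (27300 ⊠ tk :≤ 30 :* qs :+ 30 :* s :+ 90 :* (u *: 3900) :+ 192 :* s) ∷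
          (630 ⊠ qs *: 1300 :≤ ℓ) ∷
      (3900 ⊠ t :≤ s) ∷ (6064500 ⊠ s :≤ u) ∷ (2600 ⊠ con 1 :≤ u) ∷ (670 ⊠ u *: 100000000 :≤ ℓ) ∷ [] ⊢
      (1300 ⊠ 12 :* tk :+ 18 :* k :+ 3 :* t :+ con 2 :≤ ℓ))
    (*-monoˡ-≤ k t≥2) tk-bound q-small t≤s s≤u u>0 large

  spread-bound : (2 + suc ((i + t) * 3)) * suc (suc ((i + t) * 3)) +
      (3 + 3 * (suc x + suc x) + (suc x + suc (3 * (suc x + suc x)))) ≤ ℓ
  spread-bound = lin ((2 + suc ((i + t) * 3)) * suc (suc ((i + t) * 3)) ∷ x ∷ t ∷ s ∷ u ∷ ℓ ∷ []) (λ z x t s u ℓ →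
      (1 ⊠ z :≤ 81 :* s :+ 153 :* t :+ con 72) ∷ (13 ⊠ x :≤ con 6 :+ 6 :* t) ∷ (1000 ⊠ t :≤ s) ∷ (2000 ⊠ s :≤ u) ∷
          (1000 ⊠ con 1 :≤ u) ∷ (1 ⊠ u *: 100000000 :≤ ℓ) ∷ [] ⊢
      (1 ⊠ z :+ (con 3 :+ 3 :* (con 1 :+ x :+ (con 1 :+ x)) :+
          (con 1 :+ x :+ (con 1 :+ 3 :* (con 1 :+ x :+ (con 1 :+ x))))) :≤ ℓ))
    (≤-reflexive (lemma t)) (≤-reflexive x-def) t≤s s≤u u>0 large
    where
    lemma : ∀ t → (2 + suc ((2 + (t + t) + t) * 3)) * suc (suc ((2 + (t + t) + t) * 3)) ≡ 81 * (t * t) + 153 * t + 72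
    lemma = solve-∀

upperBound : (t ℓ n : ℕ) → .{{_ : NonZero t}} → 2 ≤ t → t * t * t * (t * t * t) * 100000000 ≤ ℓ → 1 ≤ n →
  n ∸ 1 < t * (2 * ℓ ∸ 1) → Arrows ℓ n (suc (f t ℓ n))
upperBound t zero n t≥2 large n>0 small = ⊥-elim (n≮0 (<-≤-trans small (≤-reflexive (*-zeroʳ t))))
upperBound t ℓ@(suc b₁) n t≥2 large n>0 small G = cases (star⊎degree G n d n+d≡N) (containsCycle? (2 * ℓ) G)
  where
  open Threshold t n (2 * suc b₁ ∸ 1) n>0 small using (N; d; n+d≡N; N≤; tM<N; N≤[1+t]d; 2M≤3d)
  t>0 : 1 ≤ t
  t>0 = ≤-trans (s≤s z≤n) t≥2
  open Parameters t ℓ t≥2 large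
  M≡ : 2 * suc b₁ ∸ 1 ≡ b₁ + suc b₁
  M≡ = cong (λ z → b₁ + suc z) (+-identityʳ b₁)
  N≤′ : N ≤ suc t * (b₁ + suc b₁)
  N≤′ = ≤-trans N≤ (≤-reflexive (cong (suc t *_) M≡))
  N<ib : N < suc (suc (t + t)) * suc b₁
  N<ib = ≤-trans (s≤s N≤′) (≤-trans (s≤s (m≤m+n _ t)) (≤-reflexive (lemma t b₁)))
    where
    lemma : ∀ t b → suc (suc t * (b + suc b) + t) ≡ suc (suc (t + t)) * suc b
    lemma = solve-∀
  N<ec : N < e * c
  N<ec = <-trans (<-≤-trans N<ib (*-monoˡ-≤ (suc b₁) i≤3t)) e-large
  small-t : 4 * t ≤ b₁
  small-t = s≤s⁻¹ (lin (t ∷ s ∷ u ∷ ℓ ∷ []) (λ t s u ℓ →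
    (4 ⊠ t :≤ s) ∷ (4 ⊠ s :≤ u) ∷ (1 ⊠ con 1 :≤ u) ∷ (1 ⊠ u *: 100000000 :≤ ℓ) ∷ [] ⊢ (1 ⊠ con 1 :+ 4 :* t :≤ ℓ)) t≤s
        s≤u u>0 large)
  N<bb : N < suc b₁ * b₁
  N<bb = <-≤-trans N<ib (≤-trans (*-monoˡ-≤ (suc b₁) (≤-trans
    (lin (t ∷ []) (λ t → (1 ⊠ con 2 :≤ t) ∷ [] ⊢ (1 ⊠ con 2 :+ (t :+ t) :≤ 4 :* t)) t≥2) small-t))
        (≤-reflexive (*-comm b₁ (suc b₁))))
  M-bound : 4 * ℓ ≤ 3 * d + 2
  M-bound = ≤-trans (≤-reflexive (≡.trans (lemma b₁) (cong (λ z → 2 * z + 2) (sym M≡)))) (+-monoˡ-≤ 2 (2M≤3d t≥2))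
    where
    lemma : ∀ b → 4 * suc b ≡ 2 * (b + suc b) + 2
    lemma = solve-∀
  κn : (1 + (t + t)) * (k + k) ≡ 2 * k + 4 * (t * k)
  κn = lemma t k
    where
    lemma : ∀ t k → (1 + (t + t)) * (k + k) ≡ 2 * k + 4 * (t * k)
    lemma = solve-∀
  cluster-room : ℓ + (k + k) + (1 + (t + t)) * (k + k) + (k + k) + t ≤ d
  cluster-room = lin (ℓ ∷ k ∷ (1 + (t + t)) * (k + k) ∷ t ∷ d ∷ t * k ∷ []) (λ b k p t d tk →
      (1 ⊠ 12 :* tk :+ 18 :* k :+ 3 :* t :+ con 2 :≤ b) ∷ (1 ⊠ 4 :* b :≤ 3 :* d :+ con 2) ∷
          (3 ⊠ p :≤ 2 :* k :+ 4 :* tk) ∷ [] ⊢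
      (3 ⊠ b :+ (k :+ k) :+ p :+ (k :+ k) :+ t :≤ d))
    k-bound M-bound (≤-reflexive κn)
  t≤k : t ≤ k
  t≤k = lin (t ∷ k ∷ x ∷ A ∷ []) (λ t k x A →
      (1 ⊠ con 6 :+ 6 :* t :≤ x) ∷ [] ⊢ (1 ⊠ t :≤ con 2 :+ 3 :* A :+ (con 1 :+ x :+ (con 2 :+ x) :+
          (con 1 :+ 3 :* (3 :* (con 1 :+ x :+ (con 1 :+ x)))))))
    (≤-reflexive (sym x-def))
    where A = (e + i * c) * suc x
  dirac-room : ℓ + t + t + (k + k) ≤ d
  dirac-room = lin (ℓ ∷ k ∷ (1 + (t + t)) * (k + k) ∷ t ∷ d ∷ []) (λ b k p t d →
      (1 ⊠ b :+ (k :+ k) :+ p :+ (k :+ k) :+ t :≤ d) ∷ (1 ⊠ t :≤ k) ∷ [] ⊢ (1 ⊠ b :+ t :+ t :+ (k :+ k) :≤ d))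
          cluster-room t≤k
  core-size : t * suc (3 * t) ≤ d
  core-size = ≤-trans (lin (t * suc (3 * t) ∷ t ∷ s ∷ u ∷ ℓ ∷ []) (λ z t s u ℓ →
      (1 ⊠ z :≤ 3 :* s :+ t) ∷ (1 ⊠ t :≤ s) ∷ (4 ⊠ s :≤ u) ∷ (1 ⊠ u *: 100000000 :≤ ℓ) ∷ [] ⊢ (1 ⊠ z :≤ ℓ))
      (≤-reflexive (lemma t)) t≤s s≤u large)
    (≤-trans (≤-trans (m≤m+n ℓ (t + t + (k + k))) (≤-reflexive (regroup ℓ t (k + k)))) dirac-room)
    where
    lemma : ∀ t → t * suc (3 * t) ≡ 3 * (t * t) + t
    lemma = solve-∀
    regroup : ∀ a b c → a + (b + b + c) ≡ a + b + b + c
    regroup = solve-∀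
  noCycle′ : ¬ ContainsCycle (2 * ℓ) G → ¬ ContainsCycle (ℓ + ℓ) G
  noCycle′ = subst (λ z → ¬ ContainsCycle z G) (cong (λ z → suc (b₁ + suc z)) (+-identityʳ b₁))
  impossible : ¬ ContainsCycle (2 * ℓ) G → (∀ v → d ≤ # (adj G v)) → ⊥
  -- Rounds of separation: 1 + 2t, as N < (2t + 2) ℓ. Core threshold: 3t + 1, so that after losing t
  -- neighbours in `S` and t vertices left out, t + 1 neighbours remain.
  impossible noCycle degrees = Main.upperBound G b₁ (1 + (t + t)) c e t (3 * t) d k N<ib N<ec N<bb ≤-refl
      spread-bound (noCycle′ noCycle)
    t>0 core-size dirac-room (≤-reflexive (cong suc (lemma t))) (≤-trans (≤-trans (m≤n*m t 4) small-t) (n≤1+n b₁))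
        cluster-room degrees N≤[1+t]d
    (<-≤-trans (s≤s (≤-reflexive (cong (t *_) (sym M≡)))) tM<N)
    where
    lemma : ∀ t → t + t + t ≡ 3 * t
    lemma = solve-∀
  cases : ComplContainsStar n G ⊎ (∀ v → d ≤ # (adj G v)) → Dec (ContainsCycle (2 * ℓ) G) → ContainsCycle (2 * ℓ) G ⊎
      ComplContainsStar n G
  cases (inj₁ star) _ = inj₂ star
  cases (inj₂ degrees) (yes cycle) = inj₁ cycle
  cases (inj₂ degrees) (no noCycle) = ⊥-elim (impossible noCycle degrees)

-- The lower bound

next-inject₁ : ∀ {m} (i : Fin m) → next (inject₁ i) ≡ suc i
next-inject₁ {suc m} zero = refl
next-inject₁ {suc (suc m)} (suc i) rewrite next-inject₁ {suc m} i = refl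

next-last : ∀ m → next (fromℕ m) ≡ zero
next-last zero = refl
next-last (suc m) rewrite next-last m = refl

tabulatePath : ∀ {N} {G : Graph N} m (g : Fin (suc m) → Fin N) → (∀ i → Adj G (g (inject₁ i)) (g (suc i))) →
  Path G (g zero) (g (fromℕ m)) (tabulate g)
tabulatePath zero g h = end
tabulatePath (suc m) g h = step (h zero) (tabulatePath m (g ∘ suc) (h ∘ suc))

fromCycle : ∀ {N} {G : Graph N} {m} → ContainsCycle (suc m) G → Σ (Fin (suc m) → Fin N) λ φ →
  Injective _≡_ _≡_ φ × Unique (tabulate φ) × Cyclic G (tabulate φ)
fromCycle {G = G} {m} (φ , inj , edges) = φ , inj , UniqueP.tabulate⁺ inj , φ zero , φ (fromℕ m) ,
  tabulatePath m φ (λ i → subst (λ j → Adj G (φ (inject₁ i)) (φ j)) (next-inject₁ i) (edges (inject₁ i))) ,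
  subst (λ j → Adj G (φ (fromℕ m)) (φ j)) (next-last m) (edges (fromℕ m))

injective-# : ∀ {N m} (p : Sub N) (ψ : Fin m → Fin N) → Injective _≡_ _≡_ ψ → (∀ i → p (ψ i) ≡ true) → m ≤ # p
injective-# p ψ inj h = ≤-trans (≤-reflexive (sym (length-tabulate ψ))) (unique-length p (UniqueP.tabulate⁺ inj)
    (AllP.tabulate⁺ h))

-- The leaves of a star in the complement are disjoint from the closed neighbourhood of its centre.
noStar : ∀ {N} (G : Graph N) n s → N < n + s →
  (∀ v → Σ (Fin s → Fin N) λ χ → Injective _≡_ _≡_ χ × (∀ j → χ j ≡ v ⊎ Adj G v (χ j))) → ¬ ComplContainsStar n G
noStar {N} G n s small χ (v , ψ , ψ-inj , ψ≢v , far) = <⇒≱ small (≤-trans (+-mono-≤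
  (injective-# away ψ ψ-inj (λ i → ∧-intro (cong not (dec-false (ψ i ≟ v) (ψ≢v i))) (cong not (far i))))
  (injective-# close (proj₁ (χ v)) (proj₁ (proj₂ (χ v))) (λ j → near (proj₂ (proj₂ (χ v)) j))))
  (≤-trans (wt-disjoint (λ _ → 1) {p = away} {q = close} {r = λ _ → true} (λ _ _ → refl) (λ _ _ → refl) apart)
      (#≤n (λ _ → true))))
  where
  away close : Sub N
  away u = not (does (u ≟ v)) ∧ not (adj G v u)
  close u = does (u ≟ v) ∨ adj G v u
  near : ∀ {u} → u ≡ v ⊎ Adj G v u → close u ≡ true
  near {u} (inj₁ u≡v) = ∨-introˡ (dec-true (u ≟ v) u≡v)
  near {u} (inj₂ e) = ∨-introʳ e
  apart : ∀ u → away u ≡ true → close u ≡ true → ⊥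
  apart u h h′ with ∧-elim {not (does (u ≟ v))} h
  ... | u≢v , ¬e with ∨-elim {does (u ≟ v)} h′
  ... | inj₁ u≡v = true≢false u≡v (not-elim u≢v)
  ... | inj₂ e = true≢false e (not-elim ¬e)

sameClass : ∀ {n c} → (Fin n → Fin c) → Fin n → Fin n → Bool
sameClass lab u v = does (lab u ≟ lab v) ∧ not (does (u ≟ v))

sameClass-sym : ∀ {n c} (lab : Fin n → Fin c) u v → sameClass lab u v ≡ sameClass lab v u
sameClass-sym lab u v rewrite does-sym (lab u) (lab v) | does-sym u v = refl

sameClass-irrefl : ∀ {n c} (lab : Fin n → Fin c) v → sameClass lab v v ≡ false
sameClass-irrefl lab v rewrite dec-true (lab v ≟ lab v) refl | dec-true (v ≟ v) refl = refl

sameClass-elim : ∀ {n c} (lab : Fin n → Fin c) {u v} → sameClass lab u v ≡ true → lab u ≡ lab v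
sameClass-elim lab {u} {v} h = does-true {d = lab u ≟ lab v} (proj₁ (∧-elim h))

sameClass-intro : ∀ {n c} (lab : Fin n → Fin c) {u v} → lab u ≡ lab v → v ≡ u ⊎ sameClass lab u v ≡ true
sameClass-intro lab {u} {v} eq with u ≟ v
... | yes u≡v = inj₁ (sym u≡v)
... | no u≢v = inj₂ (∧-intro (dec-true (lab u ≟ lab v) eq) refl)

module Cliques (t M : ℕ) where

  class : Fin (t * M) → Fin t
  class u = proj₁ (remQuot {t} M u)

  cliques : Graph (t * M)
  cliques = record { adj = sameClass class ; sym = sameClass-sym class ; irrefl = sameClass-irrefl class }

  path-class : ∀ {u v xs} → Path cliques u v xs → ∀ {x} → x ∈ xs → class x ≡ class u
  path-class end (here refl) = refl
  path-class (step e p) (here refl) = refl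
  path-class (step e p) (there i) = ≡.trans (path-class p i) (sym (sameClass-elim class e))

  -- A cycle stays in one class, where the second coordinate tells the vertices apart and takes only
  -- `M` values.
  noCycle : ¬ ContainsCycle (suc M) cliques
  noCycle cyc with fromCycle cyc
  ... | φ , inj , _ , (u , v , p , _) = 1+n≰n (injective⇒≤ {f = λ i → proj₂ (remQuot {t} M (φ i))} λ {i} {j} eq →
    inj (≡.trans (sym (combine-remQuot {t} M (φ i))) (≡.trans (≡.cong₂ combine
      (≡.trans (path-class p (∈-tabulate⁺ {f = φ} i)) (sym (path-class p (∈-tabulate⁺ {f = φ} j)))) eq)
          (combine-remQuot {t} M (φ j)))))

  closed-neighbourhood : ∀ v → Σ (Fin M → Fin (t * M)) λ χ → Injective _≡_ _≡_ χ × (∀ j → χ j ≡ v ⊎ Adj cliques v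
      (χ j))
  closed-neighbourhood v = combine (class v) , inj , λ j → sameClass-intro class
      (sym (cong proj₁ (remQuot-combine (class v) j)))
    where
    inj : Injective _≡_ _≡_ (combine (class v))
    inj {j} {j′} eq = ≡.trans (sym (cong proj₂ (remQuot-combine (class v) j)))
      (≡.trans (cong (proj₂ ∘ remQuot {t} M) eq) (cong proj₂ (remQuot-combine (class v) j′)))

-- The vertex zero is joined to all vertices of the classes r, …, t, which have q vertices;
-- the classes 0, …, r - 1 have q + 1 vertices.
module Windmill (t q r : ℕ) (r≤t : r ≤ t) where

  private
    P : ℕ
    P = suc t * q + r

  -- Index zero is kept for the additional vertex of the classes below `r`. In the other blocks the
  -- hub takes this place, so `position` numbers every block by `Fin (suc q)`.
  locate : Fin (suc t * q) ⊎ Fin r → Fin (suc t) × Fin (suc q)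
  locate (inj₁ a) = proj₁ (remQuot {suc t} q a) , suc (proj₂ (remQuot {suc t} q a))
  locate (inj₂ e) = inject≤ e (m≤n⇒m≤1+n r≤t) , zero

  place : Fin P → Fin (suc t) × Fin (suc q)
  place u = locate (splitAt (suc t * q) u)

  class : Fin P → Fin (suc t)
  class = proj₁ ∘ place

  index : Fin P → Fin (suc q)
  index = proj₂ ∘ place

  private
    place-inl : ∀ c j → place (combine c j ↑ˡ r) ≡ (c , suc j)
    place-inl c j = ≡.trans (cong locate (splitAt-↑ˡ (suc t * q) (combine c j) r))
      (cong (λ (c , j) → c , suc j) (remQuot-combine {suc t} {q} c j))

    place-inr : ∀ e → place ((suc t * q) ↑ʳ e) ≡ (inject≤ e (m≤n⇒m≤1+n r≤t) , zero)
    place-inr e = cong locate (splitAt-↑ʳ (suc t * q) r e)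

  unplace : ∀ u → (∃₂ λ c j → u ≡ combine {suc t} {q} c j ↑ˡ r) ⊎ ∃ λ e → u ≡ (suc t * q) ↑ʳ e
  unplace u with splitAt (suc t * q) u | join-splitAt (suc t * q) r u
  ... | inj₁ a | eq = inj₁ (proj₁ (remQuot {suc t} q a) , proj₂ (remQuot {suc t} q a) ,
    ≡.trans (sym eq) (cong (_↑ˡ r) (sym (combine-remQuot {suc t} q a))))
  ... | inj₂ e | eq = inj₂ (e , sym eq)

  place-injective : ∀ {u v} → place u ≡ place v → u ≡ v
  place-injective {u} {v} eq with unplace u | unplace v
  ... | inj₁ (c , j , refl) | inj₁ (c′ , j′ , refl) with ≡.trans (sym (place-inl c j)) (≡.trans eq (place-inl c′ j′))
  ... | refl = refl
  place-injective {u} {v} eq | inj₁ (c , j , refl) | inj₂ (e , refl) with ≡.trans (sym (place-inl c j))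
      (≡.trans eq (place-inr e))
  ... | ()
  place-injective {u} {v} eq | inj₂ (e , refl) | inj₁ (c , j , refl) with ≡.trans (sym (place-inr e))
      (≡.trans eq (place-inl c j))
  ... | ()
  place-injective {u} {v} eq | inj₂ (e , refl) | inj₂ (e′ , refl) =
    cong ((suc t * q) ↑ʳ_) (inject≤-injective _ _ e e′ (cong proj₁ (≡.trans (sym (place-inr e))
        (≡.trans eq (place-inr e′)))))

  index-zero : ∀ u → index u ≡ zero → toℕ (class u) < r
  index-zero u h with unplace u
  ... | inj₂ (e , refl) = subst (_< r) (≡.trans (sym (toℕ-inject≤ e (m≤n⇒m≤1+n r≤t)))
      (cong (toℕ ∘ proj₁) (sym (place-inr e)))) (toℕ<n e)
  ... | inj₁ (c , j , refl) with ≡.trans (cong proj₂ (sym (place-inl c j))) h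
  ... | ()

  hubAdj : Fin P → Bool
  hubAdj u = does (r ≤? toℕ (class u))

  windmill : Graph (suc P)
  windmill = record { adj = a ; sym = s ; irrefl = λ { zero → refl ; (suc v) → sameClass-irrefl class v } }
    where
    a : Fin (suc P) → Fin (suc P) → Bool
    a zero zero = false
    a zero (suc v) = hubAdj v
    a (suc u) zero = hubAdj u
    a (suc u) (suc v) = sameClass class u v
    s : ∀ u v → a u v ≡ a v u
    s zero zero = refl
    s zero (suc v) = refl
    s (suc u) zero = refl
    s (suc u) (suc v) = sameClass-sym class u v

  -- By uniqueness the hub occurs only at the end, so the path stays in its first class until then,
  -- and its last edge shows that this class is joined to the hub.
  hub-path : ∀ {u xs} → Path windmill (suc u) zero xs → Unique xs →
    r ≤ toℕ (class u) × (∀ {x} → suc x ∈ xs → class x ≡ class u)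
  hub-path {u} (step {zero} e end) _ = does-true {d = r ≤? toℕ (class u)} e , λ
      { (here refl) → refl ; (there (here ())) }
  hub-path (step {zero} e (step f p)) (_ ∷ z≢ ∷ _) = ⊥-elim (All.lookup z≢ (end∈ p) refl)
  hub-path {u} (step {suc w} e p) (_ ∷ uq) with hub-path p uq
  ... | r≤ , same = subst (λ c → r ≤ toℕ c) (sym cu≡cw) r≤ , λ { (here refl) → refl ; (there i) → ≡.trans (same i)
      (sym cu≡cw) }
    where
    cu≡cw : class u ≡ class w
    cu≡cw = sameClass-elim class e

  hubless-path : ∀ {u v xs} → Path windmill u v xs → zero ∉ xs → ∀ {x y} → suc x ∈ xs → suc y ∈ xs → class x ≡ class y
  hubless-path {u} {v} {xs} p hub∉ i j = ≡.trans (same p hub∉ i) (sym (same p hub∉ j))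
    where
    start-class : Fin (suc P) → Fin (suc t)
    start-class zero = zero
    start-class (suc u) = class u
    same : ∀ {u v xs} → Path windmill u v xs → zero ∉ xs → ∀ {x} → suc x ∈ xs → class x ≡ start-class u
    same end _ (here refl) = refl
    same (step e p) _ (here refl) = refl
    same {u} (step {w} e p) hub∉ (there i) = ≡.trans (same p (hub∉ ∘ there) i)
        (sym (edge u w e (λ { refl → hub∉ (here refl) }) (λ { refl → hub∉ (there (start∈ p)) })))
      where
      edge : ∀ a b → Adj windmill a b → a ≢ zero → b ≢ zero → start-class a ≡ start-class b
      edge zero b _ a≢ _ = ⊥-elim (a≢ refl)
      edge (suc a) zero _ _ b≢ = ⊥-elim (b≢ refl)
      edge (suc a) (suc b) e _ _ = sameClass-elim class e

  position : Fin (suc P) → Fin (suc q)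
  position zero = zero
  position (suc u) = index u

  -- A cycle that avoids the hub, or is rotated so as to end there, lies in one block, where
  -- `position` takes at most `suc q` values without repetition.
  noCycle : ∀ {m} → suc q ≤ m → ¬ ContainsCycle (suc m) windmill
  noCycle {m} q<m cyc with fromCycle cyc
  ... | φ , inj , uq , cyclic = <⇒≱ (s≤s q<m) (injective⇒≤ {f = position ∘ φ}
      (λ {i} {j} eq → inj (distinct (∈-tabulate⁺ {f = φ} i) (∈-tabulate⁺ {f = φ} j) eq)))
    where
    Facts : Set
    Facts = (∀ {x y} → suc x ∈ tabulate φ → suc y ∈ tabulate φ → class x ≡ class y) ×
      (∀ {x} → zero ∈ tabulate φ → suc x ∈ tabulate φ → r ≤ toℕ (class x))
    rotated : (∃₂ λ u ys → Path windmill u zero ys × ys ↭ tabulate φ) → Facts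
    rotated (zero , _ , end , perm) = (λ i _ → ⊥-elim (nothing (∈-resp-↭ (↭-sym perm) i))) , λ _ i → ⊥-elim
        (nothing (∈-resp-↭ (↭-sym perm) i))
      where
      nothing : ∀ {x : Fin P} → suc x ∈ zero ∷ [] → ⊥
      nothing (here ())
      nothing (there ())
    rotated (zero , _ , step e p , perm) with Unique-resp-↭ (↭-sym perm) uq
    ... | z≢ ∷ _ = ⊥-elim (All.lookup z≢ (end∈ p) refl)
    rotated (suc u , ys , p , perm) with hub-path p (Unique-resp-↭ (↭-sym perm) uq)
    ... | r≤ , same = (λ i j → ≡.trans (same (∈-resp-↭ (↭-sym perm) i)) (sym (same (∈-resp-↭ (↭-sym perm) j)))) ,
      λ _ i → subst (λ c → r ≤ toℕ c) (sym (same (∈-resp-↭ (↭-sym perm) i))) r≤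
    facts : Facts
    facts with zero ∈? tabulate φ
    ... | yes hub∈ = rotated (rotate cyclic hub∈)
    ... | no hub∉ = hubless-path (proj₁ (proj₂ (proj₂ cyclic))) hub∉ , λ hub∈ _ → ⊥-elim (hub∉ hub∈)
    distinct : ∀ {x y} → x ∈ tabulate φ → y ∈ tabulate φ → position x ≡ position y → x ≡ y
    distinct {zero} {zero} _ _ _ = refl
    -- The hub and an additional vertex share position zero, but the latter lies in a class below
    -- `r`, which no cycle through the hub meets.
    distinct {zero} {suc y} i j eq = ⊥-elim (<⇒≱ (index-zero y (sym eq)) (proj₂ facts i j))
    distinct {suc x} {zero} i j eq = ⊥-elim (<⇒≱ (index-zero x eq) (proj₂ facts j i))
    distinct {suc x} {suc y} i j eq = cong suc (place-injective (≡.cong₂ _,_ (proj₁ facts i j) eq))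

  closed-neighbourhood : ∀ v → Σ (Fin (suc q) → Fin (suc P)) λ χ → Injective _≡_ _≡_ χ ×
      (∀ j → χ j ≡ v ⊎ Adj windmill v (χ j))
  closed-neighbourhood = neighbourhood
    where
    member : Fin (suc t) → Fin q → Fin P
    member c j = combine c j ↑ˡ r
    member-class : ∀ c j → class (member c j) ≡ c
    member-class c j = cong proj₁ (place-inl c j)
    withHub : Fin (suc t) → Fin (suc q) → Fin (suc P)
    withHub c zero = zero
    withHub c (suc j) = suc (member c j)
    withExtra : Fin (suc t) → Fin r → Fin (suc q) → Fin (suc P)
    withExtra c e zero = suc ((suc t * q) ↑ʳ e)
    withExtra c e (suc j) = suc (member c j)
    position-withHub : ∀ c j → position (withHub c j) ≡ j
    position-withHub c zero = refl
    position-withHub c (suc j) = cong proj₂ (place-inl c j)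
    position-withExtra : ∀ c e j → position (withExtra c e j) ≡ j
    position-withExtra c e zero = cong proj₂ (place-inr e)
    position-withExtra c e (suc j) = cong proj₂ (place-inl c j)
    injective : (χ : Fin (suc q) → Fin (suc P)) → (∀ j → position (χ j) ≡ j) → Injective _≡_ _≡_ χ
    injective χ h {i} {j} eq = ≡.trans (sym (h i)) (≡.trans (cong position eq) (h j))
    suc-near : ∀ {u v} → class u ≡ class v → suc v ≡ suc u ⊎ Adj windmill (suc u) (suc v)
    suc-near eq with sameClass-intro class eq
    ... | inj₁ v≡u = inj₁ (cong suc v≡u)
    ... | inj₂ e = inj₂ e
    neighbourhood : ∀ v → Σ (Fin (suc q) → Fin (suc P)) λ χ → Injective _≡_ _≡_ χ × (∀ j → χ j ≡ v ⊎ Adj windmill v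
        (χ j))
    -- The last class is always joined to the hub because `r ≤ t`.
    neighbourhood zero = withHub (fromℕ t) , injective _ (position-withHub (fromℕ t)) , λ
      { zero → inj₁ refl
      ; (suc j) → inj₂ (dec-true (r ≤? toℕ (class (member (fromℕ t) j)))
          (≤-trans r≤t (≤-reflexive (≡.trans (sym (toℕ-fromℕ t)) (cong toℕ (sym (member-class (fromℕ t) j))))))) }
    neighbourhood (suc u) with r ≤? toℕ (class u)
    ... | yes r≤ = withHub (class u) , injective _ (position-withHub (class u)) , λ
      { zero → inj₂ (dec-true (r ≤? toℕ (class u)) r≤) ; (suc j) → suc-near (sym (member-class (class u) j)) }
    ... | no r≰ = withExtra (class u) extra , injective _ (position-withExtra (class u) extra) , λ
      { zero → suc-near (toℕ-injective (≡.trans (sym (toℕ-fromℕ< (≰⇒> r≰)))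
          (≡.trans (sym (toℕ-inject≤ extra (m≤n⇒m≤1+n r≤t))) (cong (toℕ ∘ proj₁) (sym (place-inr extra))))))
      ; (suc j) → suc-near (sym (member-class (class u) j)) }
      where
      extra : Fin r
      extra = fromℕ< (≰⇒> r≰)

Arrows-mono : ∀ {ℓ n N N′} → N ≤ N′ → Arrows ℓ n N → Arrows ℓ n N′
Arrows-mono {ℓ} {n} {N} {N′} N≤N′ arrows G = lift (arrows H)
  where
  ι : Fin N → Fin N′
  ι u = inject≤ u N≤N′
  H : Graph N
  H = record { adj = λ u v → adj G (ι u) (ι v) ; sym = λ u v → Graph.sym G (ι u) (ι v) ; irrefl = λ v → irrefl G
      (ι v) }
  ι-injective : ∀ {u v} → ι u ≡ ι v → u ≡ v
  ι-injective {u} {v} = inject≤-injective N≤N′ N≤N′ u v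
  lift : ContainsCycle (2 * ℓ) H ⊎ ComplContainsStar n H → ContainsCycle (2 * ℓ) G ⊎ ComplContainsStar n G
  lift (inj₁ (φ , inj , edges)) = inj₁ (ι ∘ φ , (λ eq → inj (ι-injective eq)) , edges)
  lift (inj₂ (v , ψ , inj , ψ≢v , far)) = inj₂ (ι v , ι ∘ ψ , (λ eq → inj (ι-injective eq)) ,
      (λ i eq → ψ≢v i (ι-injective eq)) , far)

lowerBound : ∀ t ℓ n .{{_ : NonZero t}} → 1 ≤ t → 1 ≤ n → (t ∸ 1) * (2 * ℓ ∸ 1) ≤ n ∸ 1 → n ∸ 1 < t * (2 * ℓ ∸ 1) →
  ∀ N → Arrows ℓ n N → suc (f t ℓ n) ≤ N
lowerBound t zero n t>0 n>0 low high N arrows = ⊥-elim (n≮0 (<-≤-trans high (≤-reflexive (*-zeroʳ t))))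
lowerBound (suc t) ℓ@(suc b) n _ n>0 low high N arrows = ≰⇒> λ N≤f → refute (≤-total N (suc t * M)) N≤f
  where
  M q r : ℕ
  M = 2 * ℓ ∸ 1
  q = (n ∸ 1) / suc t
  r = (n ∸ 1) % suc t
  n≡ : n ≡ suc (n ∸ 1)
  n≡ = sym (m+[n∸m]≡n n>0)
  r≤t : r ≤ t
  r≤t = s≤s⁻¹ (m%n<n (n ∸ 1) (suc t))
  q<M : q < M
  q<M = m<n*o⇒m/o<n (<-≤-trans high (≤-reflexive (*-comm (suc t) M)))
  -- The non-neighbours of a vertex fill the other `t` cliques, and `t * M ≤ n ∸ 1` by the lower
  -- bound on `n`.
  not-cliques : ¬ Arrows ℓ n (suc t * M)
  not-cliques arrows with arrows (Cliques.cliques (suc t) M)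
  ... | inj₁ cyc = Cliques.noCycle (suc t) M cyc
  ... | inj₂ star = noStar (Cliques.cliques (suc t) M) n M
    (lin (n ∷ n ∸ 1 ∷ M ∷ t * M ∷ []) (λ n p m x → (1 ⊠ con 1 :+ p :≤ n) ∷ (1 ⊠ x :≤ p) ∷ [] ⊢
        (1 ⊠ con 1 :+ (m :+ x) :≤ n :+ m))
      (≤-reflexive (sym n≡)) low) (Cliques.closed-neighbourhood (suc t) M) star
  -- By division with remainder the graph has `n + q` vertices. Each closed neighbourhood contains
  -- at least `q + 1` of them, which leaves at most n - 1 non-neighbours.
  not-windmill : ¬ Arrows ℓ n (n + q)
  not-windmill arrows with subst (Arrows ℓ n) size arrows (Windmill.windmill (suc t) q r (m≤n⇒m≤1+n r≤t))
    where
    size : n + q ≡ suc (suc (suc t) * q + r)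
    size = ≡.trans (cong (_+ q) n≡) (cong suc (≡.trans (cong (_+ q) (m≡m%n+[m/n]*n (n ∸ 1) (suc t))) (lemma r q t)))
      where
      lemma : ∀ r q t → r + q * suc t + q ≡ suc (suc t) * q + r
      lemma = solve-∀
  ... | inj₁ cyc = Windmill.noCycle (suc t) q r (m≤n⇒m≤1+n r≤t) q<M cyc
  ... | inj₂ star = noStar (Windmill.windmill (suc t) q r (m≤n⇒m≤1+n r≤t)) n (suc q)
    (≤-reflexive (≡.trans (cong suc (≡.trans (cong suc (lemma r q t)) refl))
        (sym (≡.trans (+-suc n q) (cong (λ k → suc (k + q))
      (≡.trans n≡ (cong suc (m≡m%n+[m/n]*n (n ∸ 1) (suc t)))))))))
    (Windmill.closed-neighbourhood (suc t) q r (m≤n⇒m≤1+n r≤t)) star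
    where
    lemma : ∀ r q t → suc (suc t) * q + r ≡ r + q * suc t + q
    lemma = solve-∀
  refute : N ≤ suc t * M ⊎ suc t * M ≤ N → N ≤ f (suc t) ℓ n → ⊥
  refute (inj₁ N≤) _ = not-cliques (Arrows-mono {ℓ} N≤ arrows)
  refute (inj₂ ≤N) N≤f with ≤-total (suc t * M) (n + q)
  ... | inj₁ le = not-windmill (Arrows-mono {ℓ} (≤-trans N≤f (≤-reflexive (m≤n⇒m⊔n≡n le))) arrows)
  ... | inj₂ ge = not-cliques (Arrows-mono {ℓ} (≤-trans N≤f (≤-reflexive (m≥n⇒m⊔n≡m ge))) arrows)

theorem1 : (t ℓ n : ℕ) → .{{_ : NonZero t}} → 2 ≤ t → (191 ^ 9) * (t ^ 9) ≤ (10 ^ 9) * ℓ → 1 ≤ n → (t ∸ 1) * (2 * ℓ ∸ 1) ≤ n ∸ 1 → n ∸ 1 < t * (2 * ℓ ∸ 1) → IsRamseyCycleStar ℓ n (suc (f t ℓ n))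
theorem1 t ℓ n t≥2 large n>0 low high = upperBound t ℓ n t≥2 (sixth-power t ℓ t>0 large) n>0 high , lowerBound t ℓ n
    t>0 n>0 low high
  where
  t>0 : 1 ≤ t
  t>0 = ≤-trans (s≤s z≤n) t≥2
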